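{- Let $d$ be a positive integer and let $G$ be an $n$-vertex $\Delta$-critical graph with minimum degree at least $d$ and maximum degree $\Delta=\Delta(G)\ge (d+2)^{5d+10}$. Then $\alpha(G)<\frac{7n}{12}$ if $d=3$; $\alpha(G)<\frac{4n}{7}$ if $d=4$; and $\alpha(G)<\frac{d+2+\sqrt[3]{(d-1)d}}{2d+4+\sqrt[3]{(d-1)d}}\,n$ if $d\ge 19$.
   Context: All graphs are finite and simple. $\Delta(G)$ is the maximum degree, $\chi'(G)$ the chromatic index, and $\alpha(G)$ the independence number of $G$. A graph $G$ is $\Delta$-critical if $G$ is connected, $\chi'(G)=\Delta(G)+1$, and $\chi'(G-e)=\Delta(G)$ for every edge $e\in E(G)$. -}

module Defs where

open import Data.Nat using (ℕ; zero; suc; _+_; _*_; _∸_; _^_; _≤_; _<_; _⊔_)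
open import Data.Bool using (Bool; true; false; _∧_; _∨_; not; if_then_else_)
open import Data.Bool.Properties using (∧-comm; ∨-comm)
open import Data.Fin using (Fin; _≟_)
open import Data.Fin.Subset using (Subset; _∈_; ∣_∣)
open import Data.List using (List; allFin; map; foldr)
open import Data.Nat.ListAction using (sum)
open import Data.Product using (Σ; _×_; ∃)
open import Relation.Nullary using (¬_; ⌊_⌋)
open import Relation.Binary.PropositionalEquality using (_≡_; _≢_; refl; cong)

record Graph (n : ℕ) : Set where
  field
    adj    : Fin n → Fin n → Bool
    sym    : ∀ u v → adj u v ≡ adj v u
    irrefl : ∀ v → adj v v ≡ false
open Graph public

deg : ∀ {n} → Graph n → Fin n → ℕ
deg {n} G v = sum (map (λ u → if adj G v u then 1 else 0) (allFin n))

maxDeg : ∀ {n} → Graph n → ℕ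
maxDeg {n} G = foldr _⊔_ 0 (map (deg G) (allFin n))

data Reach {n} (G : Graph n) (u : Fin n) : Fin n → Set where
  here : Reach G u u
  step : ∀ {v w} → Reach G u v → adj G v w ≡ true → Reach G u w

Connected : ∀ {n} → Graph n → Set
Connected {n} G = ∀ (u v : Fin n) → Reach G u v

record EdgeColouring {n} (G : Graph n) (k : ℕ) : Set where
  field
    col    : Fin n → Fin n → Fin k
    colSym : ∀ u v → adj G u v ≡ true → col u v ≡ col v u
    proper : ∀ u v w → adj G u v ≡ true → adj G u w ≡ true → v ≢ w
             → col u v ≢ col u w

ChromaticIndex : ∀ {n} → Graph n → ℕ → Set
ChromaticIndex G k = EdgeColouring G k × (∀ j → j < k → ¬ EdgeColouring G j)

isE : ∀ {n} → Fin n → Fin n → Fin n → Fin n → Bool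
isE u v x y = (⌊ x ≟ u ⌋ ∧ ⌊ y ≟ v ⌋) ∨ (⌊ x ≟ v ⌋ ∧ ⌊ y ≟ u ⌋)

isE-sym : ∀ {n} (u v x y : Fin n) → isE u v x y ≡ isE u v y x
isE-sym u v x y
  rewrite ∧-comm ⌊ x ≟ u ⌋ ⌊ y ≟ v ⌋ | ∧-comm ⌊ x ≟ v ⌋ ⌊ y ≟ u ⌋
  = ∨-comm (⌊ y ≟ v ⌋ ∧ ⌊ x ≟ u ⌋) (⌊ y ≟ u ⌋ ∧ ⌊ x ≟ v ⌋)

removeEdge : ∀ {n} → Graph n → Fin n → Fin n → Graph n
removeEdge G u v = record
  { adj    = λ x y → adj G x y ∧ not (isE u v x y)
  ; sym    = λ x y → cong₂' (sym G x y) (cong not (isE-sym u v x y))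
  ; irrefl = λ x → cong (_∧ not (isE u v x x)) (irrefl G x)
  }
  where
  cong₂' : ∀ {a b c d : Bool} → a ≡ b → c ≡ d → a ∧ c ≡ b ∧ d
  cong₂' refl refl = refl

Critical : ∀ {n} → Graph n → Set
Critical G =
  Connected G
  × ChromaticIndex G (suc (maxDeg G))
  × (∀ u v → adj G u v ≡ true → ChromaticIndex (removeEdge G u v) (maxDeg G))

Independent : ∀ {n} → Graph n → Subset n → Set
Independent G S = ∀ u v → u ∈ S → v ∈ S → adj G u v ≡ false

IndependenceNumber : ∀ {n} → Graph n → ℕ → Set
IndependenceNumber G a =
  (Σ _ λ S → Independent G S × ∣ S ∣ ≡ a)
  × (∀ S → Independent G S → ∣ S ∣ ≤ a)

-- α < (d+2+c)/(2d+4+c) · n with c = ((d-1)d)^(1/3), written without reals: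
-- with L = α(2d+4) - (d+2)n and R = n - α ≥ 0 the inequality is L < c·R,
-- i.e. L < 0, or L ≥ 0 and L³ < (d-1)d·R³.
CubeRootBound : ℕ → ℕ → ℕ → Set
CubeRootBound d n a =
  let L = a * (2 * d + 4) ∸ (d + 2) * n
      R = n ∸ a
  in (a * (2 * d + 4) < (d + 2) * n)
     Data.Sum.⊎ (L ^ 3 < (d ∸ 1) * d * R ^ 3)
  where import Data.Sum

-- Delete an edge xy of the Δ-critical graph and colour the rest with Δ colours.  Fix a vertex x of
-- small degree k.  A vertex of small degree misses almost every colour, so the colour of an edge from
-- a neighbour of x to such a vertex can be exchanged for a missing one by a Kempe change.  Hence
-- Vizing's fan argument at x works as if these colours were missing: they are disjoint over the fan
-- of y, which bounds the sum of the numbers t of small neighbours over a set R of neighbours of x,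
-- with y ∈ R, by 2|R| - 2.  Choosing y with t maximal gives Σ 1/t ≥ t - 1 + k/t over the neighbours
-- of x.  For low vertices whose degree is a constant fraction of Δ common missing colours exist by
-- averaging, which gives a weaker estimate with a lot of room.
-- In the discharging every vertex outside the independent set has (E+2)/E units to give, and
-- distributes 1/Δ to each neighbour of degree Δ and (E+2)/(EΔ) to all others; by Vizing's adjacency
-- lemma a vertex with a low neighbour saves almost 2/E, which it splits among its low neighbours.
-- So α/(n - α) < (E+2)/E, with E = 5 for d = 3, E = 6 for d = 4, and E = 2e for d ≥ 19, where
-- e² ≤ d and d + 10 ≤ e³.
module Submission where

open import Defs renaming (sym to adj-sym)
open import Algebra.Properties.Semiring.Sum using (*-distribˡ-sum)
open import Data.Bool as Bool using (Bool; true; false; not; if_then_else_; _∨_)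
open import Data.Bool.Properties using (∧-zeroʳ; ∨-zeroʳ)
open import Data.Empty using (⊥; ⊥-elim)
open import Data.Fin using (Fin; zero; suc; _≟_; toℕ; fromℕ<)
open import Data.Fin.Properties as Fin using (any?; pigeonhole; toℕ<n; toℕ-fromℕ<)
open import Data.Fin.Subset using (Subset; ∣_∣; inside; outside) renaming (_∈_ to _∈ₛ_)
open import Data.Fin.Subset.Properties using (drop-there; ∣p∣≤n) renaming (_∈?_ to _∈ₛ?_)
open import Data.List as List using (List; []; _∷_; length; allFin; tabulate; foldr)
open import Data.List.Membership.Propositional using (_∈_)
open import Data.List.Membership.Propositional.Properties using (∈-allFin)
open import Data.List.Properties using (map-tabulate)
open import Data.List.Relation.Unary.Any as Any using (here; there)
open import Data.Nat hiding (_≟_)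
import Data.Nat as ℕ
import Data.Nat.ListAction as ListAction
open import Data.Nat.Divisibility using (_∣_; ∣n⇒∣m*n; ∣m⇒∣m*n; m≤n⇒m!∣n!; ∣-trans; m∣m*n)
open import Data.Nat.DivMod
open import Data.Nat.Properties hiding (_≟_)
open import Data.Nat.Solver using (module +-*-Solver)
open import Data.Product using (Σ; _×_; _,_; ∃; proj₁; proj₂)
open import Data.Sum as Sum using (_⊎_; inj₁; inj₂)
open import Data.Unit using (⊤; tt)
open import Data.Vec using ([]; _∷_; there)
open import Function.Bundles using (mk⇔)
open import Relation.Binary.PropositionalEquality
open import Relation.Nullary
open import Relation.Nullary.Decidable using (dec-true; decidable-stable; does-⇔; toSum)
open import Algebra.Properties.CommutativeMonoid.Sum +-0-commutativeMonoid using (sum; ∑-comm; ∑-distrib-+)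
open import Algebra.Properties.CommutativeSemigroup +-commutativeSemigroup using (interchange; xy∙z≈xz∙y)

-- Counting over Fin n

-- Origin of `E`: a low vertex of degree Δ - s lacks at most s/Δ, and each neighbour y, having more
-- than s neighbours of degree Δ, saves more than 2s/(EΔ). So it suffices that the fractions of
-- their savings which the neighbours pass on to a low vertex add up to E/2. With fractions 1/t the
-- fan gives (d+2)/2 if all t are at most 2. Hence `E = d + 2` for d = 3 and d = 4 leaves no slack,
-- and this is the obstacle: y must also feed its low neighbours of larger degree ("mid"), but seems
-- unable to set anything aside for them. The way out is to root the fan at a y that has a mid
-- neighbour. The edge to it is exchangeable too, which adds 1/2 to the sum; a gain of 1/3 already
-- pays for a reserve of 2/(3E+2) at every vertex with mid neighbours. A mid vertex has so many
-- neighbours that tiny pieces of the reserves suffice, which leaves room for powers of d + 2. Only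
-- the root may use mid vertices: comparing two exchangeable edges takes a colour missing at x and
-- at both far ends, and counting provides it only if the three degrees add up to less than Δ.

𝟙 : ∀ {p} {P : Set p} → Dec P → ℕ
𝟙 d = if does d then 1 else 0

count : ∀ {n p} {P : Fin n → Set p} → (∀ i → Dec (P i)) → ℕ
count P? = sum (λ i → 𝟙 (P? i))

𝟙-yes : ∀ {p} {P : Set p} (d : Dec P) → P → 𝟙 d ≡ 1
𝟙-yes (yes _) _ = refl
𝟙-yes (no ¬p) p = ⊥-elim (¬p p)

𝟙-no : ∀ {p} {P : Set p} (d : Dec P) → ¬ P → 𝟙 d ≡ 0
𝟙-no (yes p) ¬p = ⊥-elim (¬p p)
𝟙-no (no _) _ = refl

𝟙≤1 : ∀ {p} {P : Set p} (d : Dec P) → 𝟙 d ≤ 1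
𝟙≤1 (yes _) = ≤-refl
𝟙≤1 (no _) = z≤n

𝟙-bound : ∀ {p} {P : Set p} (d : Dec P) {m} → (P → 1 ≤ m) → 𝟙 d ≤ m
𝟙-bound (yes p) f = f p
𝟙-bound (no _) _ = z≤n

𝟙-mono : ∀ {p q} {P : Set p} {Q : Set q} (d : Dec P) (e : Dec Q) → (P → Q) → 𝟙 d ≤ 𝟙 e
𝟙-mono d e f = 𝟙-bound d (λ p → ≤-reflexive (sym (𝟙-yes e (f p))))

sum-mono : ∀ {n} {f g : Fin n → ℕ} → (∀ i → f i ≤ g i) → sum f ≤ sum g
sum-mono {zero} h = z≤n
sum-mono {suc n} h = +-mono-≤ (h zero) (sum-mono (λ i → h (suc i)))

sum-cong : ∀ {n} {f g : Fin n → ℕ} → (∀ i → f i ≡ g i) → sum f ≡ sum g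
sum-cong {zero} h = refl
sum-cong {suc n} h = cong₂ _+_ (h zero) (sum-cong (λ i → h (suc i)))

sum-const : ∀ n c → sum {n} (λ _ → c) ≡ n * c
sum-const zero c = refl
sum-const (suc n) c = cong (c +_) (sum-const n c)

sum-+ : ∀ {n} (f g : Fin n → ℕ) → sum (λ i → f i + g i) ≡ sum f + sum g
sum-+ = ∑-distrib-+

sum-* : ∀ {n} c (f : Fin n → ℕ) → sum (λ i → c * f i) ≡ c * sum f
sum-* c f = sym (*-distribˡ-sum +-*-semiring c f)

sum-swap : ∀ {m n} (f : Fin m → Fin n → ℕ) → sum (λ i → sum (f i)) ≡ sum (λ j → sum (λ i → f i j))
sum-swap = ∑-comm

term≤sum : ∀ {n} (f : Fin n → ℕ) i → f i ≤ sum f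
term≤sum f zero = m≤m+n _ _
term≤sum f (suc i) = ≤-trans (term≤sum (λ j → f (suc j)) i) (m≤n+m _ _)

sum-pos : ∀ {n} (f : Fin n → ℕ) → 1 ≤ sum f → ∃ λ i → 1 ≤ f i
sum-pos {suc n} f h with 1 ≤? f zero
... | yes p = zero , p
... | no ¬p with sum-pos (λ j → f (suc j)) (subst (λ z → 1 ≤ z + sum (λ j → f (suc j))) (n<1⇒n≡0 (≰⇒> ¬p)) h)
...   | i , p = suc i , p

sum-pigeonhole : ∀ {n} (f : Fin n → ℕ) q → n * q < sum f → ∃ λ i → q < f i
sum-pigeonhole {n} f q h with any? (λ i → q <? f i)
... | yes p = p
... | no ¬p = ⊥-elim (<⇒≱ h (≤-trans (sum-mono (λ i → ≮⇒≥ (λ lt → ¬p (i , lt)))) (≤-reflexive (sum-const n q))))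

module _ {n p} {P : Fin n → Set p} (P? : ∀ i → Dec (P i)) where

  count-∃ : 1 ≤ count P? → ∃ P
  count-∃ h with sum-pos (λ i → 𝟙 (P? i)) h
  ... | i , q with P? i
  ...   | yes x = i , x

  count-pos : ∀ i → P i → 1 ≤ count P?
  count-pos i p = ≤-trans (≤-reflexive (sym (𝟙-yes (P? i) p))) (term≤sum (λ i → 𝟙 (P? i)) i)

  count-none : (∀ i → ¬ P i) → count P? ≡ 0
  count-none h = trans (sum-cong (λ i → 𝟙-no (P? i) (h i))) (trans (sum-const n 0) (*-zeroʳ n))

  count≤ : count P? ≤ n
  count≤ = ≤-trans (sum-mono (λ i → 𝟙≤1 (P? i))) (≤-reflexive (trans (sum-const n 1) (*-identityʳ n)))

count-unique : ∀ {n p} {P : Fin n → Set p} (P? : ∀ i → Dec (P i)) → (∀ i j → P i → P j → i ≡ j) → count P? ≤ 1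
count-unique {zero} P? u = z≤n
count-unique {suc n} P? u with P? zero
... | yes p = ≤-reflexive (cong suc (count-none (λ i → P? (suc i)) (λ i q → 0≢ (u zero (suc i) p q))))
  where
  0≢ : ∀ {i : Fin n} → zero ≢ suc i
  0≢ ()
... | no ¬p = count-unique (λ i → P? (suc i)) (λ i j a b → Fin.suc-injective (u (suc i) (suc j) a b))

module _ {n p q} {P : Fin n → Set p} {Q : Fin n → Set q} (P? : ∀ i → Dec (P i)) (Q? : ∀ i → Dec (Q i)) where

  count-mono : (∀ i → P i → Q i) → count P? ≤ count Q?
  count-mono h = sum-mono (λ i → 𝟙-mono (P? i) (Q? i) (h i))

  count-cong : (∀ i → P i → Q i) → (∀ i → Q i → P i) → count P? ≡ count Q?
  count-cong f g = ≤-antisym (count-mono f) (sum-mono (λ i → 𝟙-mono (Q? i) (P? i) (g i)))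

  count-disjoint : ∀ {r} {R : Fin n → Set r} (R? : ∀ i → Dec (R i)) →
    (∀ i → P i → R i) → (∀ i → Q i → R i) → (∀ i → P i → ¬ Q i) → count P? + count Q? ≤ count R?
  count-disjoint R? f g d = ≤-trans (≤-reflexive (sym (sum-+ (λ i → 𝟙 (P? i)) (λ i → 𝟙 (Q? i))))) (sum-mono pt)
    where
    pt : ∀ i → 𝟙 (P? i) + 𝟙 (Q? i) ≤ 𝟙 (R? i)
    pt i with P? i | Q? i
    ... | yes p | yes q = ⊥-elim (d i p q)
    ... | yes p | no _ = ≤-reflexive (sym (𝟙-yes (R? i) (f i p)))
    ... | no _ | yes q = ≤-reflexive (sym (𝟙-yes (R? i) (g i q)))
    ... | no _ | no _ = z≤n

  count-cover : ∀ {r} {R : Fin n → Set r} (R? : ∀ i → Dec (R i)) →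
    (∀ i → R i → P i ⊎ Q i) → count R? ≤ count P? + count Q?
  count-cover R? f = ≤-trans (sum-mono pt) (≤-reflexive (sum-+ (λ i → 𝟙 (P? i)) (λ i → 𝟙 (Q? i))))
    where
    pt : ∀ i → 𝟙 (R? i) ≤ 𝟙 (P? i) + 𝟙 (Q? i)
    pt i = 𝟙-bound (R? i) λ r → help (f i r)
      where
      help : P i ⊎ Q i → 1 ≤ 𝟙 (P? i) + 𝟙 (Q? i)
      help (inj₁ p) = ≤-trans (≤-reflexive (sym (𝟙-yes (P? i) p))) (m≤m+n _ _)
      help (inj₂ q) = ≤-trans (≤-reflexive (sym (𝟙-yes (Q? i) q))) (m≤n+m _ _)

count-¬ : ∀ {n p} {P : Fin n → Set p} (P? : ∀ i → Dec (P i)) → count P? + count (λ i → ¬? (P? i)) ≡ n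
count-¬ {n} P? = trans (sym (sum-+ (λ i → 𝟙 (P? i)) (λ i → 𝟙 (¬? (P? i)))))
  (trans (sum-cong pt) (trans (sum-const n 1) (*-identityʳ n)))
  where
  pt : ∀ i → 𝟙 (P? i) + 𝟙 (¬? (P? i)) ≡ 1
  pt i with P? i
  ... | yes _ = refl
  ... | no _ = refl

-- Double counting of the related pairs: each row of `P` contains one, each column at most one. The
-- injection is given as a relation, so that no partner has to be chosen.
count-relation : ∀ {m n p q r} {P : Fin m → Set p} {Q : Fin n → Set q} {R : Fin m → Fin n → Set r}
  (P? : ∀ i → Dec (P i)) (Q? : ∀ j → Dec (Q j)) (R? : ∀ i j → Dec (R i j)) →
  (∀ i → P i → ∃ λ j → R i j × Q j) →
  (∀ i i' j → P i → P i' → R i j → R i' j → i ≡ i') →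
  count P? ≤ count Q?
count-relation {m} {n} {P = P} {Q} {R} P? Q? R? tot inj = begin
  sum (λ i → 𝟙 (P? i)) ≤⟨ sum-mono (λ i → 𝟙-bound (P? i) (λ p → rowpos i p)) ⟩
  sum (λ i → sum (λ j → 𝟙 (S? i j))) ≡⟨ sum-swap (λ i j → 𝟙 (S? i j)) ⟩
  sum (λ j → sum (λ i → 𝟙 (S? i j))) ≤⟨ sum-mono col ⟩
  sum (λ j → 𝟙 (Q? j)) ∎
  where
  open ≤-Reasoning
  S? : ∀ i j → Dec (P i × R i j × Q j)
  S? i j = P? i ×-dec (R? i j ×-dec Q? j)
  rowpos : ∀ i → P i → 1 ≤ sum (λ j → 𝟙 (S? i j))
  rowpos i p with tot i p
  ... | j , r , q = count-pos (S? i) j (p , r , q)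
  col : ∀ j → sum (λ i → 𝟙 (S? i j)) ≤ 𝟙 (Q? j)
  col j with Q? j in eq
  ... | yes q = count-unique (λ i → P? i ×-dec (R? i j ×-dec yes q)) λ i i' (a , b , _) (a' , b' , _) → inj i i' j a a' b b'
  ... | no ¬q = ≤-reflexive (count-none (λ i → P? i ×-dec (R? i j ×-dec no ¬q)) λ i (_ , _ , q) → ¬q q)

count-avoid : ∀ {n p} {P : Fin n → Set p} (P? : ∀ i → Dec (P i)) → 2 ≤ count P? → ∀ j → ∃ λ i → P i × i ≢ j
count-avoid {P = P} P? h j = count-∃ avoid? (+-cancelʳ-≤ 1 1 _ (≤-trans h
    (≤-trans (count-cover avoid? (λ i → i Fin.≟ j) P? split)
      (+-monoʳ-≤ (count avoid?) (count-unique (λ i → i Fin.≟ j) (λ a b p q → trans p (sym q)))))))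
  where
  avoid? = λ i → P? i ×-dec ¬? (i Fin.≟ j)
  split : ∀ i → P i → (P i × i ≢ j) ⊎ i ≡ j
  split i p with i Fin.≟ j
  ... | yes e = inj₂ e
  ... | no ne = inj₁ (p , ne)

count-∩ : ∀ {n p q} {P : Fin n → Set p} {Q : Fin n → Set q} (P? : ∀ i → Dec (P i)) (Q? : ∀ i → Dec (Q i)) →
  count P? + count Q? ≤ count (λ i → P? i ×-dec Q? i) + n
count-∩ {n} P? Q? = begin
  count P? + count Q? ≡⟨ sum-+ (λ i → 𝟙 (P? i)) (λ i → 𝟙 (Q? i)) ⟨
  sum (λ i → 𝟙 (P? i) + 𝟙 (Q? i)) ≤⟨ sum-mono pt ⟩
  sum (λ i → 𝟙 (P? i ×-dec Q? i) + 1) ≡⟨ sum-+ (λ i → 𝟙 (P? i ×-dec Q? i)) (λ _ → 1) ⟩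
  count (λ i → P? i ×-dec Q? i) + sum {n} (λ _ → 1) ≡⟨ cong (count (λ i → P? i ×-dec Q? i) +_) (trans (sum-const n 1) (*-identityʳ n)) ⟩
  count (λ i → P? i ×-dec Q? i) + n ∎
  where
  open ≤-Reasoning
  pt : ∀ i → 𝟙 (P? i) + 𝟙 (Q? i) ≤ 𝟙 (P? i ×-dec Q? i) + 1
  pt i with P? i | Q? i
  ... | yes _ | yes _ = ≤-refl
  ... | yes _ | no _ = ≤-refl
  ... | no _ | yes _ = ≤-refl
  ... | no _ | no _ = z≤n

-- Partial edge colourings

if-yes : ∀ {p a} {P : Set p} {A : Set a} (d : Dec P) {s t : A} → P → (if does d then s else t) ≡ s
if-yes (yes _) _ = refl
if-yes (no ¬p) p = ⊥-elim (¬p p)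

if-no : ∀ {p a} {P : Set p} {A : Set a} (d : Dec P) {s t : A} → ¬ P → (if does d then s else t) ≡ t
if-no (yes p) ¬p = ⊥-elim (¬p p)
if-no (no _) _ = refl

τ : ∀ {k} → Fin k → Fin k → Fin k → Fin k
τ a b c with c ≟ a | c ≟ b
... | yes _ | _ = b
... | no _ | yes _ = a
... | no _ | no _ = c

τ-left : ∀ {k} (a b : Fin k) → τ a b a ≡ b
τ-left a b with a ≟ a
... | yes _ = refl
... | no ¬p = ⊥-elim (¬p refl)

τ-right : ∀ {k} (a b : Fin k) → τ a b b ≡ a
τ-right a b with b ≟ a | b ≟ b
... | yes p | _ = p
... | no _ | yes _ = refl
... | no _ | no ¬p = ⊥-elim (¬p refl)

τ-other : ∀ {k} {a b c : Fin k} → c ≢ a → c ≢ b → τ a b c ≡ c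
τ-other {a = a} {b} {c} p q with c ≟ a | c ≟ b
... | yes r | _ = ⊥-elim (p r)
... | no _ | yes r = ⊥-elim (q r)
... | no _ | no _ = refl

τ-involutive : ∀ {k} (a b c : Fin k) → τ a b (τ a b c) ≡ c
τ-involutive a b c with c ≟ a | c ≟ b
... | yes p | _ = trans (τ-right a b) (sym p)
... | no _ | yes q = trans (τ-left a b) (sym q)
... | no p | no q = τ-other p q

-- A partial proper edge colouring, stored as one matching per colour:
-- mate a v is the neighbour of v along colour a, and v itself when a is missing at v.
record PartialColouring {n} (G : Graph n) (k : ℕ) : Set where
  field
    mate   : Fin k → Fin n → Fin n
    invol  : ∀ a v → mate a (mate a v) ≡ v
    edge   : ∀ a v → mate a v ≢ v → adj G v (mate a v) ≡ true
    unique : ∀ a b v → mate a v ≢ v → mate a v ≡ mate b v → a ≡ b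
open PartialColouring public

adj⇒≢ : ∀ {n} (G : Graph n) {u v} → adj G u v ≡ true → u ≢ v
adj⇒≢ G {u} e refl with trans (sym e) (irrefl G u)
... | ()

module _ {n k : ℕ} {G : Graph n} where

  mate-flip : (φ : PartialColouring G k) → ∀ {a u v} → mate φ a u ≡ v → mate φ a v ≡ u
  mate-flip φ {a} {u} refl = invol φ a u

  mate-injective : (φ : PartialColouring G k) → ∀ {a u v} → mate φ a u ≡ mate φ a v → u ≡ v
  mate-injective φ {a} {u} {v} e = trans (sym (invol φ a u)) (trans (cong (mate φ a) e) (invol φ a v))

  Coloured : PartialColouring G k → Fin n → Fin n → Set
  Coloured φ u v = ∃ λ a → mate φ a u ≡ v

  Coloured? : ∀ φ u v → Dec (Coloured φ u v)
  Coloured? φ u v = any? (λ a → mate φ a u ≟ v)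

  SamePair : Fin n → Fin n → Fin n → Fin n → Set
  SamePair u v x y = (u ≡ x × v ≡ y) ⊎ (u ≡ y × v ≡ x)

  -- xy is the only uncoloured edge; x is the centre and y the root of the fans below.
  record Root (φ : PartialColouring G k) (x y : Fin n) : Set where
    field
      adjacent : adj G x y ≡ true
      bare     : ∀ a → mate φ a x ≢ y
      covered  : ∀ u v → adj G u v ≡ true → Coloured φ u v ⊎ SamePair u v x y
  open Root public

  bare′ : ∀ {φ x y} → Root φ x y → ∀ a → mate φ a y ≢ x
  bare′ {φ} R a e = bare R a (mate-flip φ e)

  -- A Kempe change. `C` is any set closed under both matchings rather than a path, so that one
  -- construction serves for a chain and for its complement.
  module Swap (φ : PartialColouring G k) (a b : Fin k) (C : Fin n → Bool)
              (closed-a : ∀ v → C (mate φ a v) ≡ C v) (closed-b : ∀ v → C (mate φ b v) ≡ C v) where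

    σ : Bool → Fin k → Fin k
    σ t c = if t then τ a b c else c

    M : Fin k → Fin n → Fin n
    M c v = mate φ (σ (C v) c) v

    σ-other : ∀ t {c} → c ≢ a → c ≢ b → σ t c ≡ c
    σ-other true p q = τ-other p q
    σ-other false p q = refl

    σ-involutive : ∀ t c → σ t (σ t c) ≡ c
    σ-involutive true c = τ-involutive a b c
    σ-involutive false c = refl

    σ-injective : ∀ t {c d} → σ t c ≡ σ t d → c ≡ d
    σ-injective t {c} {d} e = trans (sym (σ-involutive t c)) (trans (cong (σ t) e) (σ-involutive t d))

    M-other : ∀ {c} → c ≢ a → c ≢ b → ∀ v → M c v ≡ mate φ c v
    M-other p q v = cong (λ d → mate φ d v) (σ-other (C v) p q)

    M-out : ∀ {v} → C v ≡ false → ∀ c → M c v ≡ mate φ c v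
    M-out {v} e c rewrite e = refl

    M-in-a : ∀ {v} → C v ≡ true → M a v ≡ mate φ b v
    M-in-a {v} e rewrite e = cong (λ d → mate φ d v) (τ-left a b)

    M-in-b : ∀ {v} → C v ≡ true → M b v ≡ mate φ a v
    M-in-b {v} e rewrite e = cong (λ d → mate φ d v) (τ-right a b)

    -- Neither `a` nor `b` leaves its side of `C`, so a second application of `M` uses the same
    -- transposition as the first.
    closed-σ : ∀ v {c} → (c ≡ a ⊎ c ≡ b) → C (M c v) ≡ C v
    closed-σ v {c} h with C v in eq
    closed-σ v (inj₁ refl) | true = trans (cong C (cong (λ d → mate φ d v) (τ-left a b))) (trans (closed-b v) eq)
    closed-σ v (inj₂ refl) | true = trans (cong C (cong (λ d → mate φ d v) (τ-right a b))) (trans (closed-a v) eq)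
    closed-σ v (inj₁ refl) | false = trans (closed-a v) eq
    closed-σ v (inj₂ refl) | false = trans (closed-b v) eq

    M-invol : ∀ c v → M c (M c v) ≡ v
    M-invol c v = cases (c ≟ a) (c ≟ b)
      where
      within : (c ≡ a ⊎ c ≡ b) → M c (M c v) ≡ v
      within h = trans (cong (λ t → mate φ (σ t c) (M c v)) (closed-σ v h)) (invol φ _ v)
      cases : Dec (c ≡ a) → Dec (c ≡ b) → M c (M c v) ≡ v
      cases (yes p) _ = within (inj₁ p)
      cases (no _) (yes q) = within (inj₂ q)
      cases (no p) (no q) = trans (M-other p q (M c v)) (trans (cong (mate φ c) (M-other p q v)) (invol φ c v))

    swapped : PartialColouring G k
    swapped = record
      { mate = M
      ; invol = M-invol
      ; edge = λ c v → edge φ (σ (C v) c) v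
      ; unique = λ c d v p e → σ-injective (C v) (unique φ _ _ v p e)
      }

    swapped-Root : ∀ {x y} → Root φ x y → Root swapped x y
    swapped-Root {x} R = record
      { adjacent = adjacent R
      ; bare = λ c → bare R (σ (C x) c)
      ; covered = λ u v e → cov u v (covered R u v e)
      }
      where
      cov : ∀ u v {x y} → Coloured φ u v ⊎ SamePair u v x y → Coloured swapped u v ⊎ SamePair u v x y
      cov u v (inj₁ (c , e)) = inj₁ (σ (C u) c , trans (cong (λ d → mate φ d u) (σ-involutive (C u) c)) e)
      cov u v (inj₂ s) = inj₂ s

  module Erase (φ : PartialColouring G k) (c : Fin k) (u : Fin n) where

    w : Fin n
    w = mate φ c u

    Hit : Fin k → Fin n → Set
    Hit d v = d ≡ c × (v ≡ u ⊎ v ≡ w)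

    hit? : ∀ d v → Dec (Hit d v)
    hit? d v = (d ≟ c) ×-dec ((v ≟ u) ⊎-dec (v ≟ w))

    M : Fin k → Fin n → Fin n
    M d v = if does (hit? d v) then v else mate φ d v

    M-hit : ∀ {d v} → Hit d v → M d v ≡ v
    M-hit {d} {v} h = if-yes (hit? d v) h

    M-miss : ∀ {d v} → ¬ Hit d v → M d v ≡ mate φ d v
    M-miss {d} {v} h = if-no (hit? d v) h

    M-other : ∀ {d} → d ≢ c → ∀ v → M d v ≡ mate φ d v
    M-other p v = M-miss (λ h → p (proj₁ h))

    hit-mate : ∀ {d v} → Hit d (mate φ d v) → Hit d v
    hit-mate (refl , inj₁ e) = refl , inj₂ (sym (mate-flip φ e))
    hit-mate {v = v} (refl , inj₂ e) = refl , inj₁ (mate-injective φ e)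

    M-invol : ∀ d v → M d (M d v) ≡ v
    M-invol d v = cases (hit? d v)
      where
      cases : Dec (Hit d v) → M d (M d v) ≡ v
      cases (yes h) = trans (cong (M d) (M-hit h)) (M-hit h)
      cases (no ¬h) = trans (cong (M d) (M-miss ¬h)) (trans (M-miss (λ h → ¬h (hit-mate h))) (invol φ d v))

    M-≢ : ∀ d v → M d v ≢ v → M d v ≡ mate φ d v × ¬ Hit d v
    M-≢ d v p = M-miss ¬h , ¬h
      where
      ¬h : ¬ Hit d v
      ¬h h = p (M-hit h)

    erased : PartialColouring G k
    erased = record
      { mate = M
      ; invol = M-invol
      ; edge = λ d v p → let e = proj₁ (M-≢ d v p) in
                 trans (cong (adj G v) e) (edge φ d v (λ q → p (trans e q)))
      ; unique = λ d d' v p q → let e = proj₁ (M-≢ d v p)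
                                    p' = λ r → p (trans q r)
                                    e' = proj₁ (M-≢ d' v p') in
                 unique φ d d' v (λ r → p (trans e r)) (trans (sym e) (trans q e'))
      }

    -- By `unique` the edge `uw` carries one colour only, and that one is gone.
    erased-bare : u ≢ w → ∀ d → M d u ≢ w
    erased-bare u≢w d e with M-≢ d u (λ q → u≢w (trans (sym q) e))
    ... | e' , ¬h = ¬h (unique φ d c u (λ q → u≢w (trans (sym q) (trans (sym e') e))) (trans (sym e') e) , inj₁ refl)

    bare-mono : ∀ {p q} → p ≢ q → (∀ d → mate φ d p ≢ q) → ∀ d → M d p ≢ q
    bare-mono {p} {q} p≢q h d e = cases (hit? d p)
      where
      cases : Dec (Hit d p) → ⊥
      cases (yes hit) = p≢q (trans (sym (M-hit hit)) e)
      cases (no ¬hit) = h d (trans (sym (M-miss ¬hit)) e)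

    erased-cov : ∀ {p q} → p ≢ q → Coloured φ p q → Coloured erased p q ⊎ SamePair p q u w
    erased-cov {p} {q} p≢q (d , e) = cases (hit? d p)
      where
      cases : Dec (Hit d p) → Coloured erased p q ⊎ SamePair p q u w
      cases (yes (refl , inj₁ refl)) = inj₂ (inj₁ (refl , sym e))
      cases (yes (refl , inj₂ refl)) = inj₂ (inj₂ (refl , sym (trans (sym (invol φ c u)) e)))
      cases (no ¬h) = inj₁ (d , trans (M-miss ¬h) e)

  module Paint (φ : PartialColouring G k) (c : Fin k) (u w : Fin n) (adj-uw : adj G u w ≡ true)
               (miss-u : mate φ c u ≡ u) (miss-w : mate φ c w ≡ w) (bare-uw : ∀ d → mate φ d u ≢ w) where

    data View (d : Fin k) (v : Fin n) : Set where
      at-u  : d ≡ c → v ≡ u → View d v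
      at-w  : d ≡ c → v ≡ w → v ≢ u → View d v
      other : ¬ (d ≡ c × (v ≡ u ⊎ v ≡ w)) → View d v

    view : ∀ d v → View d v
    view d v with d ≟ c | v ≟ u | v ≟ w
    ... | yes p | yes q | _ = at-u p q
    ... | yes p | no q | yes r = at-w p r q
    ... | yes p | no q | no r = other λ { (_ , inj₁ x) → q x ; (_ , inj₂ x) → r x }
    ... | no p | _ | _ = other (λ x → p (proj₁ x))

    pick : ∀ {d v} → View d v → Fin n
    pick (at-u _ _) = w
    pick (at-w _ _ _) = u
    pick {d} {v} (other _) = mate φ d v

    M : Fin k → Fin n → Fin n
    M d v = pick (view d v)

    u≢w : u ≢ w
    u≢w = adj⇒≢ G adj-uw

    M-u : M c u ≡ w
    M-u with view c u
    ... | at-u _ _ = refl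
    ... | at-w _ _ q = ⊥-elim (q refl)
    ... | other q = ⊥-elim (q (refl , inj₁ refl))

    M-w : M c w ≡ u
    M-w with view c w
    ... | at-u _ q = ⊥-elim (u≢w (sym q))
    ... | at-w _ _ _ = refl
    ... | other q = ⊥-elim (q (refl , inj₂ refl))

    M-away : ∀ {d v} → ¬ (d ≡ c × (v ≡ u ⊎ v ≡ w)) → M d v ≡ mate φ d v
    M-away {d} {v} h with view d v
    ... | at-u p q = ⊥-elim (h (p , inj₁ q))
    ... | at-w p q _ = ⊥-elim (h (p , inj₂ q))
    ... | other _ = refl

    M-other : ∀ {d} → d ≢ c → ∀ v → M d v ≡ mate φ d v
    M-other p v = M-away (λ x → p (proj₁ x))

    M-invol : ∀ d v → M d (M d v) ≡ v
    M-invol d v with view d v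
    ... | at-u refl refl = M-w
    ... | at-w refl refl _ = M-u
    ... | other h = trans (M-away away) (invol φ d v)
      where
      away : ¬ (d ≡ c × (mate φ d v ≡ u ⊎ mate φ d v ≡ w))
      away (refl , inj₁ e) = h (refl , inj₁ (trans (sym (mate-flip φ e)) miss-u))
      away (refl , inj₂ e) = h (refl , inj₂ (trans (sym (mate-flip φ e)) miss-w))

    M-edge : ∀ d v → M d v ≢ v → adj G v (M d v) ≡ true
    M-edge d v p with view d v
    ... | at-u _ refl = adj-uw
    ... | at-w _ refl _ = trans (adj-sym G w u) adj-uw
    ... | other _ = edge φ d v p

    bare-wu : ∀ d → mate φ d w ≢ u
    bare-wu d e = bare-uw d (mate-flip φ e)

    M-unique : ∀ d d' v → M d v ≢ v → M d v ≡ M d' v → d ≡ d'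
    M-unique d d' v p e with view d v | view d' v
    ... | at-u a b | at-u a' b' = trans a (sym a')
    ... | at-u a b | at-w a' b' c' = ⊥-elim (c' b)
    ... | at-u a refl | other h = ⊥-elim (bare-uw d' (sym e))
    ... | at-w a b c' | at-u a' b' = trans a (sym a')
    ... | at-w a b c' | at-w a' b' d'' = trans a (sym a')
    ... | at-w a refl c' | other h = ⊥-elim (bare-wu d' (sym e))
    ... | other h | at-u a refl = ⊥-elim (bare-uw d e)
    ... | other h | at-w a refl c' = ⊥-elim (bare-wu d e)
    ... | other h | other h' = unique φ d d' v p e

    painted : PartialColouring G k
    painted = record { mate = M ; invol = M-invol ; edge = M-edge ; unique = M-unique }

    painted-bare : ∀ {p q} → ¬ SamePair p q u w → (∀ d → mate φ d p ≢ q) → ∀ d → M d p ≢ q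
    painted-bare {p} ns h d e with view d p
    ... | at-u _ a = ns (inj₁ (a , sym e))
    ... | at-w _ a _ = ns (inj₂ (a , sym e))
    ... | other _ = h d e

    painted-new : ∀ {p q} → SamePair p q u w → Coloured painted p q
    painted-new (inj₁ (refl , refl)) = c , M-u
    painted-new (inj₂ (refl , refl)) = c , M-w

    painted-cov : ∀ {p q} → p ≢ q → Coloured φ p q → Coloured painted p q
    painted-cov {p} p≢q (d , e) with view d p in eq
    ... | at-u refl refl = ⊥-elim (p≢q (trans (sym miss-u) e))
    ... | at-w refl refl _ = ⊥-elim (p≢q (trans (sym miss-w) e))
    ... | other h = d , trans (M-away h) e

  complete⇒edgeColouring : Fin k → (φ : PartialColouring G k) →
    (∀ u v → adj G u v ≡ true → Coloured φ u v) → EdgeColouring G k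
  complete⇒edgeColouring a₀ φ cov = record { col = col ; colSym = colSym ; proper = proper }
    where
    pick : ∀ {u v} → Dec (Coloured φ u v) → Fin k
    pick (yes (a , _)) = a
    -- Default value for non-adjacent pairs, of which `EdgeColouring` asks nothing.
    pick (no _) = a₀
    col : Fin n → Fin n → Fin k
    col u v = pick (Coloured? φ u v)
    col-mate : ∀ u v → adj G u v ≡ true → mate φ (col u v) u ≡ v
    col-mate u v e with Coloured? φ u v
    ... | yes (a , p) = p
    ... | no ¬p = ⊥-elim (¬p (cov u v e))
    colSym : ∀ u v → adj G u v ≡ true → col u v ≡ col v u
    colSym u v e = unique φ _ _ u (λ q → adj⇒≢ G e (trans (sym q) (col-mate u v e)))
      (trans (col-mate u v e) (sym (mate-flip φ (col-mate v u (trans (adj-sym G v u) e)))))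
    proper : ∀ u v w → adj G u v ≡ true → adj G u w ≡ true → v ≢ w → col u v ≢ col u w
    proper u v w p q v≢w e = v≢w (trans (sym (col-mate u v p)) (trans (cong (λ a → mate φ a u) e) (col-mate u w q)))

  module _ {φ : PartialColouring G k} {x y : Fin n} (R : Root φ x y) where

    finish : ∀ c → mate φ c x ≡ x → mate φ c y ≡ y → EdgeColouring G k
    finish c mx my = complete⇒edgeColouring c P.painted (λ u v e → help u v e (covered R u v e))
      where
      module P = Paint φ c x y (adjacent R) mx my (bare R)
      help : ∀ u v → adj G u v ≡ true → Coloured φ u v ⊎ SamePair u v x y → Coloured P.painted u v
      help u v e (inj₁ a) = P.painted-cov (adj⇒≢ G e) a
      help u v e (inj₂ s) = P.painted-new s

    -- One rotation of a Vizing fan: with `z = mate φ c x`, colour `c` moves from `xz` to `xy`. Now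
    -- `xz` is bare, and the new root `z` misses `c`.
    shift : ∀ c → mate φ c x ≢ x → mate φ c y ≡ y →
      Σ (PartialColouring G k) λ φ' → Root φ' x (mate φ c x) × mate φ' c (mate φ c x) ≡ mate φ c x
        × (∀ d → d ≢ c → ∀ v → mate φ' d v ≡ mate φ d v)
    shift c px my = P.painted , record { adjacent = edge φ c x px ; bare = bare″ ; covered = cov }
      , trans (P.M-away (λ { (_ , inj₁ e) → px e ; (_ , inj₂ e) → bare R c e })) (E.M-hit (refl , inj₂ refl))
      , λ d p v → trans (P.M-other p v) (E.M-other p v)
      where
      z = mate φ c x
      module E = Erase φ c x
      y-misses : mate E.erased c y ≡ y
      y-misses = trans (E.M-miss (λ { (_ , inj₁ e) → adj⇒≢ G (adjacent R) (sym e) ; (_ , inj₂ e) → bare R c (sym e) })) my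
      module P = Paint E.erased c x y (adjacent R) (E.M-hit (refl , inj₁ refl))
        y-misses (E.bare-mono (adj⇒≢ G (adjacent R)) (bare R))
      bare″ : ∀ d → mate P.painted d x ≢ z
      bare″ = P.painted-bare (λ { (inj₁ (_ , e)) → bare R c e ; (inj₂ (e , _)) → adj⇒≢ G (adjacent R) e })
                (E.erased-bare (λ e → px (sym e)))
      cov : ∀ u v → adj G u v ≡ true → Coloured P.painted u v ⊎ SamePair u v x z
      cov u v e with covered R u v e
      ... | inj₂ s = inj₁ (P.painted-new s)
      ... | inj₁ a with E.erased-cov (adj⇒≢ G e) a
      ...   | inj₁ b = inj₁ (P.painted-cov (adj⇒≢ G e) b)
      ...   | inj₂ s = inj₂ s

    -- The edge of colour `c` at `y` is repainted with `m`, which both its ends miss. This frees `c`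
    -- at the root and changes nothing at `x`.
    recolour : ∀ c m → mate φ c y ≢ y → mate φ m y ≡ y → mate φ m (mate φ c y) ≡ mate φ c y →
      Σ (PartialColouring G k) λ φ' → Root φ' x y × mate φ' c y ≡ y
        × (∀ d → d ≢ c → d ≢ m → ∀ v → mate φ' d v ≡ mate φ d v)
        × (∀ d → mate φ' d x ≡ mate φ d x)
    recolour c m py my mu = P.painted , record { adjacent = adjacent R ; bare = bare″ ; covered = cov }
      , trans (P.M-other c≢m y) (E.M-hit (refl , inj₁ refl))
      , (λ d p q v → trans (P.M-other q v) (E.M-other p v))
      , λ d → trans (P.M-away (λ { (_ , inj₁ e) → x≢y e ; (_ , inj₂ e) → x≢u e }))
                    (E.M-miss (λ { (_ , inj₁ e) → x≢y e ; (_ , inj₂ e) → x≢u e }))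
      where
      u = mate φ c y
      x≢y : x ≢ y
      x≢y = adj⇒≢ G (adjacent R)
      x≢u : x ≢ u
      x≢u e = bare′ R c (sym e)
      c≢m : c ≢ m
      c≢m refl = py my
      m≢c : m ≢ c
      m≢c e = c≢m (sym e)
      module E = Erase φ c y
      module P = Paint E.erased m y u (edge φ c y py) (trans (E.M-other m≢c y) my) (trans (E.M-other m≢c u) mu)
        (E.erased-bare (λ e → py (sym e)))
      bare″ : ∀ d → mate P.painted d x ≢ y
      bare″ = P.painted-bare (λ { (inj₁ (e , _)) → x≢y e ; (inj₂ (e , _)) → x≢u e }) (E.bare-mono x≢y (bare R))
      cov : ∀ p q → adj G p q ≡ true → Coloured P.painted p q ⊎ SamePair p q x y
      cov p q e with covered R p q e
      ... | inj₂ s = inj₂ s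
      ... | inj₁ a with E.erased-cov (adj⇒≢ G e) a
      ...   | inj₁ b = inj₁ (P.painted-cov (adj⇒≢ G e) b)
      ...   | inj₂ s = inj₁ (P.painted-new s)

  -- The entry point of criticality: the colouring of `G` without `xy` is reread as one matching per
  -- colour, and `xy` is the only edge left bare.
  fromRemoval : ∀ x y → adj G x y ≡ true → EdgeColouring (removeEdge G x y) k →
    Σ (PartialColouring G k) λ φ → Root φ x y
  fromRemoval x y adj-xy ψ = φ , record { adjacent = adj-xy ; bare = bare″ ; covered = cov }
    where
    open EdgeColouring ψ
    H = removeEdge G x y
    Step : Fin k → Fin n → Fin n → Set
    Step a u v = adj H u v ≡ true × col u v ≡ a
    step? : ∀ a u → Dec (∃ (Step a u))
    step? a u = any? (λ v → (adj H u v Bool.≟ true) ×-dec (col u v ≟ a))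
    pick : ∀ {a u} → Dec (∃ (Step a u)) → Fin n
    pick (yes (v , _)) = v
    pick {u = u} (no _) = u
    step-functional : ∀ {a u v w} → Step a u v → Step a u w → v ≡ w
    step-functional {a} {u} {v} {w} (p , q) (p' , q') with v ≟ w
    ... | yes e = e
    ... | no ne = ⊥-elim (proper u v w p p' ne (trans q (sym q')))
    step-sym : ∀ {a u v} → Step a u v → Step a v u
    step-sym {a} {u} {v} (p , q) = trans (adj-sym H v u) p , trans (sym (colSym u v p)) q
    M : Fin k → Fin n → Fin n
    M a u = pick (step? a u)
    M-step : ∀ {a u v} → Step a u v → M a u ≡ v
    M-step {a} {u} s with step? a u
    ... | yes (_ , s') = step-functional s' s
    ... | no ¬s = ⊥-elim (¬s (_ , s))
    M-≢ : ∀ {a u} → M a u ≢ u → Step a u (M a u)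
    M-≢ {a} {u} p with step? a u
    ... | yes (_ , s) = s
    ... | no _ = ⊥-elim (p refl)
    adjH⇒adj : ∀ {u v} → adj H u v ≡ true → adj G u v ≡ true
    adjH⇒adj {u} {v} e with adj G u v
    ... | true = refl
    ... | false = e
    φ : PartialColouring G k
    φ = record
      { mate = M
      ; invol = inv
      ; edge = λ a v p → adjH⇒adj (proj₁ (M-≢ p))
      ; unique = λ a b v p e → trans (sym (proj₂ (M-≢ p)))
                   (trans (cong (col v) e) (proj₂ (M-≢ (λ q → p (trans e q)))))
      }
      where
      inv : ∀ a v → M a (M a v) ≡ v
      inv a v with M a v ≟ v
      ... | yes e = trans (cong (M a) e) e
      ... | no ne = M-step (step-sym (M-≢ ne))
    isE-refl : adj H x y ≡ false
    isE-refl with x ≟ x | y ≟ y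
    ... | yes _ | yes _ = ∧-zeroʳ (adj G x y)
    ... | no p | _ = ⊥-elim (p refl)
    ... | yes _ | no p = ⊥-elim (p refl)
    bare″ : ∀ a → M a x ≢ y
    bare″ a e with trans (sym isE-refl) (subst (λ v → adj H x v ≡ true) e (proj₁ (M-≢ (λ q → adj⇒≢ G adj-xy (trans (sym q) e)))))
    ... | ()
    cov : ∀ u v → adj G u v ≡ true → Coloured φ u v ⊎ SamePair u v x y
    cov u v e with adj H u v in eq
    ... | true = inj₁ (col u v , M-step (eq , refl))
    ... | false rewrite e = inj₂ (same eq)
      where
      same : not (isE x y u v) ≡ false → SamePair u v x y
      same q with u ≟ x | v ≟ y | u ≟ y | v ≟ x
      ... | yes a | yes b | _ | _ = inj₁ (a , b)
      ... | _ | _ | yes a | yes b = inj₂ (a , b)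
      same () | no _ | _ | no _ | _
      same () | no _ | _ | yes _ | no _
      same () | yes _ | no _ | no _ | _
      same () | yes _ | no _ | yes _ | no _

-- Kempe chains

does-sound : ∀ {p} {P : Set p} (d : Dec P) → does d ≡ true → P
does-sound (yes p) _ = p

least : ∀ {p} {P : ℕ → Set p} → (∀ i → Dec (P i)) → ∀ N →
  (∃ λ m → m ≤ N × P m × (∀ i → i < m → ¬ P i)) ⊎ (∀ i → i ≤ N → ¬ P i)
least P? N with P? 0
least P? N | yes p = inj₁ (0 , z≤n , p , λ i ())
least P? zero | no ¬p = inj₂ λ { zero _ → ¬p }
least {P = P} P? (suc N) | no ¬p with least (λ i → P? (suc i)) N
... | inj₁ (m , m≤N , pm , h) = inj₁ (suc m , s≤s m≤N , pm , λ { zero _ → ¬p ; (suc i) (s≤s q) → h i q })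
... | inj₂ h = inj₂ λ { zero _ → ¬p ; (suc i) (s≤s q) → h i q }

double : ℕ → ℕ
double zero = zero
double (suc t) = suc (suc (double t))

-- The path below alternates between two involutions, so the parity of the distance decides how a
-- coincidence of two positions is refuted.
gap : ∀ {i j} → i < j → (∃ λ t → j ≡ suc (double t + i)) ⊎ (∃ λ t → j ≡ suc (suc (double t + i)))
gap {i} {suc j} (s≤s q) with m≤n⇒m<n∨m≡n q
... | inj₂ refl = inj₁ (0 , refl)
... | inj₁ i<j with gap i<j
...   | inj₁ (t , refl) = inj₂ (t , refl)
...   | inj₂ (t , refl) = inj₁ (suc t , refl)

-- The orbit of a fixed point x of g under two involutions f and g is a path x, f x, g (f x), …
-- that stops at the first repetition; only its two ends can be fixed by f or g.
module Chain {n} (f g : Fin n → Fin n) (f-invol : ∀ v → f (f v) ≡ v) (g-invol : ∀ v → g (g v) ≡ v)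
             (x : Fin n) (gx : g x ≡ x) where

  alt : ℕ → Fin n → Fin n
  alt zero = f
  alt (suc zero) = g
  alt (suc (suc i)) = alt i

  p : ℕ → Fin n
  p zero = x
  p (suc i) = alt i (p i)

  alt-invol : ∀ i v → alt i (alt i v) ≡ v
  alt-invol zero v = f-invol v
  alt-invol (suc zero) v = g-invol v
  alt-invol (suc (suc i)) v = alt-invol i v

  alt-double : ∀ t i → alt (double t + i) ≡ alt i
  alt-double zero i = refl
  alt-double (suc t) i = alt-double t i

  back : ∀ i → alt i (p (suc i)) ≡ p i
  back i = alt-invol i (p i)

  module _ (K : ℕ) (moving : ∀ i → i < K → p (suc i) ≢ p i) where

    -- At odd distance the step after the earlier point and the step before the later one use the
    -- same involution. A coincidence therefore moves inwards from both sides, until two consecutive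
    -- points agree.
    odd-gap : ∀ t i → suc (double t + i) ≤ K → p i ≢ p (suc (double t + i))
    odd-gap zero i h e = moving i h (sym e)
    odd-gap (suc t) i h e = odd-gap t (suc i) (≤-trans (≤-trans (s≤s (≤-reflexive (+-suc (double t) i))) (n≤1+n _)) h)
      (trans (cong (alt i) e) (trans (cong (λ s → s (p (suc (double (suc t) + i)))) (sym (alt-double t i)))
        (trans (back (suc (suc (double t + i)))) (cong (λ j → p (suc j)) (sym (+-suc (double t) i))))))

    -- At even distance the steps before both points use the same involution, so a coincidence moves
    -- down to the start. There `g` fixes `x`, so the last step onto the later point would not move.
    even-gap : ∀ t i → suc (suc (double t + i)) ≤ K → p i ≢ p (suc (suc (double t + i)))
    even-gap t zero h e = moving (suc (double t + 0)) h (trans (sym e) (trans (sym gx)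
      (trans (cong g e) (trans (cong (λ s → s (p (suc (suc (double t + 0))))) (sym alt-g)) (back (suc (double t + 0)))))))
      where
      alt-g : alt (suc (double t + 0)) ≡ g
      alt-g = trans (cong alt (sym (+-suc (double t) 0))) (alt-double t 1)
    even-gap t (suc i) h e = even-gap t i (≤-trans (s≤s (s≤s (≤-trans (n≤1+n _) (≤-reflexive (sym (+-suc (double t) i)))))) h)
      (trans (sym (back i)) (trans (cong (alt i) (trans e (cong (λ j → p (suc (suc j))) (+-suc (double t) i))))
        (trans (cong (λ s → s (p (suc (suc (suc (double t + i)))))) (sym (alt-double t i))) (back (suc (suc (double t + i)))))))

    distinct : ∀ {i j} → i < j → j ≤ K → p i ≢ p j
    distinct i<j j≤K with gap i<j
    ... | inj₁ (t , refl) = odd-gap t _ j≤K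
    ... | inj₂ (t , refl) = even-gap t _ j≤K

  -- If the path moved at every step up to `n`, its first `n + 1` points would be distinct.
  stop : ∃ λ m → p (suc m) ≡ p m × (∀ i → i < m → p (suc i) ≢ p i)
  stop with least (λ i → p (suc i) ≟ p i) n
  ... | inj₁ (m , _ , e , h) = m , e , h
  ... | inj₂ h with pigeonhole (n<1+n n) (λ i → p (toℕ i))
  ...   | i , j , i<j , e = ⊥-elim (distinct n (λ i q → h i (<⇒≤ q)) i<j (≤-pred (toℕ<n j)) e)

  m : ℕ
  m = proj₁ stop

  end : Fin n
  end = p m

  On : Fin n → Set
  On v = ∃ λ (i : Fin (suc m)) → p (toℕ i) ≡ v

  on? : ∀ v → Dec (On v)
  on? v = any? (λ i → p (toℕ i) ≟ v)

  visited : ∀ i → i ≤ m → On (p i)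
  visited i h = fromℕ< (s≤s h) , cong p (toℕ-fromℕ< (s≤s h))

  on-alt : ∀ i → i ≤ m → On (alt i (p i))
  on-alt i h with m≤n⇒m<n∨m≡n h
  ... | inj₁ i<m = visited (suc i) i<m
  ... | inj₂ refl = subst On (sym (proj₁ (proj₂ stop))) (visited m ≤-refl)

  on-back : ∀ i → i ≤ m → On (alt (suc i) (p i))
  on-back zero h = subst On (sym gx) (visited 0 z≤n)
  on-back (suc i) h = subst On (sym (back i)) (visited i (≤-trans (n≤1+n i) h))

  -- Consecutive indices name `f` and `g` in one order or the other, so the parity of `i` need not
  -- be followed.
  both : ∀ (P : (Fin n → Fin n) → Set) i → P (alt i) → P (alt (suc i)) → P f × P g
  both P zero a b = a , b
  both P (suc zero) a b = b , a
  both P (suc (suc i)) a b = both P i a b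

  on-closed : ∀ v → On v → On (f v) × On (g v)
  on-closed v (i , refl) = both (λ s → On (s (p (toℕ i)))) (toℕ i) (on-alt (toℕ i) h) (on-back (toℕ i) h)
    where
    h : toℕ i ≤ m
    h = ≤-pred (toℕ<n i)

  ends : ∀ v → On v → f v ≡ v ⊎ g v ≡ v → v ≡ x ⊎ v ≡ end
  ends v (i , refl) fix = cases (toℕ i) (≤-pred (toℕ<n i)) fix
    where
    inner : ∀ j → suc j < m → f (p (suc j)) ≢ p (suc j) × g (p (suc j)) ≢ p (suc j)
    inner j q = both (λ s → s (p (suc j)) ≢ p (suc j)) (suc j) (proj₂ (proj₂ stop) (suc j) q)
      (λ e → proj₂ (proj₂ stop) j (≤-trans (n≤1+n _) q) (trans (sym e) (back j)))
    cases : ∀ j → j ≤ m → f (p j) ≡ p j ⊎ g (p j) ≡ p j → p j ≡ x ⊎ p j ≡ end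
    cases zero h _ = inj₁ refl
    cases (suc j) h e with m≤n⇒m<n∨m≡n h
    ... | inj₂ eq = inj₂ (cong p eq)
    ... | inj₁ q with e
    ...   | inj₁ a = ⊥-elim (proj₁ (inner j q) a)
    ...   | inj₂ a = ⊥-elim (proj₂ (inner j q) a)

  C : Fin n → Bool
  C v = does (on? v)

  C-on : ∀ {v} → C v ≡ true → On v
  C-on {v} = does-sound (on? v)

  on-C : ∀ {v} → On v → C v ≡ true
  on-C {v} = dec-true (on? v)

  C-cong : ∀ {u v} → (On u → On v) → (On v → On u) → C u ≡ C v
  C-cong {u} {v} a b = does-⇔ (mk⇔ a b) (on? u) (on? v)

  C-x : C x ≡ true
  C-x = on-C (visited 0 z≤n)

  C-f : ∀ v → C (f v) ≡ C v
  C-f v = C-cong (λ o → subst On (f-invol v) (proj₁ (on-closed _ o))) (λ o → proj₁ (on-closed _ o))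

  C-g : ∀ v → C (g v) ≡ C v
  C-g v = C-cong (λ o → subst On (g-invol v) (proj₂ (on-closed _ o))) (λ o → proj₂ (on-closed _ o))

-- All that is used of a chain: a set closed under both colours with at most one vertex besides `x`
-- that misses either of them. The orbit behind it stays hidden by `abstract`.
record KempeChain {n k} {G : Graph n} (φ : PartialColouring G k) (a b : Fin k) (x : Fin n) : Set where
  field
    C        : Fin n → Bool
    start    : C x ≡ true
    closed-a : ∀ v → C (mate φ a v) ≡ C v
    closed-b : ∀ v → C (mate φ b v) ≡ C v
    end      : Fin n
    ends     : ∀ v → C v ≡ true → mate φ a v ≡ v ⊎ mate φ b v ≡ v → v ≡ x ⊎ v ≡ end

abstract
  kempeChain : ∀ {n k} {G : Graph n} (φ : PartialColouring G k) a b x → mate φ b x ≡ x → KempeChain φ a b x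
  kempeChain φ a b x bx = record
    { C = K.C ; start = K.C-x ; closed-a = K.C-f ; closed-b = K.C-g ; end = K.end
    ; ends = λ v c → K.ends v (K.C-on c) }
    where
    module K = Chain (mate φ a) (mate φ b) (invol φ a) (invol φ b) x bx

-- `Inner` exchanges the colours on the chain of `x`; `Outer` exchanges them everywhere else and so
-- leaves the colours at `x` alone.
module ChainSwap {n k} {G : Graph n} (φ : PartialColouring G k) (a b : Fin k) (x : Fin n) (bx : mate φ b x ≡ x) where
  open KempeChain (kempeChain φ a b x bx) public
  module Inner = Swap φ a b C closed-a closed-b
  module Outer = Swap φ a b (λ v → not (C v)) (λ v → cong not (closed-a v)) (λ v → cong not (closed-b v))

-- Fans with exchangeable edges

sum-tabulate : ∀ {n} (f : Fin n → ℕ) → ListAction.sum (tabulate f) ≡ sum f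
sum-tabulate {zero} f = refl
sum-tabulate {suc n} f = cong (f zero +_) (sum-tabulate (λ i → f (suc i)))

adj? : ∀ {n} (G : Graph n) u v → Dec (adj G u v ≡ true)
adj? G u v = adj G u v Bool.≟ true

deg-count : ∀ {n} (G : Graph n) v → deg G v ≡ count (adj? G v)
deg-count {n} G v = begin
  ListAction.sum (List.map f (allFin n)) ≡⟨ cong ListAction.sum (map-tabulate (λ i → i) f) ⟩
  ListAction.sum (tabulate f) ≡⟨ sum-tabulate f ⟩
  sum f ≡⟨ sum-cong (λ u → help (adj G v u)) ⟩
  count (adj? G v) ∎
  where
  open ≡-Reasoning
  f : Fin n → ℕ
  f u = if adj G v u then 1 else 0
  help : ∀ b → (if b then 1 else 0) ≡ 𝟙 (b Bool.≟ true)
  help true = refl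
  help false = refl

module _ {n k : ℕ} {G : Graph n} where

  Missing : PartialColouring G k → Fin n → Fin k → Set
  Missing φ v a = mate φ a v ≡ v

  missing? : ∀ φ v a → Dec (Missing φ v a)
  missing? φ v a = mate φ a v ≟ v

  missing : PartialColouring G k → Fin n → ℕ
  missing φ v = count (missing? φ v)

  missing-deg : ∀ φ v → k ≤ missing φ v + deg G v
  missing-deg φ v = begin
    k ≡⟨ count-¬ (missing? φ v) ⟨
    missing φ v + count (λ a → ¬? (missing? φ v a)) ≤⟨ +-monoʳ-≤ (missing φ v) present≤ ⟩
    missing φ v + count (adj? G v) ≡⟨ cong (missing φ v +_) (deg-count G v) ⟨
    missing φ v + deg G v ∎
    where
    open ≤-Reasoning
    present≤ : count (λ a → ¬? (missing? φ v a)) ≤ count (adj? G v)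
    present≤ = count-relation (λ a → ¬? (missing? φ v a)) (adj? G v) (λ a u → mate φ a v ≟ u)
      (λ a p → mate φ a v , refl , edge φ a v p)
      (λ a b u p _ q r → unique φ a b v p (trans q (sym r)))

  -- The bare edge counts in the degree but uses no colour, which gives one missing colour more than
  -- `missing-deg`.
  missing-bare : ∀ φ x y → adj G y x ≡ true → (∀ a → mate φ a y ≢ x) → suc k ≤ missing φ y + deg G y
  missing-bare φ x y yx h = begin
    suc k ≡⟨ cong suc (count-¬ (missing? φ y)) ⟨
    suc (missing φ y + count (λ a → ¬? (missing? φ y a))) ≡⟨ +-suc (missing φ y) _ ⟨
    missing φ y + suc (count (λ a → ¬? (missing? φ y a))) ≤⟨ +-monoʳ-≤ (missing φ y) (≤-trans (+-mono-≤ (count-pos (λ u → u ≟ x) x refl) present≤)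
        (count-disjoint (λ u → u ≟ x) (λ u → adj? G y u ×-dec ¬? (u ≟ x)) (adj? G y) (λ { _ refl → yx }) (λ _ → proj₁) (λ { _ e (_ , ne) → ne e }))) ⟩
    missing φ y + count (adj? G y) ≡⟨ cong (missing φ y +_) (deg-count G y) ⟨
    missing φ y + deg G y ∎
    where
    open ≤-Reasoning
    present≤ : count (λ a → ¬? (missing? φ y a)) ≤ count (λ u → adj? G y u ×-dec ¬? (u ≟ x))
    present≤ = count-relation (λ a → ¬? (missing? φ y a)) (λ u → adj? G y u ×-dec ¬? (u ≟ x)) (λ a u → mate φ a y ≟ u)
      (λ a p → mate φ a y , refl , edge φ a y p , h a)
      (λ a b u p _ q r → unique φ a b y p (trans q (sym r)))

  module _ {φ : PartialColouring G k} {x y : Fin n} (R : Root φ x y) where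

    missing-centre : suc k ≤ missing φ x + deg G x
    missing-centre = missing-bare φ y x (adjacent R) (bare R)

    missing-root : suc k ≤ missing φ y + deg G y
    missing-root = missing-bare φ x y (trans (adj-sym G y x) (adjacent R)) (bare′ R)

    abstract
      root-missing : deg G y ≤ k → ∃ (Missing φ y)
      root-missing le = count-∃ (missing? φ y) (+-cancelʳ-≤ (deg G y) 1 (missing φ y) (≤-trans (s≤s le) missing-root))

      centre-missing : deg G x ≤ k → ∃ (Missing φ x)
      centre-missing le = count-∃ (missing? φ x) (+-cancelʳ-≤ (deg G x) 1 (missing φ x) (≤-trans (s≤s le) missing-centre))

    -- Inclusion and exclusion: `x` misses at least `k + 1 - deg x` colours, one of them owing to
    -- the bare edge, and `w` at least `k - deg w`.
    pair-common : ∀ w → suc k ≤ count (λ g → missing? φ x g ×-dec missing? φ w g) + (deg G x + deg G w)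
    pair-common w = +-cancelʳ-≤ k (suc k) _ (begin
      suc k + k ≤⟨ +-mono-≤ missing-centre (missing-deg φ w) ⟩
      (missing φ x + deg G x) + (missing φ w + deg G w) ≡⟨ interchange (missing φ x) (deg G x) (missing φ w) (deg G w) ⟩
      (missing φ x + missing φ w) + (deg G x + deg G w) ≤⟨ +-monoˡ-≤ _ (count-∩ (missing? φ x) (missing? φ w)) ⟩
      (count both? + k) + (deg G x + deg G w) ≡⟨ xy∙z≈xz∙y (count both?) k _ ⟩
      count both? + (deg G x + deg G w) + k ∎)
      where
      open ≤-Reasoning
      both? = λ g → missing? φ x g ×-dec missing? φ w g

    triple-common : ∀ w w' → suc k ≤ count (λ g → (missing? φ x g ×-dec missing? φ w g) ×-dec missing? φ w' g) + (deg G x + deg G w + deg G w')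
    triple-common w w' = +-cancelʳ-≤ k (suc k) _ (begin
      suc k + k ≤⟨ +-mono-≤ (pair-common w) (missing-deg φ w') ⟩
      (count both? + (deg G x + deg G w)) + (missing φ w' + deg G w') ≡⟨ interchange (count both?) _ (missing φ w') _ ⟩
      (count both? + missing φ w') + (deg G x + deg G w + deg G w') ≤⟨ +-monoˡ-≤ _ (count-∩ both? (missing? φ w')) ⟩
      (count all? + k) + (deg G x + deg G w + deg G w') ≡⟨ xy∙z≈xz∙y (count all?) k _ ⟩
      count all? + (deg G x + deg G w + deg G w') + k ∎)
      where
      open ≤-Reasoning
      both? = λ g → missing? φ x g ×-dec missing? φ w g
      all? = λ g → both? g ×-dec missing? φ w' g

  module _ (nocol : ¬ EdgeColouring G k) where

    no-common : ∀ {φ x y} → Root φ x y → ∀ {c} → Missing φ x c → ¬ Missing φ y c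
    no-common R mx my = nocol (finish R _ mx my)

    -- Since y misses m and x misses g, the (m,g)-chain of x ends at y; outside of it the
    -- colours m and g can be exchanged, after which m is free for the edge from y to u.
    exchange : ∀ {φ x y} → Root φ x y → ∀ {m c g} → Missing φ y m → ¬ Missing φ y c →
      Missing φ x g → Missing φ (mate φ c y) g →
      Σ (PartialColouring G k) λ φ' → Root φ' x y × Missing φ' y c
        × (∀ d → d ≢ c → d ≢ m → d ≢ g → ∀ v → mate φ' d v ≡ mate φ d v)
        × (∀ d → mate φ' d x ≡ mate φ d x)
    exchange {φ} {x} {y} R {m} {c} {g} my cy gx gu with S.C y in Cy
      where module S = ChainSwap φ m g x gx
    -- If the chain of `x` avoids `y`, exchanging along it makes `m` missing at `x`, while `y` still
    -- misses it.
    ... | false = ⊥-elim (no-common (S.Inner.swapped-Root R) (trans (S.Inner.M-in-a S.start) gx) (trans (S.Inner.M-out Cy m) my))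
      where module S = ChainSwap φ m g x gx
    ... | true = ψ , Rψ , cψ
      , (λ d p q r v → trans (same d p q v) (S.Outer.M-other q r v))
      , λ d → trans (atx d) (S.Outer.M-out (cong not S.start) d)
      where
      module S = ChainSwap φ m g x gx
      u = mate φ c y
      y-end : y ≡ S.end
      y-end with S.ends y Cy (inj₁ my)
      ... | inj₁ e = ⊥-elim (adj⇒≢ G (adjacent R) (sym e))
      ... | inj₂ e = e
      -- `u` misses `g`, so on the chain it would have to be one of the two ends `x` and `y`.
      u-out : S.C u ≡ false
      u-out with S.C u in Cu
      ... | false = refl
      ... | true with S.ends u Cu (inj₂ gu)
      ...   | inj₁ e = ⊥-elim (bare′ R c e)
      ...   | inj₂ e = ⊥-elim (cy (trans e (sym y-end)))
      φ₁ = S.Outer.swapped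
      y-same : ∀ d → mate φ₁ d y ≡ mate φ d y
      y-same = S.Outer.M-out (cong not Cy)
      mu₁ : mate φ₁ m (mate φ₁ c y) ≡ mate φ₁ c y
      mu₁ = trans (cong (mate φ₁ m) (y-same c)) (trans (S.Outer.M-in-a (cong not u-out)) (trans gu (sym (y-same c))))
      res = recolour (S.Outer.swapped-Root R) c m (λ e → cy (trans (sym (y-same c)) e)) (trans (y-same m) my) mu₁
      ψ = proj₁ res
      Rψ = proj₁ (proj₂ res)
      cψ = proj₁ (proj₂ (proj₂ res))
      same = proj₁ (proj₂ (proj₂ (proj₂ res)))
      atx = proj₂ (proj₂ (proj₂ (proj₂ res)))

    -- `Mk v w` declares the edge `vw` exchangeable: its colour may be treated as missing at `v`.
    -- The degree conditions yield a colour missing at `x` and at one marked vertex, or at two of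
    -- them marked from distinct fan vertices. With no marks this is Vizing's fan.
    module MarkedFan (deg≤ : ∀ v → deg G v ≤ k) (x : Fin n) (Mk : Fin n → Fin n → Set) (Mk? : ∀ v w → Dec (Mk v w))
      (Mk-≢x : ∀ {v w} → Mk v w → w ≢ x)
      (Mk-pair : ∀ {v w} → Mk v w → deg G x + deg G w < k)
      (Mk-triple : ∀ {v v' w w'} → v ≢ v' → Mk v w → Mk v' w' → deg G x + deg G w + deg G w' < k) where

      abstract
        pair-missing : ∀ {φ y} → Root φ x y → ∀ {w} → deg G x + deg G w < k → ∀ j →
          ∃ λ g → (Missing φ x g × Missing φ w g) × g ≢ j
        pair-missing {φ} R {w} lt j = count-avoid (λ g → missing? φ x g ×-dec missing? φ w g)
          (+-cancelʳ-≤ (deg G x + deg G w) 2 _ (≤-trans (s≤s lt) (pair-common R w))) j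

        triple-missing : ∀ {φ y} → Root φ x y → ∀ {w w'} → deg G x + deg G w + deg G w' < k →
          ∃ λ g → (Missing φ x g × Missing φ w g) × Missing φ w' g
        triple-missing {φ} R {w} {w'} lt = count-∃ (λ g → (missing? φ x g ×-dec missing? φ w g) ×-dec missing? φ w' g)
          (+-cancelʳ-≤ (deg G x + deg G w + deg G w') 1 _ (≤-trans lt (≤-trans (n≤1+n k) (triple-common R w w'))))

      -- The colour c leads on from v: it is missing at v, or it can be made so by an exchange.
      Avail : PartialColouring G k → Fin n → Fin k → Set
      Avail φ v c = mate φ c v ≡ v ⊎ Mk v (mate φ c v)

      avail? : ∀ φ v c → Dec (Avail φ v c)
      avail? φ v c = (mate φ c v ≟ v) ⊎-dec Mk? v (mate φ c v)

      -- Recorded by colours instead of vertices, because `exchange` and `shift` change few colours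
      -- and thus keep every path that avoids these.
      Path : PartialColouring G k → Fin n → List (Fin k) → Fin n → Set
      Path φ u [] v = u ≡ v
      Path φ u (c ∷ cs) v = Avail φ u c × ¬ Missing φ x c × Path φ (mate φ c x) cs v

      snoc : ∀ φ u cs {v c} → Path φ u cs v → Avail φ v c → ¬ Missing φ x c → ∃ λ cs' → Path φ u cs' (mate φ c x)
      snoc φ u [] {c = c} refl a p = c ∷ [] , a , p , refl
      snoc φ u (d ∷ cs) (a' , p' , t) a p with snoc φ _ cs t a p
      ... | cs' , t' = d ∷ cs' , a' , p' , t'

      path-≢x : ∀ {φ u} cs {v} → u ≢ x → Path φ u cs v → v ≢ x
      path-≢x [] ne refl = ne
      path-≢x (c ∷ cs) ne (_ , p , t) = path-≢x cs p t

      path-adj : ∀ {φ u} cs {v} → adj G x u ≡ true → Path φ u cs v → adj G x v ≡ true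
      path-adj [] e refl = e
      path-adj {φ} (c ∷ cs) e (_ , p , t) = path-adj cs (edge φ c x p) t

      Augmenting : PartialColouring G k → Fin n → List (Fin k) → Fin k → Set
      Augmenting φ u cs j = ∃ λ v → Path φ u cs v × Avail φ v j

      -- A colour alone determines the vertex it leads to from `x`, so what follows any occurrence
      -- of `c` is a path from `mate φ c x`.
      shorten : ∀ {φ u cs j c} → c ∈ cs → Augmenting φ u cs j →
        ∃ λ cs' → length cs' < length cs × ¬ Missing φ x c × Augmenting φ (mate φ c x) cs' j
      shorten {cs = _ ∷ cs} (here refl) (v , (_ , p , t) , a) = cs , n<1+n _ , p , v , t , a
      shorten (there i) (v , (_ , _ , t) , a) with shorten i (v , t , a)
      ... | cs' , lt , q = cs' , m<n⇒m<1+n lt , q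

      present : ∀ {φ u cs j c} → c ∈ cs → Augmenting φ u cs j → ¬ Missing φ x c
      present i a = proj₁ (proj₂ (proj₂ (shorten i a)))

      transfer : ∀ {φ φ' u cs j} → (∀ d → d ∈ cs ⊎ d ≡ j → ∀ v → mate φ' d v ≡ mate φ d v) →
        Augmenting φ u cs j → Augmenting φ' u cs j
      transfer {φ} {φ'} {j = j} same (v , t , a) = v , path _ _ (λ d i → same d (inj₁ i)) t , av j v (same j (inj₂ refl)) a
        where
        av : ∀ d v → (∀ v → mate φ' d v ≡ mate φ d v) → Avail φ v d → Avail φ' v d
        av d v e (inj₁ p) = inj₁ (trans (e v) p)
        av d v e (inj₂ p) = inj₂ (subst (Mk v) (sym (e v)) p)
        path : ∀ cs u → (∀ d → d ∈ cs → ∀ v → mate φ' d v ≡ mate φ d v) → Path φ u cs v → Path φ' u cs v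
        path [] u e t = t
        path (c ∷ cs) u e (a , p , t) = av c u (e c (here refl)) a , (λ q → p (trans (sym (e c (here refl) x)) q))
          , subst (λ z → Path φ' z cs v) (sym (e c (here refl) x)) (path cs _ (λ d i → e d (there i)) t)

      _∈?_ : (c : Fin k) (cs : List (Fin k)) → Dec (c ∈ cs)
      c ∈? cs = Any.any? (c ≟_) cs

      -- Induction on the length. If necessary an exchange frees the first colour at the root; a
      -- shift then moves the root to the next vertex, until `j` is missing at both ends of the bare
      -- edge. Where an altered colour occurs later on the path, a shortcut gives a shorter one
      -- instead.
      no-augmenting : ∀ N {cs} → length cs ≤ N → ∀ {φ y j} → Root φ x y → Missing φ x j → ¬ Augmenting φ y cs j
      no-augmenting N {[]} _ {φ} {y} {j} R jx (_ , refl , inj₁ jy) = no-common R jx jy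
      no-augmenting N {[]} _ {φ} {y} {j} R jx (_ , refl , inj₂ mk) with mate φ j y ≟ y | root-missing R (deg≤ y) | pair-missing R (Mk-pair mk) j
      ... | yes jy | _ | _ = no-common R jx jy
      ... | no ¬jy | m , my | g , (gx , gu) , _ with exchange R my ¬jy gx gu
      ...   | φ' , R' , jy' , _ , same-x = no-common R' (trans (same-x j) jx) jy'
      no-augmenting (suc N) {c ∷ cs} (s≤s h) {φ} {y} {j} R jx A@(v , (a , p , t) , b) with c ∈? cs
      ... | yes i with shorten i (v , t , b)
      ...   | cs' , lt , _ , v' , t' , b' = no-augmenting N (≤-trans lt h) R jx (v' , (a , p , t') , b')
      no-augmenting (suc N) {c ∷ cs} (s≤s h) {φ} {y} {j} R jx A@(v , (a , p , t) , b) | no c∉ with mate φ c y ≟ y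
      ... | yes cy with shift R c p cy
      ...   | φ' , R' , _ , same = no-augmenting N h R' (trans (same j j≢c x) jx) (transfer keep (v , t , b))
        where
        j≢c : j ≢ c
        j≢c refl = p jx
        keep : ∀ d → d ∈ cs ⊎ d ≡ j → ∀ v → mate φ' d v ≡ mate φ d v
        keep d (inj₁ i) = same d (λ { refl → c∉ i })
        keep d (inj₂ refl) = same d j≢c
      no-augmenting (suc N) {c ∷ cs} (s≤s h) {φ} {y} {j} R jx A@(v , (a , p , t) , b) | no c∉ | no ¬cy with root-missing R (deg≤ y)
      ... | m , my with m ∈? cs
      -- `m` is missing at `y`, so `y` leads directly to the vertex behind `m`; no exchange is
      -- required.
      ...   | yes i with shorten i (v , t , b)
      ...     | cs' , lt , q , v' , t' , b' = no-augmenting N (≤-trans lt h) R jx (v' , (inj₁ my , q , t') , b')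
      no-augmenting (suc N) {c ∷ cs} (s≤s h) {φ} {y} {j} R jx A@(v , (inj₁ cy , p , t) , b) | no c∉ | no ¬cy | m , my | no m∉ = ¬cy cy
      no-augmenting (suc N) {c ∷ cs} (s≤s h) {φ} {y} {j} R jx A@(v , (inj₂ mk , p , t) , b) | no c∉ | no ¬cy | m , my | no m∉
        with pair-missing R (Mk-pair mk) j
      ... | g , (gx , gu) , g≢j with exchange R my ¬cy gx gu
      ...   | φ₁ , R₁ , cy₁ , same₁ , same-x₁ with shift R₁ c (λ q → p (trans (sym (same-x₁ c)) q)) cy₁
      ...     | φ₂ , R₂ , _ , same₂ = no-augmenting N h (subst (Root φ₂ x) (same-x₁ c) R₂)
                  (trans (same₂ j j≢c x) (trans (same-x₁ j) jx)) (transfer keep (v , t , b))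
        where
        j≢c : j ≢ c
        j≢c refl = p jx
        -- The shortcuts exclude `c` and `m` from the rest of the path, and `g` cannot occur there
        -- since it is missing at `x`. That `j` differs from `g` is the reason why `pair-missing`
        -- avoids a given colour.
        keep : ∀ d → d ∈ cs ⊎ d ≡ j → ∀ v → mate φ₂ d v ≡ mate φ d v
        keep d (inj₁ i) v' = trans (same₂ d d≢c v') (same₁ d d≢c (λ { refl → m∉ i }) (λ { refl → present i (v , t , b) gx }) v')
          where
          d≢c : d ≢ c
          d≢c refl = c∉ i
        keep d (inj₂ refl) v' = trans (same₂ d j≢c v') (same₁ d j≢c (λ { refl → no-common R jx my }) (λ e → g≢j (sym e)) v')

      reach-present : ∀ {φ y cs v c} → Root φ x y → Path φ y cs v → Avail φ v c → ¬ Missing φ x c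
      reach-present {cs = cs} R t a cx = no-augmenting (length cs) ≤-refl R cx (_ , t , a)

      -- Otherwise exchanging h and j outside the chain of x would make j available at v.
      on-chain : ∀ {φ y cs v h j} → Root φ x y → Path φ y cs v → Avail φ v h → (jx : Missing φ x j) →
        KempeChain.C (kempeChain φ h j x jx) v ≡ true
      on-chain {φ} {y} {cs} {v} {h} {j} R t a jx with S.C v in Cv
        where module S = ChainSwap φ h j x jx
      ... | true = refl
      ... | false with walk cs y t
        where
        module S = ChainSwap φ h j x jx
        ψ = S.Outer.swapped
        here-avail : ∀ {u} → S.C u ≡ false → Avail φ u h → Avail ψ u j
        here-avail {u} e (inj₁ p) = inj₁ (trans (S.Outer.M-in-b (cong not e)) p)
        here-avail {u} e (inj₂ p) = inj₂ (subst (Mk u) (sym (S.Outer.M-in-b (cong not e))) p)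
        atx : ∀ d → mate ψ d x ≡ mate φ d x
        atx = S.Outer.M-out (cong not S.start)
        keep : ∀ {u c} → mate ψ c u ≡ mate φ c u → Avail φ u c → Avail ψ u c
        keep e (inj₁ p) = inj₁ (trans e p)
        keep {u} e (inj₂ p) = inj₂ (subst (Mk u) (sym e) p)
        -- The old path can break only where it uses `h` at a vertex off the chain; at the first
        -- such vertex `j` has become available, and the walk ends there.
        walk : ∀ cs u → Path φ u cs v → ∃ λ cs' → Augmenting ψ u cs' j
        extend : ∀ {c cs u} → mate ψ c u ≡ mate φ c u → Path φ u (c ∷ cs) v → ∃ λ cs' → Augmenting ψ u cs' j
        extend {c} {cs} {u} e (b , p , t) with walk cs _ t
        ... | cs' , w , t' , b' = c ∷ cs' , w
          , (keep e b , (λ q → p (trans (sym (atx c)) q)) , subst (λ z → Path ψ z cs' w) (sym (atx c)) t') , b'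
        walk [] u refl = [] , u , refl , here-avail Cv a
        walk (c ∷ cs) u T@(b , p , t) with c ≟ h
        ... | no c≢h = extend {c} {cs} {u} (S.Outer.M-other c≢h (λ { refl → p jx }) u) T
        ... | yes refl with S.C u in Cu
        ...   | false = [] , u , refl , here-avail Cu b
        ...   | true = extend {c} {cs} {u} (S.Outer.M-out (cong not Cu) c) T
      ...   | cs' , A = ⊥-elim (no-augmenting (length cs') ≤-refl (S.Outer.swapped-Root R)
                  (trans (S.Outer.M-out (cong not S.start) j) jx) A)
        where module S = ChainSwap φ h j x jx

      -- On the `(h, j)`-chain of `x`, a vertex missing `h`, or the far end of a marked edge if it
      -- misses `j`, can only be the other end. Two fan vertices offering `h` would lead to the same
      -- end. For two marked edges `j` must be missing at both far ends, hence `Mk-triple`.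
      reach-disjoint : ∀ {φ y cs cs' v v' h} → Root φ x y → Path φ y cs v → Path φ y cs' v' →
        Avail φ v h → Avail φ v' h → v ≡ v'
      reach-disjoint {φ} {y} {cs} {cs'} {v} {v'} {h} R t t' a a' with v ≟ v'
      ... | yes e = e
      ... | no ne = ⊥-elim (cases a a')
        where
        y≢x : y ≢ x
        y≢x e = adj⇒≢ G (adjacent R) (sym e)
        module _ {j} (jx : Missing φ x j) where
          module S = ChainSwap φ h j x jx
          end-missing : ∀ {u cs} → Path φ y cs u → Avail φ u h → Missing φ u h → u ≡ S.end
          end-missing {u} {cs} t a p with S.ends u (on-chain R t a jx) (inj₁ p)
          ... | inj₁ e = ⊥-elim (path-≢x cs y≢x t e)
          ... | inj₂ e = e
          end-marked : ∀ {u cs} → Path φ y cs u → (mk : Mk u (mate φ h u)) → Missing φ (mate φ h u) j → mate φ h u ≡ S.end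
          end-marked {u} t mk p with S.ends (mate φ h u) (trans (S.closed-a u) (on-chain R t (inj₂ mk) jx)) (inj₂ p)
          ... | inj₁ e = ⊥-elim (Mk-≢x mk e)
          ... | inj₂ e = e
        mixed : ∀ {u u' ds ds'} → u ≢ u' → Path φ y ds u → Path φ y ds' u' → Missing φ u h → Mk u' (mate φ h u') → ⊥
        mixed {u} {u'} ne t t' p mk with pair-missing R (Mk-pair mk) h
        ... | j , (jx , jw) , _ = ne (mate-injective φ (trans p (trans (end-missing jx t (inj₁ p) p) (sym (end-marked jx t' mk jw)))))
        cases : Avail φ v h → Avail φ v' h → ⊥
        cases (inj₁ p) (inj₁ p') with centre-missing R (deg≤ x)
        ... | j , jx = ne (trans (end-missing jx t a p) (sym (end-missing jx t' a' p')))
        cases (inj₁ p) (inj₂ mk) = mixed ne t t' p mk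
        cases (inj₂ mk) (inj₁ p) = mixed (λ e → ne (sym e)) t' t p mk
        cases (inj₂ mk) (inj₂ mk') with triple-missing R (Mk-triple ne mk mk')
        ... | j , (jx , jw) , jw' = ne (mate-injective φ (trans (end-marked jx t mk jw) (sym (end-marked jx t' mk' jw'))))

-- The set of vertices reached by a fan

in? : ∀ {n} (R : Fin n → Bool) v → Dec (R v ≡ true)
in? R v = R v Bool.≟ true

abstract
  insert : ∀ {n} → Fin n → (Fin n → Bool) → Fin n → Bool
  insert v R w = does (w ≟ v) ∨ R w

  insert-new : ∀ {n} (v : Fin n) R → insert v R v ≡ true
  insert-new v R = cong (_∨ R v) (dec-true (v ≟ v) refl)

  insert-old : ∀ {n} (v : Fin n) R {w} → R w ≡ true → insert v R w ≡ true
  insert-old v R {w} e = trans (cong (does (w ≟ v) ∨_) e) (∨-zeroʳ _)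

  insert-inv : ∀ {n} (v : Fin n) R {w} → insert v R w ≡ true → w ≡ v ⊎ R w ≡ true
  insert-inv v R {w} e with w ≟ v
  ... | yes p = inj₁ p
  ... | no _ = inj₂ e

-- Vertices are added one by one with `P` as an invariant; each addition enlarges the set, so `n`
-- rounds suffice.
closure : ∀ {n} {P : Fin n → Set} {E : Fin n → Fin n → Set} (E? : ∀ u v → Dec (E u v)) y → P y →
  (∀ u v → P u → E u v → P v) →
  ∃ λ (R : Fin n → Bool) → R y ≡ true × (∀ v → R v ≡ true → P v) × (∀ u v → R u ≡ true → E u v → R v ≡ true)
closure {n} {P} {E} E? y py extend = go n (insert y (λ _ → false)) (insert-new y _)
    (λ v e → base v (insert-inv y _ e)) (m≤m+n n _)
  where
  base : ∀ v → v ≡ y ⊎ false ≡ true → P v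
  base v (inj₁ refl) = py
  Leaving : (Fin n → Bool) → Fin n → Set
  Leaving R v = R v ≢ true × ∃ λ u → R u ≡ true × E u v
  leaving? : ∀ R v → Dec (Leaving R v)
  leaving? R v = ¬? (in? R v) ×-dec any? (λ u → in? R u ×-dec E? u v)
  go : ∀ f R → R y ≡ true → (∀ v → R v ≡ true → P v) → n ≤ f + count (in? R) →
    ∃ λ (R : Fin n → Bool) → R y ≡ true × (∀ v → R v ≡ true → P v) × (∀ u v → R u ≡ true → E u v → R v ≡ true)
  go f R ry sound size with any? (leaving? R)
  go f R ry sound size | no none = R , ry , sound , closed
    where
    closed : ∀ u v → R u ≡ true → E u v → R v ≡ true
    closed u v e s with in? R v
    ... | yes p = p
    ... | no ¬p = ⊥-elim (none (v , ¬p , u , e , s))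
  go zero R ry sound size | yes (v , ¬rv , u , ru , s) = ⊥-elim (<⇒≱ (n<1+n n) (begin
    suc n ≤⟨ s≤s size ⟩
    suc (count (in? R)) ≡⟨ +-comm 1 (count (in? R)) ⟩
    count (in? R) + 1 ≤⟨ +-monoʳ-≤ (count (in? R)) (count-pos (λ v → ¬? (in? R v)) v ¬rv) ⟩
    count (in? R) + count (λ v → ¬? (in? R v)) ≡⟨ count-¬ (in? R) ⟩
    n ∎))
    where open ≤-Reasoning
  go (suc f) R ry sound size | yes (v , ¬rv , u , ru , s) = go f (insert v R) (insert-old v R ry)
      (λ w e → sound' w (insert-inv v R e)) (begin
    n ≤⟨ size ⟩
    suc f + count (in? R) ≡⟨ +-suc f _ ⟨
    f + (1 + count (in? R)) ≤⟨ +-monoʳ-≤ f (+-monoˡ-≤ (count (in? R)) (count-pos (λ w → w ≟ v) v refl)) ⟩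
    f + (count (λ w → w ≟ v) + count (in? R)) ≤⟨ +-monoʳ-≤ f (count-disjoint (λ w → w ≟ v) (in? R) (in? (insert v R))
          (λ { w refl → insert-new v R }) (λ w → insert-old v R) (λ { w refl → ¬rv })) ⟩
    f + count (in? (insert v R)) ∎)
    where
    open ≤-Reasoning
    sound' : ∀ w → w ≡ v ⊎ R w ≡ true → P w
    sound' w (inj₁ refl) = extend u v (sound u ru) s
    sound' w (inj₂ e) = sound w e

𝟙-× : ∀ {p q} {P : Set p} {Q : Set q} (d : Dec P) (e : Dec Q) → 𝟙 d * 𝟙 e ≡ 𝟙 (d ×-dec e)
𝟙-× (yes _) (yes _) = refl
𝟙-× (yes _) (no _) = refl
𝟙-× (no _) _ = refl

-- The colours available at the vertices reached from y are pairwise disjoint, and each of them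
-- leads to a reached vertex other than y; so there are at most |R| - 1 of them.
fan-closure : ∀ {n k} {G : Graph n} → ¬ EdgeColouring G k → (∀ v → deg G v ≤ k) →
  ∀ x (Mk : Fin n → Fin n → Set) (Mk? : ∀ v w → Dec (Mk v w)) →
  (∀ {v w} → Mk v w → w ≢ x) →
  (∀ {v w} → Mk v w → deg G x + deg G w < k) →
  (∀ {v v' w w'} → v ≢ v' → Mk v w → Mk v' w' → deg G x + deg G w + deg G w' < k) →
  ∀ {φ : PartialColouring G k} {y} → Root φ x y →
  ∃ λ (R : Fin n → Bool) → R y ≡ true × (∀ v → R v ≡ true → adj G x v ≡ true)
    × 2 + sum (λ v → 𝟙 (in? R v) * (k ∸ deg G v + count (λ w → adj? G v w ×-dec Mk? v w))) ≤ count (in? R)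
fan-closure {n} {k} {G} nocol deg≤ x Mk Mk? ≢x pair triple {φ} {y} root = R , Ry , R-adj , bound
  where
  open MarkedFan nocol deg≤ x Mk Mk? ≢x pair triple
  Reached : Fin n → Set
  Reached v = ∃ λ cs → Path φ y cs v
  Next : Fin n → Fin n → Set
  Next u v = ∃ λ c → (Avail φ u c × ¬ Missing φ x c) × mate φ c x ≡ v
  next? : ∀ u v → Dec (Next u v)
  next? u v = any? (λ c → (avail? φ u c ×-dec ¬? (missing? φ x c)) ×-dec (mate φ c x ≟ v))
  next-reached : ∀ u v → Reached u → Next u v → Reached v
  next-reached u v (cs , t) (c , (a , p) , refl) = snoc φ y cs t a p
  cl = closure next? y ([] , refl) next-reached
  R : Fin n → Bool
  R = proj₁ cl
  Ry : R y ≡ true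
  Ry = proj₁ (proj₂ cl)
  R-reached : ∀ v → R v ≡ true → Reached v
  R-reached = proj₁ (proj₂ (proj₂ cl))
  R-closed : ∀ u v → R u ≡ true → Next u v → R v ≡ true
  R-closed = proj₂ (proj₂ (proj₂ cl))
  R-adj : ∀ v → R v ≡ true → adj G x v ≡ true
  R-adj v e = path-adj (proj₁ (R-reached v e)) (adjacent root) (proj₂ (R-reached v e))
  marks : Fin n → ℕ
  marks v = count (λ w → adj? G v w ×-dec Mk? v w)
  weight : Fin n → ℕ
  weight v = k ∸ deg G v + marks v

  marks≤ : ∀ v → v ≢ x → marks v ≤ count (λ c → ¬? (missing? φ v c) ×-dec Mk? v (mate φ c v))
  marks≤ v v≢x = count-relation (λ w → adj? G v w ×-dec Mk? v w) (λ c → ¬? (missing? φ v c) ×-dec Mk? v (mate φ c v))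
    (λ w c → mate φ c v ≟ w) exists (λ w w' c _ _ e e' → trans (sym e) e')
    where
    exists : ∀ w → adj G v w ≡ true × Mk v w → ∃ λ c → mate φ c v ≡ w × (¬ Missing φ v c × Mk v (mate φ c v))
    exists w (a , mk) with covered root v w a
    ... | inj₁ (c , refl) = c , refl , (λ e → adj⇒≢ G a (sym e)) , mk
    ... | inj₂ (inj₁ (e , _)) = ⊥-elim (v≢x e)
    ... | inj₂ (inj₂ (_ , e)) = ⊥-elim (≢x mk e)

  avail-count : ∀ v → v ≢ x → missing φ v + marks v ≤ count (avail? φ v)
  avail-count v v≢x = ≤-trans (+-monoʳ-≤ (missing φ v) (marks≤ v v≢x))
    (count-disjoint (missing? φ v) (λ c → ¬? (missing? φ v c) ×-dec Mk? v (mate φ c v)) (avail? φ v)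
      (λ _ → inj₁) (λ _ p → inj₂ (proj₂ p)) (λ _ p q → proj₁ q p))

  weight≤ : ∀ v → R v ≡ true → 𝟙 (v ≟ y) + weight v ≤ count (avail? φ v)
  weight≤ v e = ≤-trans (help (v ≟ y)) (avail-count v (λ { refl → adj⇒≢ G (R-adj x e) refl }))
    where
    help : (d : Dec (v ≡ y)) → 𝟙 d + weight v ≤ missing φ v + marks v
    -- The root misses one colour more owing to the bare edge. Together with the fact that no colour
    -- leads back to `y`, this makes up the 2 in the bound.
    help (yes refl) = +-monoˡ-≤ (marks v) (m≤n+o⇒m∸n≤o′ (missing-root root))
      where
      m≤n+o⇒m∸n≤o′ : suc k ≤ missing φ v + deg G v → suc (k ∸ deg G v) ≤ missing φ v
      m≤n+o⇒m∸n≤o′ h = subst (_≤ missing φ v) (+-∸-assoc 1 (deg≤ v)) (m≤n+o⇒m∸n≤o (suc k) (deg G v)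
        (subst (suc k ≤_) (+-comm (missing φ v) (deg G v)) h))
    help (no _) = +-monoˡ-≤ (marks v) (m≤n+o⇒m∸n≤o k (deg G v)
        (subst (k ≤_) (+-comm (missing φ v) (deg G v)) (missing-deg φ v)))

  total : sum (λ v → 𝟙 (in? R v) * count (avail? φ v)) ≤ count (λ v → in? R v ×-dec ¬? (v ≟ y))
  total = begin
    sum (λ v → 𝟙 (in? R v) * count (avail? φ v)) ≡⟨ sum-cong (λ v → sym (sum-* (𝟙 (in? R v)) (λ c → 𝟙 (avail? φ v c)))) ⟩
    sum (λ v → sum (λ c → 𝟙 (in? R v) * 𝟙 (avail? φ v c))) ≡⟨ sum-cong (λ v → sum-cong (λ c → 𝟙-× (in? R v) (avail? φ v c))) ⟩
    sum (λ v → sum (λ c → 𝟙 (S? v c))) ≡⟨ sum-swap (λ v c → 𝟙 (S? v c)) ⟩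
    sum (λ c → sum (λ v → 𝟙 (S? v c))) ≤⟨ sum-mono col ⟩
    count used? ≤⟨ count-relation used? (λ v → in? R v ×-dec ¬? (v ≟ y)) (λ c v → mate φ c x ≟ v)
        (λ { c (p , v , e , a) → mate φ c x , refl , R-closed v _ e (c , (a , p) , refl) , bare root c })
        (λ { c c' v (p , _) _ e e' → unique φ c c' x p (trans e (sym e')) }) ⟩
    count (λ v → in? R v ×-dec ¬? (v ≟ y)) ∎
    where
    open ≤-Reasoning
    S? : ∀ v c → Dec (R v ≡ true × Avail φ v c)
    S? v c = in? R v ×-dec avail? φ v c
    used? : ∀ c → Dec (¬ Missing φ x c × ∃ λ v → R v ≡ true × Avail φ v c)
    used? c = ¬? (missing? φ x c) ×-dec any? (λ v → S? v c)
    col : ∀ c → sum (λ v → 𝟙 (S? v c)) ≤ 𝟙 (used? c)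
    col c = help (any? (λ v → S? v c))
      where
      help : Dec (∃ λ v → R v ≡ true × Avail φ v c) → sum (λ v → 𝟙 (S? v c)) ≤ 𝟙 (used? c)
      help (no none) = ≤-trans (≤-reflexive (count-none (λ v → S? v c) (λ v p → none (v , p)))) z≤n
      help (yes (v , e , a)) = ≤-trans
        (count-unique (λ v → S? v c) (λ u u' (e , a) (e' , a') →
          reach-disjoint root (proj₂ (R-reached u e)) (proj₂ (R-reached u' e')) a a'))
        (≤-reflexive (sym (𝟙-yes (used? c) (reach-present root (proj₂ (R-reached v e)) a , v , e , a))))

  bound : 2 + sum (λ v → 𝟙 (in? R v) * weight v) ≤ count (in? R)
  bound = begin
    2 + sum (λ v → 𝟙 (in? R v) * weight v) ≤⟨ s≤s (+-monoˡ-≤ _ (count-pos (λ v → v ≟ y) y refl)) ⟩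
    1 + (count (λ v → v ≟ y) + sum (λ v → 𝟙 (in? R v) * weight v)) ≡⟨ cong suc (sym (sum-+ (λ v → 𝟙 (v ≟ y)) (λ v → 𝟙 (in? R v) * weight v))) ⟩
    1 + sum (λ v → 𝟙 (v ≟ y) + 𝟙 (in? R v) * weight v) ≤⟨ s≤s (sum-mono pt) ⟩
    1 + sum (λ v → 𝟙 (in? R v) * count (avail? φ v)) ≤⟨ s≤s total ⟩
    1 + count (λ v → in? R v ×-dec ¬? (v ≟ y)) ≤⟨ +-monoˡ-≤ _ (count-pos (λ v → v ≟ y) y refl) ⟩
    count (λ v → v ≟ y) + count (λ v → in? R v ×-dec ¬? (v ≟ y)) ≤⟨ count-disjoint (λ v → v ≟ y) (λ v → in? R v ×-dec ¬? (v ≟ y)) (in? R)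
        (λ { v refl → Ry }) (λ _ → proj₁) (λ _ p q → proj₂ q p) ⟩
    count (in? R) ∎
    where
    open ≤-Reasoning
    pt : ∀ v → 𝟙 (v ≟ y) + 𝟙 (in? R v) * weight v ≤ 𝟙 (in? R v) * count (avail? φ v)
    pt v = help (in? R v)
      where
      help : (d : Dec (R v ≡ true)) → 𝟙 (v ≟ y) + 𝟙 d * weight v ≤ 𝟙 d * count (avail? φ v)
      help (yes e) = subst₂ _≤_ (cong (𝟙 (v ≟ y) +_) (sym (*-identityˡ (weight v)))) (sym (*-identityˡ _)) (weight≤ v e)
      help (no ¬e) = ≤-reflexive (trans (+-identityʳ _) (𝟙-no (v ≟ y) (λ { refl → ¬e Ry })))

-- Vizing's adjacency lemma and vertices of small degree

maxNbrs : ∀ {n} → Graph n → ℕ → Fin n → ℕ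
maxNbrs G k y = count (λ v → adj? G y v ×-dec (deg G v ℕ.≟ k))

never : Dec ⊥
never = no (λ ())

module _ {n k} {G : Graph n} (nocol : ¬ EdgeColouring G k) (deg≤ : ∀ v → deg G v ≤ k) where

  -- In the fan without marks, centred at `y` with root `x`, each vertex of degree below `k` has
  -- weight at least 1 and so pays for its own place, and `x` even pays `k - deg x`. The bound can
  -- then hold only with enough fan vertices of degree `k`.
  vizing-adjacency : ∀ {φ : PartialColouring G k} {x y} → Root φ y x → suc (k ∸ deg G x) ≤ maxNbrs G k y
  vizing-adjacency {φ} {x} {y} root
    with fan-closure nocol deg≤ y (λ _ _ → ⊥) (λ _ _ → never) (λ ()) (λ ()) (λ _ ()) root
  ... | R , Rx , R-adj , bound = +-cancelˡ-≤ (1 + S) _ _ (begin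
    1 + S + suc (k ∸ deg G x) ≡⟨ +-suc (1 + S) _ ⟩
    2 + S + (k ∸ deg G x) ≤⟨ +-mono-≤ bound (≤-reflexive (sym (*-identityˡ (k ∸ deg G x)))) ⟩
    count (in? R) + 1 * (k ∸ deg G x) ≤⟨ +-monoʳ-≤ (count (in? R)) (*-monoˡ-≤ (k ∸ deg G x) (count-pos (λ v → v ≟ x) x refl)) ⟩
    count (in? R) + count (λ v → v ≟ x) * (k ∸ deg G x) ≡⟨ cong (count (in? R) +_) (trans (*-comm _ (k ∸ deg G x)) (sym (sum-* (k ∸ deg G x) (λ v → 𝟙 (v ≟ x))))) ⟩
    count (in? R) + sum (λ v → (k ∸ deg G x) * 𝟙 (v ≟ x)) ≡⟨ sum-+ (λ v → 𝟙 (in? R v)) (λ v → (k ∸ deg G x) * 𝟙 (v ≟ x)) ⟨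
    sum (λ v → 𝟙 (in? R v) + (k ∸ deg G x) * 𝟙 (v ≟ x)) ≤⟨ sum-mono pt ⟩
    sum (λ v → (𝟙 (v ≟ x) + 𝟙 (isMax? v)) + 𝟙 (in? R v) * weight v) ≡⟨ sum-+ (λ v → 𝟙 (v ≟ x) + 𝟙 (isMax? v)) (λ v → 𝟙 (in? R v) * weight v) ⟩
    sum (λ v → 𝟙 (v ≟ x) + 𝟙 (isMax? v)) + S ≡⟨ cong (_+ S) (sum-+ (λ v → 𝟙 (v ≟ x)) (λ v → 𝟙 (isMax? v))) ⟩
    count (λ v → v ≟ x) + maxNbrs G k y + S ≤⟨ +-monoˡ-≤ S (+-monoˡ-≤ (maxNbrs G k y) (count-unique (λ v → v ≟ x) (λ u v p q → trans p (sym q)))) ⟩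
    1 + maxNbrs G k y + S ≡⟨ cong suc (+-comm (maxNbrs G k y) S) ⟩
    1 + S + maxNbrs G k y ∎)
    where
    open ≤-Reasoning
    weight : Fin n → ℕ
    weight v = k ∸ deg G v + count (λ w → adj? G v w ×-dec never)
    S = sum (λ v → 𝟙 (in? R v) * weight v)
    isMax? : ∀ v → Dec (adj G y v ≡ true × deg G v ≡ k)
    isMax? v = adj? G y v ×-dec (deg G v ℕ.≟ k)
    pt : ∀ v → 𝟙 (in? R v) + (k ∸ deg G x) * 𝟙 (v ≟ x) ≤ (𝟙 (v ≟ x) + 𝟙 (isMax? v)) + 𝟙 (in? R v) * weight v
    pt v = help (in? R v) (v ≟ x) (deg G v ℕ.≟ k)
      where
      help : (d : Dec (R v ≡ true)) (e : Dec (v ≡ x)) → Dec (deg G v ≡ k) →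
        𝟙 d + (k ∸ deg G x) * 𝟙 e ≤ (𝟙 e + 𝟙 (isMax? v)) + 𝟙 d * weight v
      help (no ¬r) (yes refl) _ = ⊥-elim (¬r Rx)
      help (no ¬r) (no _) _ = ≤-trans (≤-reflexive (*-zeroʳ (k ∸ deg G x))) z≤n
      help (yes r) (yes refl) _ = s≤s (≤-trans (≤-reflexive (*-identityʳ (k ∸ deg G v)))
        (≤-trans (m≤m+n _ _) (≤-trans (≤-reflexive (sym (*-identityˡ (weight v)))) (m≤n+m _ (𝟙 (isMax? v))))))
      help (yes r) (no _) (yes e) = ≤-trans (≤-reflexive (cong suc (*-zeroʳ (k ∸ deg G x))))
        (≤-trans (≤-reflexive (sym (𝟙-yes (isMax? v) (R-adj v r , e)))) (m≤m+n _ _))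
      help (yes r) (no _) (no ne) = ≤-trans (≤-reflexive (cong suc (*-zeroʳ (k ∸ deg G x))))
        (≤-trans (m<n⇒0<n∸m (≤∧≢⇒< (deg≤ v) ne))
          (≤-trans (m≤m+n _ _) (≤-trans (≤-reflexive (sym (*-identityˡ (weight v)))) (m≤n+m _ (𝟙 (isMax? v))))))

  module SmallCentre (x : Fin n) {Tiny Low : Fin n → Set} (tiny? : ∀ v → Dec (Tiny v)) (low? : ∀ v → Dec (Low v))
    (tiny-x : Tiny x)
    (tiny-tiny : ∀ {w w'} → Tiny w → Tiny w' → deg G x + deg G w + deg G w' < k)
    (tiny-low : ∀ {w w'} → Tiny w → Low w' → deg G x + deg G w + deg G w' < k) where

    t : Fin n → ℕ
    t v = count (λ w → adj? G v w ×-dec tiny? w)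

    Mid : Fin n → Set
    Mid w = Low w × ¬ Tiny w

    marks : Fin n → ℕ
    marks v = count (λ w → adj? G v w ×-dec (tiny? w ×-dec ¬? (w ≟ x)))

    t≤marks : ∀ v → t v ≤ 1 + marks v
    t≤marks v = ≤-trans (count-cover (λ w → w ≟ x) (λ w → adj? G v w ×-dec (tiny? w ×-dec ¬? (w ≟ x))) (λ w → adj? G v w ×-dec tiny? w) split)
      (+-monoˡ-≤ (marks v) (count-unique (λ v → v ≟ x) (λ u v p q → trans p (sym q))))
      where
      split : ∀ w → adj G v w ≡ true × Tiny w → w ≡ x ⊎ (adj G v w ≡ true × Tiny w × w ≢ x)
      split w (a , p) with w ≟ x
      ... | yes e = inj₁ e
      ... | no ne = inj₂ (a , p , ne)

    -- The centre is tiny but never marked, so passing from marks to `t` costs one per fan vertex;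
    -- this is the second `count (in? R)`.
    collect : ∀ (R : Fin n → Bool) (weight : Fin n → ℕ) c → (∀ v → marks v ≤ weight v) →
      c + sum (λ v → 𝟙 (in? R v) * weight v) ≤ count (in? R) →
      c + sum (λ v → 𝟙 (in? R v) * t v) ≤ count (in? R) + count (in? R)
    collect R weight c le h = begin
      c + sum (λ v → 𝟙 (in? R v) * t v) ≤⟨ +-monoʳ-≤ c (sum-mono pt) ⟩
      c + sum (λ v → 𝟙 (in? R v) * weight v + 𝟙 (in? R v)) ≡⟨ cong (c +_) (sum-+ (λ v → 𝟙 (in? R v) * weight v) (λ v → 𝟙 (in? R v))) ⟩
      c + (sum (λ v → 𝟙 (in? R v) * weight v) + count (in? R)) ≡⟨ +-assoc c _ _ ⟨
      c + sum (λ v → 𝟙 (in? R v) * weight v) + count (in? R) ≤⟨ +-monoˡ-≤ (count (in? R)) h ⟩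
      count (in? R) + count (in? R) ∎
      where
      open ≤-Reasoning
      pt : ∀ v → 𝟙 (in? R v) * t v ≤ 𝟙 (in? R v) * weight v + 𝟙 (in? R v)
      pt v = ≤-trans (*-monoʳ-≤ (𝟙 (in? R v)) (≤-trans (t≤marks v) (s≤s (le v))))
        (≤-reflexive (trans (*-suc (𝟙 (in? R v)) (weight v)) (+-comm (𝟙 (in? R v)) _)))

    Spread : Fin n → ℕ → Set
    Spread y c = ∃ λ (R : Fin n → Bool) → R y ≡ true × (∀ v → R v ≡ true → adj G x v ≡ true)
      × c + sum (λ v → 𝟙 (in? R v) * t v) ≤ count (in? R) + count (in? R)

    spread : ∀ {φ : PartialColouring G k} {y} → Root φ x y → Spread y 2
    spread {φ} {y} root with fan-closure nocol deg≤ x (λ _ w → Tiny w × w ≢ x) (λ _ w → tiny? w ×-dec ¬? (w ≟ x)) proj₂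
      (λ (p , _) → ≤-trans (s≤s (m≤m+n _ _)) (tiny-tiny p tiny-x)) (λ _ (p , _) (q , _) → tiny-tiny p q) root
    ... | R , Ry , R-adj , bound = R , Ry , R-adj , collect R _ 2 (λ v → m≤n+m (marks v) (k ∸ deg G v)) bound

    -- Only the root y may see low vertices that are not tiny, so that no two of them need a common missing colour.
    module _ (y : Fin n) where
      private
        Mk : Fin n → Fin n → Set
        Mk v w = (Tiny w × w ≢ x) ⊎ (v ≡ y × Mid w)
        Mk? : ∀ v w → Dec (Mk v w)
        Mk? v w = (tiny? w ×-dec ¬? (w ≟ x)) ⊎-dec ((v ≟ y) ×-dec (low? w ×-dec ¬? (tiny? w)))
        Mk-≢x : ∀ {v w} → Mk v w → w ≢ x
        Mk-≢x (inj₁ (_ , ne)) = ne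
        Mk-≢x (inj₂ (_ , _ , nt)) refl = nt tiny-x
        pair : ∀ {v w} → Mk v w → deg G x + deg G w < k
        pair (inj₁ (p , _)) = ≤-trans (s≤s (m≤m+n _ _)) (tiny-tiny p tiny-x)
        pair (inj₂ (_ , p , _)) = ≤-trans (s≤s (+-monoˡ-≤ _ (m≤m+n (deg G x) (deg G x)))) (tiny-low tiny-x p)
        triple : ∀ {v v' w w'} → v ≢ v' → Mk v w → Mk v' w' → deg G x + deg G w + deg G w' < k
        triple ne (inj₁ (p , _)) (inj₁ (q , _)) = tiny-tiny p q
        triple ne (inj₁ (p , _)) (inj₂ (_ , q , _)) = tiny-low p q
        triple {w = w} {w'} ne (inj₂ (_ , q , _)) (inj₁ (p , _)) = subst (_< k) (xy∙z≈xz∙y (deg G x) (deg G w') (deg G w)) (tiny-low p q)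
        triple ne (inj₂ (e , _)) (inj₂ (e' , _)) = ⊥-elim (ne (trans e (sym e')))

      -- A mid neighbour of `y` is a mark that `t y` does not count; it raises the constant from 2
      -- to 3.
      spread-mid : ∀ {φ : PartialColouring G k} → Root φ x y → (∃ λ w → adj G y w ≡ true × Mid w) → Spread y 3
      spread-mid {φ} root (w₀ , a₀ , low₀ , ¬tiny₀) with fan-closure nocol deg≤ x Mk Mk? Mk-≢x pair triple root
      ... | R , Ry , R-adj , bound = R , Ry , R-adj , (begin
        3 + sum (λ v → 𝟙 (in? R v) * t v) ≤⟨ +-monoʳ-≤ 2 (+-monoˡ-≤ _ (count-pos (λ v → v ≟ y) y refl)) ⟩
        2 + (count (λ v → v ≟ y) + sum (λ v → 𝟙 (in? R v) * t v)) ≡⟨ cong (2 +_) (sym (sum-+ (λ v → 𝟙 (v ≟ y)) (λ v → 𝟙 (in? R v) * t v))) ⟩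
        2 + sum (λ v → 𝟙 (v ≟ y) + 𝟙 (in? R v) * t v) ≤⟨ +-monoʳ-≤ 2 (sum-mono pt) ⟩
        2 + sum (λ v → 𝟙 (in? R v) * weight v + 𝟙 (in? R v)) ≡⟨ cong (2 +_) (sum-+ (λ v → 𝟙 (in? R v) * weight v) (λ v → 𝟙 (in? R v))) ⟩
        2 + sum (λ v → 𝟙 (in? R v) * weight v) + count (in? R) ≤⟨ +-monoˡ-≤ (count (in? R)) bound ⟩
        count (in? R) + count (in? R) ∎)
        where
        open ≤-Reasoning
        weight : Fin n → ℕ
        weight v = k ∸ deg G v + count (λ w → adj? G v w ×-dec Mk? v w)
        pt : ∀ v → 𝟙 (v ≟ y) + 𝟙 (in? R v) * t v ≤ 𝟙 (in? R v) * weight v + 𝟙 (in? R v)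
        pt v = help (in? R v) (v ≟ y)
          where
          all = count (λ w → adj? G v w ×-dec Mk? v w)
          marks≤all : marks v ≤ all
          marks≤all = count-mono (λ w → adj? G v w ×-dec (tiny? w ×-dec ¬? (w ≟ x))) (λ w → adj? G v w ×-dec Mk? v w) (λ { w (a , p) → a , inj₁ p })
          suc-marks≤ : v ≡ y → suc (marks v) ≤ all
          suc-marks≤ refl = ≤-trans (+-monoˡ-≤ (marks v) (count-pos (λ w → w ≟ w₀) w₀ refl))
            (count-disjoint (λ w → w ≟ w₀) (λ w → adj? G v w ×-dec (tiny? w ×-dec ¬? (w ≟ x))) (λ w → adj? G v w ×-dec Mk? v w)
              (λ { w refl → a₀ , inj₂ (refl , low₀ , ¬tiny₀) }) (λ { w (a , p) → a , inj₁ p }) (λ { w refl (_ , p , _) → ¬tiny₀ p }))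
          help : (d : Dec (R v ≡ true)) (e : Dec (v ≡ y)) → 𝟙 e + 𝟙 d * t v ≤ 𝟙 d * weight v + 𝟙 d
          help (no ¬r) (yes refl) = ⊥-elim (¬r Ry)
          help (no ¬r) (no _) = z≤n
          help (yes _) (yes e) = begin
            suc (t v + 0) ≡⟨ cong suc (+-identityʳ (t v)) ⟩
            suc (t v) ≤⟨ s≤s (≤-trans (t≤marks v) (≤-trans (suc-marks≤ e) (m≤n+m all _))) ⟩
            suc (weight v) ≡⟨ +-comm 1 (weight v) ⟩
            weight v + 1 ≡⟨ cong (_+ 1) (sym (+-identityʳ (weight v))) ⟩
            weight v + 0 + 1 ∎
          help (yes _) (no _) = begin
            t v + 0 ≡⟨ +-identityʳ (t v) ⟩
            t v ≤⟨ ≤-trans (t≤marks v) (s≤s (≤-trans marks≤all (m≤n+m all _))) ⟩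
            suc (weight v) ≡⟨ +-comm 1 (weight v) ⟩
            weight v + 1 ≡⟨ cong (_+ 1) (sym (+-identityʳ (weight v))) ⟩
            weight v + 0 + 1 ∎

-- Shares received by a vertex of small degree

argmax : ∀ {n p} {P : Fin n → Set p} (P? : ∀ v → Dec (P v)) (f : Fin n → ℕ) M → (∀ v → f v ≤ M) →
  ∃ P → ∃ λ y → P y × (∀ v → P v → f v ≤ f y)
argmax {P = P} P? f M f≤M (y₀ , p₀) = go M y₀ p₀ (m≤m+n M _)
  where
  go : ∀ fuel y → P y → M ≤ fuel + f y → ∃ λ y → P y × (∀ v → P v → f v ≤ f y)
  go fuel y p h with any? (λ v → P? v ×-dec (f y <? f v))
  go fuel y p h | no none = y , p , λ v q → ≮⇒≥ (λ lt → none (v , q , lt))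
  go zero y p h | yes (v , q , lt) = ⊥-elim (<⇒≱ lt (≤-trans (f≤M v) h))
  go (suc fuel) y p h | yes (v , q , lt) = go fuel v q (≤-trans h (≤-trans (≤-reflexive (sym (+-suc fuel (f y)))) (+-monoʳ-≤ fuel lt)))

-- The bound on the sum of 1/t depends on the fan size `r` with coefficient 1/2 - 1/T, which is
-- nonnegative, so `r = T + 1` is the worst case. In terms of the slacks `q = T - 2` and
-- `s = r - T - 1`, twice the difference is `B * q * s` plus the slack of the hypotheses.
spread-arith : ∀ B D q s S W → let T = 2 + q ; r = 1 + T + s in
  2 * B * D + 3 * T * B * r + (T * T * B + 2 * B) ≤ 2 * T * W + T * B * S + 2 * B * r + 3 * T * B →
  2 + S ≤ r + r → B * (T * T + D) ≤ T * W + B * T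
spread-arith B D q s S W h h' = *-cancelˡ-≤ 2 (+-cancelʳ-≤ (T * B * S + 2 * B * r + 3 * T * B + T * B * (r + r)) _ _ (begin
  2 * (B * (T * T + D)) + (T * B * S + 2 * B * r + 3 * T * B + T * B * (r + r)) ≤⟨ m≤m+n _ (B * q * s) ⟩
  2 * (B * (T * T + D)) + (T * B * S + 2 * B * r + 3 * T * B + T * B * (r + r)) + B * q * s ≡⟨ lhs B D q s S ⟩
  (2 * B * D + 3 * T * B * r + (T * T * B + 2 * B)) + T * B * (2 + S) + 2 * B * T ≤⟨ +-monoˡ-≤ (2 * B * T) (+-mono-≤ h (*-monoʳ-≤ (T * B) h')) ⟩
  (2 * T * W + T * B * S + 2 * B * r + 3 * T * B) + T * B * (r + r) + 2 * B * T ≡⟨ rhs B q s S W ⟩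
  2 * (T * W + B * T) + (T * B * S + 2 * B * r + 3 * T * B + T * B * (r + r)) ∎))
  where
  open ≤-Reasoning
  open +-*-Solver
  T = 2 + q
  r = 1 + T + s
  lhs : ∀ B D q s S → let T = 2 + q ; r = 1 + T + s in
    2 * (B * (T * T + D)) + (T * B * S + 2 * B * r + 3 * T * B + T * B * (r + r)) + B * q * s
    ≡ (2 * B * D + 3 * T * B * r + (T * T * B + 2 * B)) + T * B * (2 + S) + 2 * B * T
  lhs = solve 5 (λ B D q s S → let T = con 2 :+ q ; r = con 1 :+ T :+ s in
    con 2 :* (B :* (T :* T :+ D)) :+ (T :* B :* S :+ con 2 :* B :* r :+ con 3 :* T :* B :+ T :* B :* (r :+ r)) :+ B :* q :* s
    := (con 2 :* B :* D :+ con 3 :* T :* B :* r :+ (T :* T :* B :+ con 2 :* B)) :+ T :* B :* (con 2 :+ S) :+ con 2 :* B :* T) refl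
  rhs : ∀ B q s S W → let T = 2 + q ; r = 1 + T + s in
    (2 * T * W + T * B * S + 2 * B * r + 3 * T * B) + T * B * (r + r) + 2 * B * T
    ≡ 2 * (T * W + B * T) + (T * B * S + 2 * B * r + 3 * T * B + T * B * (r + r))
  rhs = solve 5 (λ B q s S W → let T = con 2 :+ q ; r = con 1 :+ T :+ s in
    (con 2 :* T :* W :+ T :* B :* S :+ con 2 :* B :* r :+ con 3 :* T :* B) :+ T :* B :* (r :+ r) :+ con 2 :* B :* T
    := con 2 :* (T :* W :+ B :* T) :+ (T :* B :* S :+ con 2 :* B :* r :+ con 3 :* T :* B :+ T :* B :* (r :+ r))) refl

sum-+* : ∀ {n} (f : Fin n → ℕ) c (g : Fin n → ℕ) → sum (λ v → f v + c * g v) ≡ sum f + c * sum g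
sum-+* f c g = trans (sum-+ f (λ v → c * g v)) (cong (sum f +_) (sum-* c g))

sum-*+* : ∀ {n} b (f : Fin n → ℕ) c (g : Fin n → ℕ) → sum (λ v → b * f v + c * g v) ≡ b * sum f + c * sum g
sum-*+* b f c g = trans (sum-+* (λ v → b * f v) c g) (cong (_+ c * sum g) (sum-* b f))

count-single : ∀ {n} (y : Fin n) → count (λ v → v ≟ y) ≡ 1
count-single y = ≤-antisym (count-unique (λ v → v ≟ y) (λ u v p q → trans p (sym q))) (count-pos (λ v → v ≟ y) y refl)

-- `W t` is an integer stand-in for `B / t`. It has to be accurate only up to `E`, so that a fixed
-- common multiple can serve as `B`.
module WeightedShares {n} {Nb : Fin n → Set} (nb? : ∀ v → Dec (Nb v)) (t : Fin n → ℕ) (t-pos : ∀ {v} → Nb v → 1 ≤ t v)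
  (B E : ℕ) (2≤E : 2 ≤ E) (W : ℕ → ℕ) (W-lower : ∀ t T → 1 ≤ t → t ≤ T → T ≤ E → B ≤ T * W t) where

  D : ℕ
  D = count nb?

  received : ℕ
  received = sum (λ v → 𝟙 (nb? v) * W (t v))

  -- 1/t ≥ (3 - t)/2, with equality for t = 1 and t = 2.
  W-tangent : ∀ t → 1 ≤ t → 3 * B ≤ 2 * W t + B * t
  W-tangent (suc zero) _ = begin
    3 * B ≡⟨ solve 1 (λ B → con 3 :* B := con 2 :* B :+ B :* con 1) refl B ⟩
    2 * B + B * 1 ≤⟨ +-monoˡ-≤ (B * 1) (*-monoʳ-≤ 2 (subst (B ≤_) (+-identityʳ (W 1)) (W-lower 1 1 ≤-refl ≤-refl (≤-trans (n≤1+n 1) 2≤E)))) ⟩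
    2 * W 1 + B * 1 ∎
    where
    open ≤-Reasoning
    open +-*-Solver
  W-tangent (suc (suc zero)) _ = begin
    3 * B ≡⟨ solve 1 (λ B → con 3 :* B := B :+ B :* con 2) refl B ⟩
    B + B * 2 ≤⟨ +-monoˡ-≤ (B * 2) (W-lower 2 2 (s≤s z≤n) ≤-refl 2≤E) ⟩
    2 * W 2 + B * 2 ∎
    where
    open ≤-Reasoning
    open +-*-Solver
  W-tangent (suc (suc (suc t))) _ = begin
    3 * B ≡⟨ *-comm 3 B ⟩
    B * 3 ≤⟨ *-monoʳ-≤ B (s≤s (s≤s (s≤s z≤n))) ⟩
    B * (3 + t) ≤⟨ m≤n+m _ (2 * W (3 + t)) ⟩
    2 * W (3 + t) + B * (3 + t) ∎
    where open ≤-Reasoning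

  module _ (R : Fin n → Bool) (R-adj : ∀ v → R v ≡ true → Nb v) where

    r S : ℕ
    r = count (in? R)
    S = sum (λ v → 𝟙 (in? R v) * t v)

    -- A linear inequality between `D`, `r`, `S` and `received` is reduced to a check at each
    -- vertex, which depends only on its being a neighbour, in the fan, or the root.
    combine : ∀ a b c d e f g (y : Fin n) →
      (∀ v → (nb : Dec (Nb v)) (i : Dec (R v ≡ true)) (j : Dec (v ≡ y)) →
        a * 𝟙 nb + b * 𝟙 i + c * 𝟙 j ≤ d * (𝟙 nb * W (t v)) + e * (𝟙 i * t v) + f * 𝟙 i + g * 𝟙 j) →
      a * D + b * r + c ≤ d * received + e * S + f * r + g
    combine a b c d e f g y pt = begin
      a * D + b * r + c ≡⟨ cong ((a * D + b * r) +_) (trans (sym (*-identityʳ c)) (cong (c *_) (sym (count-single y)))) ⟩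
      a * count nb? + b * r + c * count (λ v → v ≟ y) ≡⟨ cong (_+ c * count (λ v → v ≟ y)) (sym (sum-*+* a (λ v → 𝟙 (nb? v)) b (λ v → 𝟙 (in? R v)))) ⟩
      sum (λ v → a * 𝟙 (nb? v) + b * 𝟙 (in? R v)) + c * count (λ v → v ≟ y) ≡⟨ sym (sum-+* _ c (λ v → 𝟙 (v ≟ y))) ⟩
      sum (λ v → a * 𝟙 (nb? v) + b * 𝟙 (in? R v) + c * 𝟙 (v ≟ y)) ≤⟨ sum-mono (λ v → pt v (nb? v) (in? R v) (v ≟ y)) ⟩
      sum (λ v → d * (𝟙 (nb? v) * W (t v)) + e * (𝟙 (in? R v) * t v) + f * 𝟙 (in? R v) + g * 𝟙 (v ≟ y)) ≡⟨ sum-+* _ g (λ v → 𝟙 (v ≟ y)) ⟩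
      sum (λ v → d * (𝟙 (nb? v) * W (t v)) + e * (𝟙 (in? R v) * t v) + f * 𝟙 (in? R v)) + g * count (λ v → v ≟ y) ≡⟨ cong₂ _+_
          (trans (sum-+* _ f (λ v → 𝟙 (in? R v))) (cong (_+ f * r) (sum-*+* d (λ v → 𝟙 (nb? v) * W (t v)) e (λ v → 𝟙 (in? R v) * t v))))
          (trans (cong (g *_) (count-single y)) (*-identityʳ g)) ⟩
      d * received + e * S + f * r + g ∎
      where open ≤-Reasoning

    -- A neighbour in the fan gets at least (3 - t)/2 and any other at least 1/2. Twice the sum is
    -- therefore at least `D + 2 r - S`, where `S` is at most `2 r - c`.
    few-shares : ∀ c → c + S ≤ r + r → (∀ v → Nb v → t v ≤ 2) → ∀ y → B * (D + c) ≤ 2 * received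
    few-shares c h t≤2 y = +-cancelʳ-≤ (B * S + B * (r + r)) _ _ (begin
      B * (D + c) + (B * S + B * (r + r)) ≡⟨ solve 5 (λ B D c S r → B :* (D :+ c) :+ (B :* S :+ B :* (r :+ r)) := (B :* D :+ con 2 :* B :* r :+ con 0) :+ B :* (c :+ S)) refl B (D) c S r ⟩
      (B * D + 2 * B * r + 0) + B * (c + S) ≤⟨ +-mono-≤ (combine B (2 * B) 0 2 B 0 0 y pt) (*-monoʳ-≤ B h) ⟩
      (2 * received + B * S + 0 * r + 0) + B * (r + r) ≡⟨ solve 4 (λ B W S r → (con 2 :* W :+ B :* S :+ con 0 :* r :+ con 0) :+ B :* (r :+ r) := con 2 :* W :+ (B :* S :+ B :* (r :+ r))) refl B received S r ⟩
      2 * received + (B * S + B * (r + r)) ∎)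
      where
      open ≤-Reasoning
      open +-*-Solver
      pt : ∀ v (nb : Dec (Nb v)) (i : Dec (R v ≡ true)) (j : Dec (v ≡ y)) →
        B * 𝟙 nb + 2 * B * 𝟙 i + 0 * 𝟙 j ≤ 2 * (𝟙 nb * W (t v)) + B * (𝟙 i * t v) + 0 * 𝟙 i + 0 * 𝟙 j
      pt v (no ¬a) (yes e) j = ⊥-elim (¬a (R-adj v e))
      pt v (no ¬a) (no _) j = ≤-trans (≤-reflexive (solve 1 (λ B → B :* con 0 :+ con 2 :* B :* con 0 :+ con 0 := con 0) refl B)) z≤n
      pt v (yes a) (yes e) j = begin
        B * 1 + 2 * B * 1 + 0 ≡⟨ solve 1 (λ B → B :* con 1 :+ con 2 :* B :* con 1 :+ con 0 := con 3 :* B) refl B ⟩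
        3 * B ≤⟨ W-tangent (t v) (t-pos a) ⟩
        2 * W (t v) + B * t v ≡⟨ solve 3 (λ B W t → con 2 :* W :+ B :* t := con 2 :* (con 1 :* W) :+ B :* (con 1 :* t) :+ con 0 :+ con 0) refl B (W (t v)) (t v) ⟩
        2 * (1 * W (t v)) + B * (1 * t v) + 0 + 0 ∎
      pt v (yes a) (no _) j = begin
        B * 1 + 2 * B * 0 + 0 ≡⟨ solve 1 (λ B → B :* con 1 :+ con 2 :* B :* con 0 :+ con 0 := B) refl B ⟩
        B ≤⟨ W-lower (t v) 2 (t-pos a) (t≤2 v a) 2≤E ⟩
        2 * W (t v) ≡⟨ solve 2 (λ B W → con 2 :* W := con 2 :* (con 1 :* W) :+ B :* con 0 :+ con 0 :+ con 0) refl B (W (t v)) ⟩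
        2 * (1 * W (t v)) + B * 0 + 0 + 0 ∎

    module _ (y : Fin n) (Ry : R y ≡ true) (h : 2 + S ≤ r + r) where

      -- Every fan vertex has `t` at least 1, so `S` is at least `t y + r - 1`; it is also at most
      -- `2 r - 2`.
      size : 1 + t y ≤ r
      size = +-cancelʳ-≤ (r + S + 1) _ _ (begin
        1 + t y + (r + S + 1) ≡⟨ solve 3 (λ T r S → con 1 :+ T :+ (r :+ S :+ con 1) := (r :+ T) :+ (con 2 :+ S)) refl (t y) r S ⟩
        (r + t y) + (2 + S) ≤⟨ +-mono-≤ base h ⟩
        (S + 1) + (r + r) ≡⟨ solve 2 (λ r S → (S :+ con 1) :+ (r :+ r) := r :+ (r :+ S :+ con 1)) refl r S ⟩
        r + (r + S + 1) ∎)
        where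
        open ≤-Reasoning
        open +-*-Solver
        pt : ∀ v (i : Dec (R v ≡ true)) (j : Dec (v ≡ y)) → 𝟙 i + t y * 𝟙 j ≤ 𝟙 i * t v + 1 * 𝟙 j
        pt v (no ¬e) (yes refl) = ⊥-elim (¬e Ry)
        pt v (no _) (no _) = ≤-reflexive (*-zeroʳ (t y))
        pt v (yes e) (yes refl) = ≤-reflexive (solve 1 (λ T → con 1 :+ T :* con 1 := con 1 :* T :+ con 1) refl (t v))
        pt v (yes e) (no _) = begin
          1 + t y * 0 ≡⟨ cong suc (*-zeroʳ (t y)) ⟩
          1 ≤⟨ t-pos (R-adj v e) ⟩
          t v ≡⟨ solve 1 (λ t → t := con 1 :* t :+ con 0) refl (t v) ⟩
          1 * t v + 0 ∎
        base : r + t y ≤ S + 1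
        base = subst₂ _≤_ (trans (sum-+* _ (t y) (λ v → 𝟙 (v ≟ y))) (cong (r +_) (trans (cong (t y *_) (count-single y)) (*-identityʳ (t y)))))
          (trans (sum-+* _ 1 (λ v → 𝟙 (v ≟ y))) (cong (λ z → S + 1 * z) (count-single y)))
          (sum-mono (λ v → pt v (in? R v) (v ≟ y)))

      -- Only the fan without its root is counted, by the tangent bound. This requires no upper
      -- bound on `t y`.
      many-shares : B * t y ≤ received
      many-shares = *-cancelˡ-≤ 2 (+-cancelʳ-≤ (B * S + B * (r + r) + 3 * B) _ _ (begin
        2 * (B * t y) + (B * S + B * (r + r) + 3 * B) ≡⟨ solve 4 (λ B T S r → con 2 :* (B :* T) :+ (B :* S :+ B :* (r :+ r) :+ con 3 :* B)
            := B :* (con 1 :+ T) :+ (B :* (r :+ r) :+ B :* T :+ B :* (con 2 :+ S))) refl B (t y) S r ⟩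
        B * (1 + t y) + (B * (r + r) + B * t y + B * (2 + S)) ≤⟨ +-mono-≤ (*-monoʳ-≤ B size) (+-monoʳ-≤ _ (*-monoʳ-≤ B h)) ⟩
        B * r + (B * (r + r) + B * t y + B * (r + r)) ≡⟨ solve 4 (λ B T D r → B :* r :+ (B :* (r :+ r) :+ B :* T :+ B :* (r :+ r)) := (con 0 :* D :+ con 3 :* B :* r :+ B :* T) :+ B :* (r :+ r)) refl B (t y) (D) r ⟩
        (0 * D + 3 * B * r + B * t y) + B * (r + r) ≤⟨ +-monoˡ-≤ (B * (r + r)) (combine 0 (3 * B) (B * t y) 2 B 0 (3 * B) y pt) ⟩
        (2 * received + B * S + 0 * r + 3 * B) + B * (r + r) ≡⟨ solve 4 (λ B W S r → (con 2 :* W :+ B :* S :+ con 0 :* r :+ con 3 :* B) :+ B :* (r :+ r) := con 2 :* W :+ (B :* S :+ B :* (r :+ r) :+ con 3 :* B)) refl B received S r ⟩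
        2 * received + (B * S + B * (r + r) + 3 * B) ∎))
        where
        open ≤-Reasoning
        open +-*-Solver
        pt : ∀ v (nb : Dec (Nb v)) (i : Dec (R v ≡ true)) (j : Dec (v ≡ y)) →
          0 * 𝟙 nb + 3 * B * 𝟙 i + B * t y * 𝟙 j ≤ 2 * (𝟙 nb * W (t v)) + B * (𝟙 i * t v) + 0 * 𝟙 i + 3 * B * 𝟙 j
        pt v (no ¬a) (yes e) j = ⊥-elim (¬a (R-adj v e))
        pt v nb (no ¬e) (yes refl) = ⊥-elim (¬e Ry)
        pt v nb (no _) (no _) = ≤-trans (≤-reflexive (solve 2 (λ B T → con 3 :* B :* con 0 :+ B :* T :* con 0 := con 0) refl B (t y))) z≤n
        pt v (yes a) (yes e) (yes refl) = begin
          3 * B * 1 + B * t v * 1 ≤⟨ m≤n+m _ (2 * W (t v)) ⟩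
          2 * W (t v) + (3 * B * 1 + B * t v * 1) ≡⟨ solve 3 (λ B T W → con 2 :* W :+ (con 3 :* B :* con 1 :+ B :* T :* con 1) := con 2 :* (con 1 :* W) :+ B :* (con 1 :* T) :+ con 0 :+ con 3 :* B :* con 1) refl B (t v) (W (t v)) ⟩
          2 * (1 * W (t v)) + B * (1 * t v) + 0 + 3 * B * 1 ∎
        pt v (yes a) (yes e) (no _) = begin
          3 * B * 1 + B * t y * 0 ≡⟨ solve 2 (λ B T → con 3 :* B :* con 1 :+ B :* T :* con 0 := con 3 :* B) refl B (t y) ⟩
          3 * B ≤⟨ W-tangent (t v) (t-pos a) ⟩
          2 * W (t v) + B * t v ≡⟨ solve 3 (λ B T W → con 2 :* W :+ B :* T := con 2 :* (con 1 :* W) :+ B :* (con 1 :* T) :+ con 0 :+ con 3 :* B :* con 0) refl B (t v) (W (t v)) ⟩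
          2 * (1 * W (t v)) + B * (1 * t v) + 0 + 3 * B * 0 ∎

      -- Neighbours outside the fan and the root receive at least 1/T each, by maximality of
      -- `T = t y`, and the rest of the fan is bounded by the tangent.
      max-shares : 2 ≤ t y → t y ≤ E → (∀ v → Nb v → t v ≤ t y) →
        B * (t y * t y + D) ≤ t y * received + B * t y
      max-shares 2≤T T≤E top = subst₂ (λ T r → 2 * B * D + 3 * T * B * r + (T * T * B + 2 * B) ≤ 2 * T * received + T * B * S + 2 * B * r + 3 * T * B →
          2 + S ≤ r + r → B * (T * T + D) ≤ T * received + B * T) T≡ r≡ (spread-arith B (D) q s S received)
          (combine (2 * B) (3 * t y * B) (t y * t y * B + 2 * B) (2 * t y) (t y * B) (2 * B) (3 * t y * B) y pt) h
        where
        open ≤-Reasoning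
        open +-*-Solver
        q = t y ∸ 2
        T≡ : 2 + q ≡ t y
        T≡ = m+[n∸m]≡n 2≤T
        s = r ∸ (1 + t y)
        r≡ : 1 + (2 + q) + s ≡ r
        r≡ = trans (cong (λ z → 1 + z + s) T≡) (m+[n∸m]≡n size)
        pt : ∀ v (nb : Dec (Nb v)) (i : Dec (R v ≡ true)) (j : Dec (v ≡ y)) →
          2 * B * 𝟙 nb + 3 * t y * B * 𝟙 i + (t y * t y * B + 2 * B) * 𝟙 j
          ≤ 2 * t y * (𝟙 nb * W (t v)) + t y * B * (𝟙 i * t v) + 2 * B * 𝟙 i + 3 * t y * B * 𝟙 j
        pt v (no ¬a) (yes e) j = ⊥-elim (¬a (R-adj v e))
        pt v nb (no ¬e) (yes refl) = ⊥-elim (¬e Ry)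
        pt v (no _) (no _) (no _) = ≤-trans (≤-reflexive (solve 2 (λ B T → con 2 :* B :* con 0 :+ con 3 :* T :* B :* con 0 :+ (T :* T :* B :+ con 2 :* B) :* con 0 := con 0) refl B (t y))) z≤n
        pt v (yes a) (no _) (no _) = begin
          2 * B * 1 + 3 * t y * B * 0 + (t y * t y * B + 2 * B) * 0 ≡⟨ solve 2 (λ B T → con 2 :* B :* con 1 :+ con 3 :* T :* B :* con 0 :+ (T :* T :* B :+ con 2 :* B) :* con 0 := con 2 :* B) refl B (t y) ⟩
          2 * B ≤⟨ *-monoʳ-≤ 2 (W-lower (t v) (t y) (t-pos a) (top v a) T≤E) ⟩
          2 * (t y * W (t v)) ≡⟨ solve 3 (λ B T W → con 2 :* (T :* W) := con 2 :* T :* (con 1 :* W) :+ T :* B :* con 0 :+ con 2 :* B :* con 0 :+ con 3 :* T :* B :* con 0) refl B (t y) (W (t v)) ⟩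
          2 * t y * (1 * W (t v)) + t y * B * 0 + 2 * B * 0 + 3 * t y * B * 0 ∎
        pt v (yes a) (yes e) (no _) = begin
          2 * B * 1 + 3 * t y * B * 1 + (t y * t y * B + 2 * B) * 0 ≡⟨ solve 2 (λ B T → con 2 :* B :* con 1 :+ con 3 :* T :* B :* con 1 :+ (T :* T :* B :+ con 2 :* B) :* con 0 := T :* (con 3 :* B) :+ con 2 :* B) refl B (t y) ⟩
          t y * (3 * B) + 2 * B ≤⟨ +-monoˡ-≤ (2 * B) (*-monoʳ-≤ (t y) (W-tangent (t v) (t-pos a))) ⟩
          t y * (2 * W (t v) + B * t v) + 2 * B ≡⟨ solve 4 (λ B T t W → T :* (con 2 :* W :+ B :* t) :+ con 2 :* B := con 2 :* T :* (con 1 :* W) :+ T :* B :* (con 1 :* t) :+ con 2 :* B :* con 1 :+ con 3 :* T :* B :* con 0) refl B (t y) (t v) (W (t v)) ⟩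
          2 * t y * (1 * W (t v)) + t y * B * (1 * t v) + 2 * B * 1 + 3 * t y * B * 0 ∎
        pt v (yes a) (yes e) (yes refl) = begin
          2 * B * 1 + 3 * t v * B * 1 + (t v * t v * B + 2 * B) * 1 ≡⟨ solve 2 (λ B T → con 2 :* B :* con 1 :+ con 3 :* T :* B :* con 1 :+ (T :* T :* B :+ con 2 :* B) :* con 1 := con 2 :* B :+ (con 2 :* B :+ con 3 :* T :* B :+ T :* T :* B)) refl B (t v) ⟩
          2 * B + (2 * B + 3 * t v * B + t v * t v * B) ≤⟨ +-monoˡ-≤ _ (*-monoʳ-≤ 2 (W-lower (t v) (t v) (t-pos a) ≤-refl T≤E)) ⟩
          2 * (t v * W (t v)) + (2 * B + 3 * t v * B + t v * t v * B) ≡⟨ solve 3 (λ B T W → con 2 :* (T :* W) :+ (con 2 :* B :+ con 3 :* T :* B :+ T :* T :* B) := con 2 :* T :* (con 1 :* W) :+ T :* B :* (con 1 :* T) :+ con 2 :* B :* con 1 :+ con 3 :* T :* B :* con 1) refl B (t v) (W (t v)) ⟩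
          2 * t v * (1 * W (t v)) + t v * B * (1 * t v) + 2 * B * 1 + 3 * t v * B * 1 ∎

  Spread : Fin n → ℕ → Set
  Spread y c = ∃ λ (R : Fin n → Bool) → R y ≡ true × (∀ v → R v ≡ true → Nb v)
    × c + sum (λ v → 𝟙 (in? R v) * t v) ≤ count (in? R) + count (in? R)

  -- `arith` says that T - 1 + D/T is at least E/2 + 1/3. The extra third is what the reserve for
  -- mid vertices costs.
  module Totals (E≤ : E ≤ 2 + D) (nonempty : ∃ Nb) (M : ℕ) (t≤M : ∀ v → t v ≤ M) (spread : ∀ {y} → Nb y → Spread y 2)
    (arith : ∀ T → 3 ≤ T → 2 * T ≤ E → T * (3 * E + 2) + 6 * T ≤ 6 * (T * T + D)) where

    top : ∃ λ y → Nb y × (∀ v → Nb v → t v ≤ t y)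
    top = argmax nb? t M t≤M nonempty

    y = proj₁ top
    xy = proj₁ (proj₂ top)
    y-top = proj₂ (proj₂ top)

    slack : 3 ≤ t y → B * (3 * E + 2) ≤ 6 * received
    slack 3≤T = cases (spread xy) (2 * t y ≤? E)
      where
      open ≤-Reasoning
      open +-*-Solver
      cases : Spread y 2 → Dec (2 * t y ≤ E) → B * (3 * E + 2) ≤ 6 * received
      cases (R , Ry , R-adj , h) (yes 2T≤E) = *-cancelˡ-≤ (t y) ⦃ >-nonZero (≤-trans (s≤s z≤n) 3≤T) ⦄ (+-cancelʳ-≤ (6 * (B * t y)) _ _ (begin
        t y * (B * (3 * E + 2)) + 6 * (B * t y) ≡⟨ solve 3 (λ T B E → T :* (B :* E) :+ con 6 :* (B :* T) := B :* (T :* E :+ con 6 :* T)) refl (t y) B (3 * E + 2) ⟩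
        B * (t y * (3 * E + 2) + 6 * t y) ≤⟨ *-monoʳ-≤ B (arith (t y) 3≤T 2T≤E) ⟩
        B * (6 * (t y * t y + D)) ≡⟨ solve 2 (λ B Z → B :* (con 6 :* Z) := con 6 :* (B :* Z)) refl B (t y * t y + D) ⟩
        6 * (B * (t y * t y + D)) ≤⟨ *-monoʳ-≤ 6 (max-shares R R-adj y Ry h (≤-trans (n≤1+n 2) 3≤T) (≤-trans (m≤m+n (t y) _) 2T≤E) y-top) ⟩
        6 * (t y * received + B * t y) ≡⟨ solve 3 (λ T W B → con 6 :* (T :* W :+ B :* T) := T :* (con 6 :* W) :+ con 6 :* (B :* T)) refl (t y) received B ⟩
        t y * (6 * received) + 6 * (B * t y) ∎))
      -- Here `T` itself is at least E/2 + 1/2.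
      cases (R , Ry , R-adj , h) (no 2T≰E) = begin
        B * (3 * E + 2) ≤⟨ *-monoʳ-≤ B (≤-trans (+-monoʳ-≤ (3 * E) (n≤1+n 2)) (≤-trans (≤-reflexive (solve 1 (λ E → con 3 :* E :+ con 3 := con 3 :* (con 1 :+ E)) refl E)) (*-monoʳ-≤ 3 (≰⇒> 2T≰E)))) ⟩
        B * (3 * (2 * t y)) ≡⟨ solve 2 (λ B T → B :* (con 3 :* (con 2 :* T)) := con 6 :* (B :* T)) refl B (t y) ⟩
        6 * (B * t y) ≤⟨ *-monoʳ-≤ 6 (many-shares R R-adj y Ry h) ⟩
        6 * received ∎

    small-top : ¬ 3 ≤ t y → ∀ v → Nb v → t v ≤ 2
    small-top ¬3 v a = ≤-trans (y-top v a) (≤-pred (≰⇒> ¬3))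

    share-total : B * E ≤ 2 * received
    share-total = cases (3 ≤? t y) (spread xy)
      where
      open ≤-Reasoning
      open +-*-Solver
      cases : Dec (3 ≤ t y) → Spread y 2 → B * E ≤ 2 * received
      cases (yes 3≤T) _ = *-cancelˡ-≤ 3 (begin
        3 * (B * E) ≡⟨ solve 2 (λ B E → con 3 :* (B :* E) := B :* (con 3 :* E)) refl B E ⟩
        B * (3 * E) ≤⟨ *-monoʳ-≤ B (m≤m+n (3 * E) 2) ⟩
        B * (3 * E + 2) ≤⟨ slack 3≤T ⟩
        6 * received ≡⟨ *-assoc 3 2 received ⟩
        3 * (2 * received) ∎)
      cases (no ¬3) (R , Ry , R-adj , h) = ≤-trans (*-monoʳ-≤ B (subst (E ≤_) (+-comm 2 D) E≤)) (few-shares R R-adj 2 h (small-top ¬3) y)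

    -- If all `t` are at most 2, the constant 3 gives (D+3)/2, hence at least E/2 + 1/2. Otherwise
    -- the maximal `t` already provides the extra third.
    share-total-mid : ∀ {y} → Spread y 3 → B * (3 * E + 2) ≤ 6 * received
    share-total-mid {y'} (R , Ry , R-adj , h) = cases (3 ≤? t y)
      where
      open ≤-Reasoning
      open +-*-Solver
      cases : Dec (3 ≤ t y) → B * (3 * E + 2) ≤ 6 * received
      cases (yes 3≤T) = slack 3≤T
      cases (no ¬3) = begin
        B * (3 * E + 2) ≤⟨ *-monoʳ-≤ B (≤-trans (+-monoʳ-≤ (3 * E) (n≤1+n 2)) (≤-reflexive (solve 1 (λ E → con 3 :* E :+ con 3 := con 3 :* (E :+ con 1)) refl E))) ⟩
        B * (3 * (E + 1)) ≡⟨ solve 2 (λ B E → B :* (con 3 :* E) := con 3 :* (B :* E)) refl B (E + 1) ⟩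
        3 * (B * (E + 1)) ≤⟨ *-monoʳ-≤ 3 (*-monoʳ-≤ B (≤-trans (+-monoˡ-≤ 1 E≤) (≤-reflexive (solve 1 (λ D → con 2 :+ D :+ con 1 := D :+ con 3) refl D)))) ⟩
        3 * (B * (D + 3)) ≤⟨ *-monoʳ-≤ 3 (few-shares R R-adj 3 h (small-top ¬3) y') ⟩
        3 * (2 * received) ≡⟨ *-assoc 3 2 received ⟨
        6 * received ∎

-- Low vertices of arbitrary degree

∣_∣ₛ : ∀ {n} → (Fin n → Bool) → ℕ
∣ A ∣ₛ = count (in? A)

set : ∀ {n} {P : Fin n → Set} → (∀ i → Dec (P i)) → Fin n → Bool
set P? i = does (P? i)

set-sound : ∀ {n} {P : Fin n → Set} (P? : ∀ i → Dec (P i)) {i} → set P? i ≡ true → P i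
set-sound P? {i} e = does-sound (P? i) e

set-count : ∀ {n} {P : Fin n → Set} (P? : ∀ i → Dec (P i)) → count P? ≤ ∣ set P? ∣ₛ
set-count P? = count-mono P? (in? (set P?)) (λ i → dec-true (P? i))

subset-of-size : ∀ {n} {P : Fin n → Set} (P? : ∀ i → Dec (P i)) m → m ≤ count P? →
  ∃ λ (A : Fin n → Bool) → (∀ i → A i ≡ true → P i) × ∣ A ∣ₛ ≡ m
subset-of-size {n} P? zero h = (λ _ → false) , (λ _ ()) , count-none (in? {n} (λ _ → false)) (λ _ ())
subset-of-size {suc n} {P} P? (suc m) h with P? zero
... | no ¬p with subset-of-size (λ i → P? (suc i)) (suc m) h
...   | A , A⊆ , size = A' , A'⊆ , size
  where
  A' : Fin (suc n) → Bool
  A' zero = false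
  A' (suc i) = A i
  A'⊆ : ∀ i → A' i ≡ true → P i
  A'⊆ (suc i) = A⊆ i
subset-of-size {suc n} {P} P? (suc m) (s≤s h) | yes p with subset-of-size (λ i → P? (suc i)) m h
...   | A , A⊆ , size = A' , A'⊆ , cong suc size
  where
  A' : Fin (suc n) → Bool
  A' zero = true
  A' (suc i) = A i
  A'⊆ : ∀ i → A' i ≡ true → P i
  A'⊆ zero _ = p
  A'⊆ (suc i) = A⊆ i

insert-size : ∀ {n} v (A : Fin n → Bool) → ∣ insert v A ∣ₛ ≤ 1 + ∣ A ∣ₛ
insert-size v A = ≤-trans (count-cover (λ w → w ≟ v) (in? A) (in? (insert v A)) (λ w → insert-inv v A))
  (+-monoˡ-≤ ∣ A ∣ₛ (count-unique (λ w → w ≟ v) (λ u w p q → trans p (sym q))))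

-- A low vertex misses at least the fraction 1/D of the colours. A few such vertices may have no
-- missing colour in common, so statements about single edges are replaced by bounds on how many
-- edges violate them.
module Crude {n k} {G : Graph n} (nocol : ¬ EdgeColouring G k) (deg≤ : ∀ v → deg G v ≤ k) (0<k : 1 ≤ k)
  {Low : Fin n → Set} (low? : ∀ v → Dec (Low v)) (D : ℕ) (0<D : 1 ≤ D)
  (low-deg : ∀ {v} → Low v → k ≤ D * (k ∸ deg G v)) (x : Fin n) (low-x : Low x) where

  low-missing : ∀ {φ : PartialColouring G k} {v} → Low v → k ≤ D * missing φ v
  low-missing {φ} {v} l = ≤-trans (low-deg l) (*-monoʳ-≤ D (m≤n+o⇒m∸n≤o k (deg G v) (subst (k ≤_) (+-comm (missing φ v) (deg G v)) (missing-deg φ v))))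

  -- By averaging some colour j outside F is missing at many of the low vertices W c;
  -- one swap on the chain of x makes it missing at x, at the cost of at most one of them.
  module _ {φ : PartialColouring G k} {y : Fin n} (R : Root φ x y) (F E : Fin k → Bool) (W : Fin k → Fin n) (q : ℕ)
    (F-small : 2 * D * ∣ F ∣ₛ ≤ k) (E-large : 2 * D * suc q ≤ ∣ E ∣ₛ)
    (W-low : ∀ c → E c ≡ true → Low (W c))
    (W-inj : ∀ c c' → E c ≡ true → E c' ≡ true → W c ≡ W c' → c ≡ c') where

    record Shared : Set where
      field
        φ'      : PartialColouring G k
        root    : Root φ' x y
        same    : ∀ a → F a ≡ true → ∀ v → mate φ' a v ≡ mate φ a v
        j       : Fin k
        fresh   : F j ≢ true
        centre  : Missing φ' x j
        E'      : Fin k → Bool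
        subset  : ∀ c → E' c ≡ true → E c ≡ true
        size    : q ≤ ∣ E' ∣ₛ
        shared  : ∀ c → E' c ≡ true → Missing φ' (W c) j

    private
      Hit : Fin k → Fin k → Set
      Hit j c = E c ≡ true × Missing φ (W c) j × F j ≢ true
      hit? : ∀ j c → Dec (Hit j c)
      hit? j c = in? E c ×-dec (missing? φ (W c) j ×-dec ¬? (in? F j))

      -- The protected colours `F` make up at most half of what `W c` is known to miss.
      column : ∀ c → E c ≡ true → k ≤ 2 * D * count (λ j → hit? j c)
      column c e = +-cancelʳ-≤ k _ _ (begin
        k + k ≤⟨ +-mono-≤ (low-missing {φ} (W-low c e)) (low-missing {φ} (W-low c e)) ⟩
        D * missing φ (W c) + D * missing φ (W c) ≡⟨ solve 2 (λ D M → D :* M :+ D :* M := con 2 :* D :* M) refl D (missing φ (W c)) ⟩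
        2 * D * missing φ (W c) ≤⟨ *-monoʳ-≤ (2 * D) (count-cover (λ j → hit? j c) (in? F) (missing? φ (W c)) split) ⟩
        2 * D * (count (λ j → hit? j c) + ∣ F ∣ₛ) ≡⟨ *-distribˡ-+ (2 * D) (count (λ j → hit? j c)) ∣ F ∣ₛ ⟩
        2 * D * count (λ j → hit? j c) + 2 * D * ∣ F ∣ₛ ≤⟨ +-monoʳ-≤ (2 * D * count (λ j → hit? j c)) F-small ⟩
        2 * D * count (λ j → hit? j c) + k ∎)
        where
        open ≤-Reasoning
        open +-*-Solver
        split : ∀ j → Missing φ (W c) j → Hit j c ⊎ F j ≡ true
        split j m with in? F j
        ... | yes p = inj₂ p
        ... | no ¬p = inj₁ (e , m , ¬p)

      average : k * q < sum (λ j → count (hit? j))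
      average = *-cancelˡ-< (2 * D) _ _ (begin-strict
        2 * D * (k * q) ≡⟨ solve 3 (λ D k q → con 2 :* D :* (k :* q) := k :* (con 2 :* D :* q)) refl D k q ⟩
        k * (2 * D * q) <⟨ *-monoʳ-< k ⦃ >-nonZero 0<k ⦄ (*-monoʳ-< (2 * D) ⦃ >-nonZero (≤-trans 0<D (m≤m+n D _)) ⦄ (n<1+n q)) ⟩
        k * (2 * D * suc q) ≤⟨ *-monoʳ-≤ k E-large ⟩
        k * ∣ E ∣ₛ ≡⟨ sum-* k (λ c → 𝟙 (in? E c)) ⟨
        sum (λ c → k * 𝟙 (in? E c)) ≤⟨ sum-mono (λ c → pt c (in? E c)) ⟩
        sum (λ c → 2 * D * count (λ j → hit? j c)) ≡⟨ sum-* (2 * D) (λ c → count (λ j → hit? j c)) ⟩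
        2 * D * sum (λ c → count (λ j → hit? j c)) ≡⟨ cong (2 * D *_) (sum-swap (λ c j → 𝟙 (hit? j c))) ⟩
        2 * D * sum (λ j → count (hit? j)) ∎)
        where
        open ≤-Reasoning
        open +-*-Solver
        pt : ∀ c (d : Dec (E c ≡ true)) → k * 𝟙 d ≤ 2 * D * count (λ j → hit? j c)
        pt c (yes e) = ≤-trans (≤-reflexive (*-identityʳ k)) (column c e)
        pt c (no _) = ≤-trans (≤-reflexive (*-zeroʳ k)) z≤n

      spare : ∃ λ h → Missing φ x h × F h ≢ true
      spare = count-∃ spare? (+-cancelʳ-≤ ∣ F ∣ₛ _ _ (≤-trans few (count-cover spare? (in? F) (missing? φ x) split)))
        where
        spare? : ∀ h → Dec (Missing φ x h × F h ≢ true)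
        spare? h = missing? φ x h ×-dec ¬? (in? F h)
        split : ∀ h → Missing φ x h → (Missing φ x h × F h ≢ true) ⊎ F h ≡ true
        split h m with in? F h
        ... | yes p = inj₂ p
        ... | no ¬p = inj₁ (m , ¬p)
        few : 1 + ∣ F ∣ₛ ≤ missing φ x
        few = *-cancelˡ-< D _ _ (≰⇒> λ le → <⇒≱ 0<k (+-cancelʳ-≤ k k 0 (begin
          k + k ≤⟨ +-mono-≤ (low-missing {φ} low-x) (low-missing {φ} low-x) ⟩
          D * missing φ x + D * missing φ x ≤⟨ +-mono-≤ le le ⟩
          D * ∣ F ∣ₛ + D * ∣ F ∣ₛ ≡⟨ solve 2 (λ D F → D :* F :+ D :* F := con 2 :* D :* F) refl D ∣ F ∣ₛ ⟩
          2 * D * ∣ F ∣ₛ ≤⟨ F-small ⟩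
          0 + k ∎)))
          where
          open ≤-Reasoning
          open +-*-Solver

      module _ (j : Fin k) (many : q < count (hit? j)) where

        j-fresh : F j ≢ true
        j-fresh = proj₂ (proj₂ (proj₂ (count-∃ (hit? j) (≤-trans (s≤s z≤n) many))))

        share-present : Missing φ x j → Shared
        share-present jx = record
          { φ' = φ ; root = R ; same = λ _ _ _ → refl ; j = j ; fresh = j-fresh ; centre = jx
          ; E' = set (hit? j)
          ; subset = λ c e → proj₁ (set-sound (hit? j) e)
          ; size = ≤-trans (<⇒≤ many) (set-count (hit? j))
          ; shared = λ c e → proj₁ (proj₂ (set-sound (hit? j) e)) }

        module _ (¬jx : ¬ Missing φ x j) (h : Fin k) (hx : Missing φ x h) (h-fresh : F h ≢ true) where

          module S = ChainSwap φ j h x hx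

          keep? : ∀ c → Dec (Hit j c × W c ≢ S.end)
          keep? c = hit? j c ×-dec ¬? (W c ≟ S.end)

          lost? : ∀ c → Dec (Hit j c × W c ≡ S.end)
          lost? c = hit? j c ×-dec (W c ≟ S.end)

          -- A vertex missing `j` is unaffected off the chain, and on it can only be the far end, as
          -- `x` has `j`. The `W c` are distinct, so at most one is lost; this is why `E-large`
          -- speaks of `suc q`.
          lose-one : count (hit? j) ≤ 1 + count keep?
          lose-one = ≤-trans (count-cover lost? keep? (hit? j) split)
            (+-monoˡ-≤ (count keep?) (count-unique lost? (λ { c c' ((e , _) , p) ((e' , _) , p') → W-inj c c' e e' (trans p (sym p')) })))
            where
            split : ∀ c → Hit j c → (Hit j c × W c ≡ S.end) ⊎ (Hit j c × W c ≢ S.end)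
            split c p = Sum.map (p ,_) (p ,_) (toSum (W c ≟ S.end))

          kept : ∀ c → Hit j c × W c ≢ S.end → Missing S.Inner.swapped (W c) j
          kept c ((_ , m , _) , ne) = help (S.C (W c)) refl
            where
            help : ∀ b → S.C (W c) ≡ b → Missing S.Inner.swapped (W c) j
            help false e = trans (S.Inner.M-out e j) m
            help true e = within (S.ends (W c) e (inj₁ m))
              where
              within : W c ≡ x ⊎ W c ≡ S.end → Missing S.Inner.swapped (W c) j
              within (inj₁ p) = ⊥-elim (¬jx (subst (λ v → Missing φ v j) p m))
              within (inj₂ p) = ⊥-elim (ne p)

          share-swap : Shared
          share-swap = record
            { φ' = S.Inner.swapped ; root = S.Inner.swapped-Root R
            ; same = λ a Fa → S.Inner.M-other (λ p → j-fresh (subst (λ z → F z ≡ true) p Fa)) (λ p → h-fresh (subst (λ z → F z ≡ true) p Fa))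
            ; j = j ; fresh = j-fresh
            ; centre = trans (S.Inner.M-in-a S.start) hx
            ; E' = set keep?
            ; subset = λ c e → proj₁ (proj₁ (set-sound keep? e))
            ; size = ≤-trans (≤-pred (≤-trans many lose-one)) (set-count keep?)
            ; shared = λ c e → kept c (set-sound keep? e) }

    abstract
      share : Shared
      share = from (sum-pigeonhole (λ j → count (hit? j)) q average) spare
        where
        from : (∃ λ j → q < count (hit? j)) → (∃ λ h → Missing φ x h × F h ≢ true) → Shared
        from (j , many) (h , hx , h-fresh) = decide (missing? φ x j)
          where
          decide : Dec (Missing φ x j) → Shared
          decide (yes jx) = share-present j many jx
          decide (no ¬jx) = share-swap j many ¬jx h hx h-fresh

  member-≢ : ∀ (A : Fin k → Bool) {a b} → A a ≡ true → A b ≢ true → a ≢ b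
  member-≢ A p q refl = q p

  last-exchange : ∀ {φ : PartialColouring G k} {y m c g} → Root φ x y → Missing φ y m → ¬ Missing φ y c → Missing φ x c →
    Missing φ x g → Missing φ (mate φ c y) g → ⊥
  last-exchange R my ¬cy cx gx gu = conclude (exchange nocol R my ¬cy gx gu)
    where
    conclude = λ (φ' , R' , cy , _ , at-x) → no-common nocol R' (trans (at-x _) cx) cy

  -- From `4 * D` such colours `share` would leave one whose far end has a missing colour in common
  -- with `x`, and `last-exchange` would free it at `y`. The set `F` protects these colours and `m`.
  low-fan : (2 * D * (1 + 2 * D * 2) ≤ k) → ∀ {φ : PartialColouring G k} {y m} → Root φ x y → Missing φ y m →
    count (λ h → missing? φ x h ×-dec (¬? (missing? φ y h) ×-dec low? (mate φ h y))) < 2 * D * 2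
  low-fan big {φ} {y} {m} R my = ≰⇒> λ h → contradict (subset-of-size P? (2 * D * 2) h)
    where
    P? = λ h → missing? φ x h ×-dec (¬? (missing? φ y h) ×-dec low? (mate φ h y))
    contradict : (∃ λ (E : Fin k → Bool) → (∀ h → E h ≡ true → Missing φ x h × ¬ Missing φ y h × Low (mate φ h y)) × ∣ E ∣ₛ ≡ 2 * D * 2) → ⊥
    contradict (E , E⊆ , size) = conclude (share R F E (λ h → mate φ h y) 1
        (≤-trans (*-monoʳ-≤ (2 * D) (≤-trans (insert-size m E) (≤-reflexive (cong suc size)))) big)
        (≤-reflexive (sym size)) (λ h e → proj₂ (proj₂ (E⊆ h e)))
        (λ h h' e e' p → unique φ h h' y (proj₁ (proj₂ (E⊆ h e))) p))
      where
      F = insert m E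
      conclude : Shared R F E (λ h → mate φ h y) 1 _ _ _ _ → ⊥
      conclude s = pick (count-∃ (in? E') size′)
        where
        open Shared s renaming (size to size′)
        pick : ∃ (λ h → E' h ≡ true) → ⊥
        pick (h , e) = last-exchange root (trans (keep m (insert-new m E) y) my)
            (λ p → proj₁ (proj₂ (E⊆ h (subset h e))) (trans (sym (keep h Fh y)) p))
            (trans (keep h Fh x) (proj₁ (E⊆ h (subset h e))))
            centre (subst (λ v → Missing φ' v j) (sym (keep h Fh y)) (shared h e))
          where
          keep = same
          Fh : F h ≡ true
          Fh = insert-old m E (subset h e)

  -- After the exchange off the chain of `x` the edge `zw` has colour `j`, which `x` misses. Next
  -- `g` helps to free `c` at `y`, the root is shifted to `z`, and `j₂` helps to free `j` at `z`.
  -- The inequalities between colours keep these changes from disturbing each other.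
  off-chain : ∀ {φ : PartialColouring G k} {y m c h g j j₂} → Root φ x y → Missing φ y m →
    ¬ Missing φ x c → ¬ Missing φ y c → ¬ Missing φ (mate φ c x) h →
    m ≢ h → m ≢ j → c ≢ h → c ≢ j → g ≢ h → g ≢ j → j₂ ≢ h → j₂ ≢ j →
    j ≢ m → j ≢ g → j₂ ≢ c → j₂ ≢ m → j₂ ≢ g →
    Missing φ x g → Missing φ (mate φ c y) g → (jx : Missing φ x j) → Missing φ x j₂ →
    Missing φ (mate φ h (mate φ c x)) j₂ →
    KempeChain.C (kempeChain φ h j x jx) (mate φ h (mate φ c x)) ≡ false → ⊥
  off-chain {φ} {y} {m} {c} {h} {g} {j} {j₂} R my ¬cx ¬cy ¬hz m≢h m≢j c≢h c≢j g≢h g≢j j₂≢h j₂≢j j≢m j≢g j₂≢c j₂≢m j₂≢g gx gu jx j₂x j₂w off =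
    second (exchange nocol (S.Outer.swapped-Root R) (trans (keep m≢h m≢j y) my) (λ p → ¬cy (trans (sym (keep c≢h c≢j y)) p))
      (trans (at-x g) gx) (trans (keep g≢h g≢j _) (subst (λ v → Missing φ v g) (sym (keep c≢h c≢j y)) gu)))
    where
    module S = ChainSwap φ h j x jx
    ψ = S.Outer.swapped
    z = mate φ c x
    w = mate φ h z
    keep : ∀ {a} → a ≢ h → a ≢ j → ∀ v → mate ψ a v ≡ mate φ a v
    keep = S.Outer.M-other
    at-x : ∀ a → mate ψ a x ≡ mate φ a x
    at-x = S.Outer.M-out (cong not S.start)
    jz : mate ψ j z ≡ w
    jz = S.Outer.M-in-b (cong not (trans (sym (S.closed-a z)) off))
    second : (Σ (PartialColouring G k) λ φ₁ → Root φ₁ x y × Missing φ₁ y c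
        × (∀ d → d ≢ c → d ≢ m → d ≢ g → ∀ v → mate φ₁ d v ≡ mate ψ d v) × (∀ d → mate φ₁ d x ≡ mate ψ d x)) → ⊥
    second (φ₁ , R₁ , cy₁ , same₁ , at-x₁) = third (shift R₁ c (λ p → ¬cx (trans (sym cx₁) p)) cy₁)
      where
      cx₁ : mate φ₁ c x ≡ z
      cx₁ = trans (at-x₁ c) (at-x c)
      third : (Σ (PartialColouring G k) λ φ₂ → Root φ₂ x (mate φ₁ c x) × mate φ₂ c (mate φ₁ c x) ≡ mate φ₁ c x
        × (∀ d → d ≢ c → ∀ v → mate φ₂ d v ≡ mate φ₁ d v)) → ⊥
      third (φ₂ , R₂ , cz₂ , same₂) = last-exchange (subst (Root φ₂ x) cx₁ R₂) (subst (λ v → Missing φ₂ v c) cx₁ cz₂)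
          (λ p → ¬hz (trans (sym jz₂) p)) (at-x₂ (λ p → c≢j (sym p)) jx) (at-x₂ j₂≢c j₂x)
          (subst (λ v → Missing φ₂ v j₂) (sym jz₂) j₂w₂)
        where
        keep₂ : ∀ {a} → a ≢ c → a ≢ m → a ≢ g → ∀ v → mate φ₂ a v ≡ mate ψ a v
        keep₂ p q r v = trans (same₂ _ p v) (same₁ _ p q r v)
        at-x₂ : ∀ {a} → a ≢ c → Missing φ x a → Missing φ₂ x a
        at-x₂ {a} p e = trans (same₂ a p x) (trans (at-x₁ a) (trans (at-x a) e))
        jz₂ : mate φ₂ j z ≡ w
        jz₂ = trans (keep₂ (λ p → c≢j (sym p)) j≢m j≢g z) jz
        j₂w₂ : Missing φ₂ w j₂
        j₂w₂ = trans (keep₂ j₂≢c j₂≢m j₂≢g w) (trans (keep j₂≢h j₂≢j w) j₂w)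

  -- Sizes for three successive uses of `share`: from `P` colours `P₁` survive, then `P₂`, then two.
  P₂ P₁ P : ℕ
  P₂ = 2 * D * 3
  P₁ = 2 * D * suc P₂
  P = 2 * D * suc P₁

  -- Approximate form of the disjointness in a fan: a colour `h` that leads on to low vertices other
  -- than `x` is offered by fewer than `P` of the fan vertices in question, instead of by at most
  -- one.
  module Repeated (big : 2 * D * (4 + P) ≤ k) {φ : PartialColouring G k} {y m h} (R : Root φ x y) (my : Missing φ y m) (h≢m : h ≢ m) where

    Repeat : Fin k → Set
    Repeat c = (¬ Missing φ x c × ¬ Missing φ y c × Low (mate φ c y)) × (¬ Missing φ (mate φ c x) h × Low (mate φ h (mate φ c x)) × mate φ h (mate φ c x) ≢ x)

    repeat? : ∀ c → Dec (Repeat c)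
    repeat? c = (¬? (missing? φ x c) ×-dec (¬? (missing? φ y c) ×-dec low? (mate φ c y)))
      ×-dec (¬? (missing? φ (mate φ c x) h) ×-dec (low? (mate φ h (mate φ c x)) ×-dec ¬? (mate φ h (mate φ c x) ≟ x)))

    module _ (E : Fin k → Bool) (E⊆ : ∀ c → E c ≡ true → Repeat c) (size : ∣ E ∣ₛ ≡ P) where

      u w : Fin k → Fin n
      u c = mate φ c y
      w c = mate φ h (mate φ c x)

      u-inj : ∀ c c' → E c ≡ true → E c' ≡ true → u c ≡ u c' → c ≡ c'
      u-inj c c' e e' p = unique φ c c' y (proj₁ (proj₂ (proj₁ (E⊆ c e)))) p

      w-inj : ∀ c c' → E c ≡ true → E c' ≡ true → w c ≡ w c' → c ≡ c'
      w-inj c c' e e' p = unique φ c c' x (proj₁ (proj₁ (E⊆ c e))) (mate-injective φ p)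

      w-low : ∀ c → E c ≡ true → Low (w c)
      w-low c e = proj₁ (proj₂ (proj₂ (E⊆ c e)))

      F : Fin k → Bool
      F = insert h (insert m E)

      F-size : ∣ F ∣ₛ ≤ 2 + P
      F-size = ≤-trans (insert-size h (insert m E)) (s≤s (≤-trans (insert-size m E) (s≤s (≤-reflexive size))))

      Fm : F m ≡ true
      Fm = insert-old h (insert m E) (insert-new m E)

      Fh : F h ≡ true
      Fh = insert-new h (insert m E)

      FE : ∀ {c} → E c ≡ true → F c ≡ true
      FE e = insert-old h (insert m E) (insert-old m E e)

      stage₃ : ∀ {φ' g j j₂ c} → Root φ' x y → (∀ a → F a ≡ true → ∀ v → mate φ' a v ≡ mate φ a v) →
        F g ≢ true → insert g F j ≢ true → insert j (insert g F) j₂ ≢ true →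
        Missing φ' x g → (jx : Missing φ' x j) → Missing φ' x j₂ →
        E c ≡ true → Missing φ' (u c) g → Missing φ' (w c) j₂ →
        KempeChain.C (kempeChain φ' h j x jx) (w c) ≡ true
      stage₃ {φ'} {g} {j} {j₂} {c} R' same g-new j-new j₂-new gx jx j₂x Ec gu j₂w = decide (KempeChain.C (kempeChain φ' h j x jx) (w c)) refl
        where
        Fc : F c ≡ true
        Fc = FE Ec
        F₁ = insert g F
        F₂ = insert j F₁
        up₁ : ∀ {a} → F a ≡ true → F₁ a ≡ true
        up₁ = insert-old g F
        up₂ : ∀ {a} → F a ≡ true → F₂ a ≡ true
        up₂ e = insert-old j F₁ (up₁ e)
        cx : mate φ' c x ≡ mate φ c x
        cx = same c Fc x
        wc : mate φ' h (mate φ' c x) ≡ w c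
        wc = trans (cong (mate φ' h) cx) (same h Fh _)
        rep = E⊆ c Ec
        c≢h : c ≢ h
        c≢h p = proj₂ (proj₂ (proj₂ rep)) (trans (cong (λ a → mate φ a (mate φ c x)) (sym p)) (invol φ c x))
        decide : ∀ b → KempeChain.C (kempeChain φ' h j x jx) (w c) ≡ b → KempeChain.C (kempeChain φ' h j x jx) (w c) ≡ true
        decide true e = e
        decide false e = ⊥-elim (off-chain {φ'} {y} {m} {c} {h} {g} {j} {j₂} R' (trans (same m Fm y) my)
          (λ p → proj₁ (proj₁ rep) (trans (sym cx) p))
          (λ p → proj₁ (proj₂ (proj₁ rep)) (trans (sym (same c Fc y)) p))
          (λ p → proj₁ (proj₂ rep) (trans (sym wc) (trans p cx)))
          (λ p → h≢m (sym p)) (member-≢ F₁ (up₁ Fm) j-new) c≢h (member-≢ F₁ (up₁ Fc) j-new)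
          (λ p → g-new (subst (λ a → F a ≡ true) (sym p) Fh)) (member-≢ F₁ (insert-new g F) j-new)
          (λ p → j₂-new (subst (λ a → F₂ a ≡ true) (sym p) (up₂ Fh))) (λ p → j₂-new (subst (λ a → F₂ a ≡ true) (sym p) (insert-new j F₁)))
          (λ p → j-new (subst (λ a → F₁ a ≡ true) (sym p) (up₁ Fm))) (λ p → j-new (subst (λ a → F₁ a ≡ true) (sym p) (insert-new g F)))
          (λ p → j₂-new (subst (λ a → F₂ a ≡ true) (sym p) (up₂ Fc))) (λ p → j₂-new (subst (λ a → F₂ a ≡ true) (sym p) (up₂ Fm)))
          (λ p → j₂-new (subst (λ a → F₂ a ≡ true) (sym p) (insert-old j F₁ (insert-new g F))))
          gx (subst (λ v → Missing φ' v g) (sym (same c Fc y)) gu) jx j₂x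
          (subst (λ v → Missing φ' v j₂) (sym wc) j₂w) (trans (cong (KempeChain.C (kempeChain φ' h j x jx)) wc) e))

      grow : ∀ a (A : Fin k → Bool) s → ∣ A ∣ₛ ≤ s → ∣ insert a A ∣ₛ ≤ suc s
      grow a A s le = ≤-trans (insert-size a A) (s≤s le)

      fits : ∀ (A : Fin k → Bool) s → ∣ A ∣ₛ ≤ s → s ≤ 4 + P → 2 * D * ∣ A ∣ₛ ≤ k
      fits A s le le' = ≤-trans (*-monoʳ-≤ (2 * D) (≤-trans le le')) big

      -- The uses of `share` give `g`, common to `x` and the `u c`, and then `j` and `j₂`, both
      -- common to `x` and the `w c`. By `off-chain` the two surviving `w c` lie on the
      -- `(h, j)`-chain of `x`; they miss `j`, so both are its far end, although they are distinct.
      clash : ⊥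
      clash = step₁ (share R F E u P₁ (fits F _ F-size (+-monoˡ-≤ P (s≤s (s≤s z≤n)))) (≤-reflexive (sym size))
                (λ c e → proj₂ (proj₂ (proj₁ (E⊆ c e)))) u-inj)
        where
        step₁ : Shared R F E u P₁ _ _ _ _ → ⊥
        step₁ s₁ = step₂ (share S₁.root F₁ S₁.E' w P₂ (fits F₁ _ F₁-size (+-monoˡ-≤ P (s≤s (s≤s (s≤s z≤n))))) S₁.size
            (λ c e → w-low c (S₁.subset c e)) (λ c c' e e' → w-inj c c' (S₁.subset c e) (S₁.subset c' e')))
          where
          module S₁ = Shared s₁
          F₁ = insert S₁.j F
          F₁-size : ∣ F₁ ∣ₛ ≤ 3 + P
          F₁-size = grow S₁.j F _ F-size
          step₂ : Shared S₁.root F₁ S₁.E' w P₂ _ _ _ _ → ⊥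
          step₂ s₂ = step₃ (share S₂.root F₂ S₂.E' w 2 (fits F₂ _ (grow S₂.j F₁ _ F₁-size) ≤-refl) S₂.size
              (λ c e → w-low c (E₂ c e)) (λ c c' e e' → w-inj c c' (E₂ c e) (E₂ c' e')))
            where
            module S₂ = Shared s₂
            E₂ : ∀ c → S₂.E' c ≡ true → E c ≡ true
            E₂ c e = S₁.subset c (S₂.subset c e)
            F₂ = insert S₂.j F₁
            step₃ : Shared S₂.root F₂ S₂.E' w 2 _ _ _ _ → ⊥
            step₃ s₃ = two (count-∃ (in? S₃.E') (≤-trans (n≤1+n 1) S₃.size))
              where
              module S₃ = Shared s₃
              g j j₂ : Fin k
              g = S₁.j
              j = S₂.j
              j₂ = S₃.j
              φ₃ = S₃.φ'
              up₁ : ∀ {a} → F a ≡ true → F₁ a ≡ true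
              up₁ = insert-old g F
              up₂ : ∀ {a} → F₁ a ≡ true → F₂ a ≡ true
              up₂ = insert-old j F₁
              all-same : ∀ a → F a ≡ true → ∀ v → mate φ₃ a v ≡ mate φ a v
              all-same a e v = trans (S₃.same a (up₂ (up₁ e)) v) (trans (S₂.same a (up₁ e) v) (S₁.same a e v))
              g-same : ∀ v → mate φ₃ g v ≡ mate S₁.φ' g v
              g-same v = trans (S₃.same g (up₂ (insert-new g F)) v) (S₂.same g (insert-new g F) v)
              j-same : ∀ v → mate φ₃ j v ≡ mate S₂.φ' j v
              j-same = S₃.same j (insert-new j F₁)
              jx : Missing φ₃ x j
              jx = trans (j-same x) S₂.centre
              module K = KempeChain (kempeChain φ₃ h j x jx)
              at-end : ∀ c → S₃.E' c ≡ true → w c ≡ K.end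
              at-end c e = locate (K.ends (w c) on (inj₂ (trans (j-same (w c)) (S₂.shared c (S₃.subset c e)))))
                where
                Ec : E c ≡ true
                Ec = E₂ c (S₃.subset c e)
                on : K.C (w c) ≡ true
                on = stage₃ S₃.root all-same S₁.fresh S₂.fresh S₃.fresh (trans (g-same x) S₁.centre) jx S₃.centre Ec
                  (trans (g-same (u c)) (S₁.shared c (S₂.subset c (S₃.subset c e)))) (S₃.shared c e)
                locate : w c ≡ x ⊎ w c ≡ K.end → w c ≡ K.end
                locate (inj₁ p) = ⊥-elim (proj₂ (proj₂ (proj₂ (E⊆ c Ec))) p)
                locate (inj₂ p) = p
              two : ∃ (λ c → S₃.E' c ≡ true) → ⊥
              two (c , e) = distinct (count-avoid (in? S₃.E') S₃.size c)
                where
                distinct : ∃ (λ c' → S₃.E' c' ≡ true × c' ≢ c) → ⊥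
                distinct (c' , e' , ne) = ne (w-inj c' c (E₂ c' (S₃.subset c' e')) (E₂ c (S₃.subset c e))
                  (trans (at-end c' e') (sym (at-end c e))))

    repeated< : count repeat? < P
    repeated< = ≰⇒> λ le → contradict (subset-of-size repeat? P le)
      where
      contradict : (∃ λ (E : Fin k → Bool) → (∀ c → E c ≡ true → Repeat c) × ∣ E ∣ₛ ≡ P) → ⊥
      contradict (E , E⊆ , size) = clash E E⊆ size

  lowNbrs : Fin n → ℕ
  lowNbrs v = count (λ w → adj? G v w ×-dec low? w)

  goodNbrs : ℕ → ℕ
  goodNbrs σ = count (λ z → adj? G x z ×-dec (lowNbrs z ≤? σ))

  drop-x : ∀ v → lowNbrs v ≤ 1 + count (λ w → adj? G v w ×-dec (low? w ×-dec ¬? (w ≟ x)))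
  drop-x v = ≤-trans (count-cover (λ w → w ≟ x) (λ w → adj? G v w ×-dec (low? w ×-dec ¬? (w ≟ x))) (λ w → adj? G v w ×-dec low? w) split)
    (+-monoˡ-≤ _ (count-unique (λ w → w ≟ x) (λ u w p q → trans p (sym q))))
    where
    split : ∀ w → adj G v w ≡ true × Low w → w ≡ x ⊎ (adj G v w ≡ true × Low w × w ≢ x)
    split w (a , p) = Sum.map₂ (λ ne → a , p , ne) (toSum (w ≟ x))

  lowColour? : ∀ (φ : PartialColouring G k) v c → Dec (¬ Missing φ v c × Low (mate φ c v) × mate φ c v ≢ x)
  lowColour? φ v c = ¬? (missing? φ v c) ×-dec (low? (mate φ c v) ×-dec ¬? (mate φ c v ≟ x))

  low-colours : ∀ {φ : PartialColouring G k} {y} → Root φ x y → ∀ v → v ≢ x →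
    count (λ w → adj? G v w ×-dec (low? w ×-dec ¬? (w ≟ x)))
    ≤ count (lowColour? φ v)
  low-colours {φ} {y} R v v≢x = count-relation (λ w → adj? G v w ×-dec (low? w ×-dec ¬? (w ≟ x))) (lowColour? φ v) (λ w c → mate φ c v ≟ w) exists (λ w w' c _ _ e e' → trans (sym e) e')
    where
    exists : ∀ w → adj G v w ≡ true × Low w × w ≢ x →
      ∃ λ c → mate φ c v ≡ w × (¬ Missing φ v c × Low (mate φ c v) × mate φ c v ≢ x)
    exists w (a , l , ne) = find (covered R v w a)
      where
      find : Coloured φ v w ⊎ SamePair {k = k} {G = G} v w x y → ∃ λ c → mate φ c v ≡ w × (¬ Missing φ v c × Low (mate φ c v) × mate φ c v ≢ x)
      find (inj₁ (c , refl)) = c , refl , (λ e → adj⇒≢ G a (sym e)) , l , ne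
      find (inj₂ (inj₁ (e , _))) = ⊥-elim (v≢x e)
      find (inj₂ (inj₂ (_ , e))) = ⊥-elim (ne e)

  -- Each low neighbour of `y` other than `x` is reached by a colour. At most `P` of these colours
  -- are missing at `x`; the others lead to neighbours of `x`, good ones or `b` bad ones. A bad one
  -- offers at least `σ ∸ 1` colours `h`, and each of the `k` colours is offered at most `P` times.
  crude-spread : 2 * D * (4 + P) ≤ k → ∀ {φ : PartialColouring G k} {y} → Root φ x y → ∀ σ →
    ∃ λ b → lowNbrs y ≤ 1 + (P + (goodNbrs σ + b)) × b * (σ ∸ 1) ≤ k * P
  crude-spread big {φ} {y} R σ = with-root-colour (root-missing R (deg≤ y))
    where
    y≢x : y ≢ x
    y≢x e = adj⇒≢ G (adjacent R) (sym e)
    L? : ∀ c → Dec (¬ Missing φ y c × Low (mate φ c y))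
    L? c = ¬? (missing? φ y c) ×-dec low? (mate φ c y)
    A? = λ c → missing? φ x c ×-dec L? c
    z : Fin k → Fin n
    z c = mate φ c x
    B? = λ c → (¬? (missing? φ x c) ×-dec L? c) ×-dec (lowNbrs (z c) ≤? σ)
    C? = λ c → (¬? (missing? φ x c) ×-dec L? c) ×-dec ¬? (lowNbrs (z c) ≤? σ)
    2D*2≤P : 2 * D * 2 ≤ P
    2D*2≤P = *-monoʳ-≤ (2 * D) (s≤s (*-mono-≤ (≤-trans 0<D (m≤m+n D _)) (s≤s z≤n)))
    low≤ : lowNbrs y ≤ 1 + count L?
    low≤ = ≤-trans (drop-x y) (s≤s (≤-trans (low-colours R y y≢x) (count-mono (lowColour? φ y) L? (λ c (p , l , _) → p , l))))
    split : ∀ c → ¬ Missing φ y c × Low (mate φ c y) → _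
    split c p = Sum.map (λ q → q , p) (λ q → Sum.map (λ r → (q , p) , r) (λ r → (q , p) , r) (toSum (lowNbrs (z c) ≤? σ))) (toSum (missing? φ x c))
    BC? = λ c → B? c ⊎-dec C? c
    good : count B? ≤ goodNbrs σ
    good = count-relation B? (λ v → adj? G x v ×-dec (lowNbrs v ≤? σ)) (λ c v → z c ≟ v)
      (λ { c ((p , _) , s) → z c , refl , edge φ c x p , s })
      (λ { c c' v ((p , _) , _) _ e e' → unique φ c c' x p (trans e (sym e')) })
    with-root-colour : ∃ (Missing φ y) → ∃ λ b → lowNbrs y ≤ 1 + (P + (goodNbrs σ + b)) × b * (σ ∸ 1) ≤ k * P
    with-root-colour (m , my) = count C? , total , bad
      where
      total : lowNbrs y ≤ 1 + (P + (goodNbrs σ + count C?))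
      total = ≤-trans low≤ (s≤s (≤-trans (count-cover A? BC? L? split)
        (+-mono-≤ (≤-trans (<⇒≤ (low-fan (≤-trans (*-monoʳ-≤ (2 * D) (s≤s (≤-trans 2D*2≤P (m≤n+m P 3)))) big) R my)) 2D*2≤P)
          (≤-trans (count-cover B? C? BC? (λ _ p → p)) (+-monoˡ-≤ (count C?) good)))))
      V? : ∀ c h → Dec (h ≢ m × (¬ Missing φ (z c) h × Low (mate φ h (z c)) × mate φ h (z c) ≢ x))
      V? c h = ¬? (h ≟ m) ×-dec (¬? (missing? φ (z c) h) ×-dec (low? (mate φ h (z c)) ×-dec ¬? (mate φ h (z c) ≟ x)))
      -- Of more than `σ` low neighbours, one may be `x` and one may be reached by the colour `m`.
      row : ∀ c → (¬ Missing φ x c × (¬ Missing φ y c × Low (mate φ c y))) × ¬ (lowNbrs (z c) ≤ σ) → σ ∸ 1 ≤ count (V? c)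
      row c ((p , _) , s) = ≤-trans (∸-monoˡ-≤ 1 (≤-pred (≤-trans (≰⇒> s) (≤-trans (drop-x (z c))
          (s≤s (≤-trans (low-colours R (z c) p) (count-cover (λ h → h ≟ m) (V? c) (lowColour? φ (z c)) splitm)))))))
        (m≤n+o⇒m∸n≤o _ 1 (+-monoˡ-≤ (count (V? c)) (count-unique (λ h → h ≟ m) (λ u w p q → trans p (sym q)))))
        where
        splitm : ∀ h → ¬ Missing φ (z c) h × Low (mate φ h (z c)) × mate φ h (z c) ≢ x → _
        splitm h r = Sum.map₂ (λ ne → ne , r) (toSum (h ≟ m))
      CV? = λ c h → C? c ×-dec V? c h
      col : ∀ h → count (λ c → CV? c h) ≤ P
      col h = cases (h ≟ m)
        where
        cases : Dec (h ≡ m) → count (λ c → CV? c h) ≤ P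
        cases (yes e) = ≤-trans (≤-reflexive (count-none (λ c → CV? c h) (λ c p → proj₁ (proj₂ p) e))) z≤n
        cases (no h≢m) = ≤-trans (count-mono (λ c → CV? c h) Rep.repeat? (λ { c (((p , q) , _) , (_ , r)) → (p , q) , r })) (<⇒≤ Rep.repeated<)
          where
          module Rep = Repeated big {h = h} R my h≢m
      bad : count C? * (σ ∸ 1) ≤ k * P
      bad = begin
        count C? * (σ ∸ 1) ≡⟨ *-comm (count C?) (σ ∸ 1) ⟩
        (σ ∸ 1) * count C? ≡⟨ sum-* (σ ∸ 1) (λ c → 𝟙 (C? c)) ⟨
        sum (λ c → (σ ∸ 1) * 𝟙 (C? c)) ≤⟨ sum-mono (λ c → pt c (C? c)) ⟩
        sum (λ c → sum (λ h → 𝟙 (CV? c h))) ≡⟨ sum-swap (λ c h → 𝟙 (CV? c h)) ⟩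
        sum (λ h → count (λ c → CV? c h)) ≤⟨ sum-mono col ⟩
        sum {k} (λ _ → P) ≡⟨ sum-const k P ⟩
        k * P ∎
        where
        open ≤-Reasoning
        pt : ∀ c (d : Dec _) → (σ ∸ 1) * 𝟙 d ≤ sum (λ h → 𝟙 (d ×-dec V? c h))
        pt c (yes p) = ≤-trans (≤-reflexive (*-identityʳ (σ ∸ 1))) (≤-trans (row c p) (count-mono (V? c) (λ h → yes p ×-dec V? c h) (λ h v → p , v)))
        pt c (no _) = ≤-trans (≤-reflexive (*-zeroʳ (σ ∸ 1))) z≤n

-- Estimates with powers of `D`

module Powers (D k : ℕ) (5≤D : 5 ≤ D) (big : D ^ 25 ≤ k) where

  instance
    D-nonZero : NonZero D
    D-nonZero = >-nonZero (≤-trans (s≤s z≤n) 5≤D)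

  pow≤ : ∀ {a b} → a ≤ b → D ^ a ≤ D ^ b
  pow≤ = ^-monoʳ-≤ D

  pow≤k : ∀ {a} → a ≤ 25 → D ^ a ≤ k
  pow≤k h = ≤-trans (pow≤ h) big

  pow-pos : ∀ a → 1 ≤ D ^ a
  pow-pos a = m^n>0 D a

  k-pos : 1 ≤ k
  k-pos = ≤-trans (pow-pos 25) big

  2≤D : 2 ≤ D
  2≤D = ≤-trans (s≤s (s≤s z≤n)) 5≤D

  double-pow : ∀ a → 2 * D ^ a ≤ D ^ suc a
  double-pow a = *-monoˡ-≤ (D ^ a) 2≤D

  -- For `D = 5 + q` the difference is a polynomial in `q` with nonnegative coefficients; at `q = 0`
  -- only 15 is to spare.
  tower≤ : 2 * D * suc (2 * D * suc (2 * D * 3)) ≤ D ^ 5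
  tower≤ = subst (λ D → 2 * D * suc (2 * D * suc (2 * D * 3)) ≤ D ^ 5) (m+[n∸m]≡n 5≤D) (begin
    2 * (5 + q) * suc (2 * (5 + q) * suc (2 * (5 + q) * 3)) ≤⟨ m≤m+n _ (q ^ 5 + 25 * q ^ 4 + 226 * q ^ 3 + 886 * q ^ 2 + 1283 * q + 15) ⟩
    2 * (5 + q) * suc (2 * (5 + q) * suc (2 * (5 + q) * 3)) + (q ^ 5 + 25 * q ^ 4 + 226 * q ^ 3 + 886 * q ^ 2 + 1283 * q + 15) ≡⟨ expand q ⟩
    (5 + q) ^ 5 ∎)
    where
    open ≤-Reasoning
    open +-*-Solver
    q = D ∸ 5
    expand : ∀ q → 2 * (5 + q) * suc (2 * (5 + q) * suc (2 * (5 + q) * 3)) + (q ^ 5 + 25 * q ^ 4 + 226 * q ^ 3 + 886 * q ^ 2 + 1283 * q + 15) ≡ (5 + q) ^ 5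
    expand = solve 1 (λ q → con 2 :* (con 5 :+ q) :* (con 1 :+ con 2 :* (con 5 :+ q) :* (con 1 :+ con 2 :* (con 5 :+ q) :* con 3))
      :+ (q :^ 5 :+ con 25 :* q :^ 4 :+ con 226 :* q :^ 3 :+ con 886 :* q :^ 2 :+ con 1283 :* q :+ con 15) := (con 5 :+ q) :^ 5) refl

  forbidden-fits : ∀ P → P ≤ D ^ 5 → 2 * D * (4 + P) ≤ k
  forbidden-fits P h = begin
    2 * D * (4 + P) ≤⟨ *-monoʳ-≤ (2 * D) (+-mono-≤ (≤-trans (≤-trans (n≤1+n 4) 5≤D) (≤-trans (≤-reflexive (sym (^-identityʳ D))) (pow≤ {1} {5} (s≤s z≤n)))) h) ⟩
    2 * D * (D ^ 5 + D ^ 5) ≡⟨ cong (2 * D *_) (cong (D ^ 5 +_) (sym (+-identityʳ (D ^ 5)))) ⟩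
    2 * D * (2 * D ^ 5) ≤⟨ *-monoʳ-≤ (2 * D) (double-pow 5) ⟩
    2 * D * D ^ 6 ≡⟨ *-assoc 2 D (D ^ 6) ⟩
    2 * D ^ 7 ≤⟨ double-pow 7 ⟩
    D ^ 8 ≤⟨ pow≤k (m≤m+n 8 17) ⟩
    k ∎
    where open ≤-Reasoning

  instance
    X-nonZero : NonZero (D ^ 10)
    X-nonZero = m^n≢0 D 10

  σ : ℕ
  σ = k / D ^ 10

  -- Rounding down and subtracting 1 cost at most a factor of two, because `k` is at least
  -- `4 * D ^ 10`.
  threshold : k ≤ 2 * D ^ 10 * (σ ∸ 1)
  threshold = help (D ^ 10) k σ (begin-strict
      k ≡⟨ m≡m%n+[m/n]*n k (D ^ 10) ⟩
      k % D ^ 10 + σ * D ^ 10 <⟨ +-monoˡ-< (σ * D ^ 10) (m%n<n k (D ^ 10)) ⟩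
      D ^ 10 + σ * D ^ 10 ∎)
    (≤-trans (≤-reflexive (*-assoc 2 2 (D ^ 10))) (≤-trans (*-monoʳ-≤ 2 (double-pow 10)) (≤-trans (double-pow 11) (pow≤k (m≤m+n 12 13)))))
    where
    open ≤-Reasoning
    help : ∀ X k s → k < X + s * X → 4 * X ≤ k → k ≤ 2 * X * (s ∸ 1)
    help X k s lt 4X≤k = ≤-trans (m+n≤o⇒m≤o∸n k (+-cancelʳ-≤ (2 * X + k) _ _ (begin
        k + 2 * X + (2 * X + k) ≡⟨ solve 2 (λ k X → k :+ con 2 :* X :+ (con 2 :* X :+ k) := con 2 :* k :+ con 4 :* X) refl k X ⟩
        2 * k + 4 * X ≤⟨ +-mono-≤ (*-monoʳ-≤ 2 (<⇒≤ lt)) 4X≤k ⟩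
        2 * (X + s * X) + k ≡⟨ solve 3 (λ k X s → con 2 :* (X :+ s :* X) :+ k := con 2 :* X :* s :+ (con 2 :* X :+ k)) refl k X s ⟩
        2 * X * s + (2 * X + k) ∎)))
      (≤-reflexive (trans (cong (2 * X * s ∸_) (sym (*-identityʳ (2 * X)))) (sym (*-distribˡ-∸ (2 * X) s 1))))
      where open +-*-Solver

  -- `b` is at most `2 * D ^ 15`, so `(1 + P + b) * D ^ 7` is at most `D ^ 24`, hence at most `k`.
  -- But `s * D ^ 7` is at least `2 * k`, and the good neighbours must supply the rest.
  many-good : ∀ {P s g b} → P ≤ D ^ 5 → s ≤ 1 + (P + (g + b)) → b * (σ ∸ 1) ≤ k * P → ¬ s * D ^ 6 ≤ k → k ≤ g * D ^ 7
  many-good {P} {s} {g} {b} hP hs hb s-big = ≮⇒≥ (λ lt → <-irrefl refl (begin-strict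
    2 * k ≤⟨ *-monoˡ-≤ k 2≤D ⟩
    D * k ≤⟨ *-monoʳ-≤ D (<⇒≤ (≰⇒> s-big)) ⟩
    D * (s * D ^ 6) ≡⟨ solve 3 (λ D s X → D :* (s :* X) := s :* (D :* X)) refl D s (D ^ 6) ⟩
    s * D ^ 7 ≤⟨ *-monoˡ-≤ (D ^ 7) hs ⟩
    (1 + (P + (g + b))) * D ^ 7 ≡⟨ solve 4 (λ P g b X → (con 1 :+ (P :+ (g :+ b))) :* X := (con 1 :+ P :+ b) :* X :+ g :* X) refl P g b (D ^ 7) ⟩
    (1 + P + b) * D ^ 7 + g * D ^ 7 <⟨ +-mono-≤-< small lt ⟩
    k + k ≡⟨ cong (k +_) (sym (+-identityʳ k)) ⟩
    2 * k ∎))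
    where
    open ≤-Reasoning
    open +-*-Solver
    b≤ : b ≤ 2 * D ^ 15
    b≤ = *-cancelˡ-≤ k ⦃ >-nonZero k-pos ⦄ (begin
      k * b ≡⟨ *-comm k b ⟩
      b * k ≤⟨ *-monoʳ-≤ b threshold ⟩
      b * (2 * D ^ 10 * (σ ∸ 1)) ≡⟨ solve 3 (λ b X s → b :* (X :* s) := X :* (b :* s)) refl b (2 * D ^ 10) (σ ∸ 1) ⟩
      2 * D ^ 10 * (b * (σ ∸ 1)) ≤⟨ *-monoʳ-≤ (2 * D ^ 10) (≤-trans hb (*-monoʳ-≤ k hP)) ⟩
      2 * D ^ 10 * (k * D ^ 5) ≡⟨ solve 3 (λ X k Y → con 2 :* X :* (k :* Y) := k :* (con 2 :* (X :* Y))) refl (D ^ 10) k (D ^ 5) ⟩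
      k * (2 * (D ^ 10 * D ^ 5)) ≡⟨ cong (λ z → k * (2 * z)) (sym (^-distribˡ-+-* D 10 5)) ⟩
      k * (2 * D ^ 15) ∎)
    small : (1 + P + b) * D ^ 7 ≤ k
    small = begin
      (1 + P + b) * D ^ 7 ≤⟨ *-monoˡ-≤ (D ^ 7) (+-mono-≤ (+-mono-≤ (pow-pos 15) (≤-trans hP (pow≤ (m≤m+n 5 10)))) b≤) ⟩
      (D ^ 15 + D ^ 15 + 2 * D ^ 15) * D ^ 7 ≡⟨ cong (_* D ^ 7) (solve 1 (λ X → X :+ X :+ con 2 :* X := con 2 :* (con 2 :* X)) refl (D ^ 15)) ⟩
      2 * (2 * D ^ 15) * D ^ 7 ≤⟨ *-monoˡ-≤ (D ^ 7) (≤-trans (*-monoʳ-≤ 2 (double-pow 15)) (double-pow 16)) ⟩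
      D ^ 17 * D ^ 7 ≡⟨ ^-distribˡ-+-* D 17 7 ⟨
      D ^ 24 ≤⟨ pow≤k (m≤m+n 24 1) ⟩
      k ∎

  module _ {E : ℕ} (E≤D : E ≤ D) where

    3E+2≤ : 3 * E + 2 ≤ D ^ 2
    3E+2≤ = begin
      3 * E + 2 ≤⟨ +-mono-≤ (*-monoʳ-≤ 3 E≤D) 2≤D ⟩
      3 * D + D ≡⟨ solve 1 (λ D → con 3 :* D :+ D := con 4 :* D) refl D ⟩
      4 * D ≤⟨ *-mono-≤ (≤-trans (n≤1+n 4) 5≤D) (≤-reflexive (sym (*-identityʳ D))) ⟩
      D ^ 2 ∎
      where
      open ≤-Reasoning
      open +-*-Solver

    4[E+2]≤ : 4 * (E + 2) ≤ D ^ 3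
    4[E+2]≤ = begin
      4 * (E + 2) ≤⟨ *-mono-≤ (≤-trans (n≤1+n 4) 5≤D) (+-mono-≤ E≤D 2≤D) ⟩
      D * (D + D) ≡⟨ cong (λ z → D * (D + z)) (sym (+-identityʳ D)) ⟩
      D * (2 * D) ≤⟨ *-monoʳ-≤ D (*-monoˡ-≤ D 2≤D) ⟩
      D * (D * D) ≡⟨ cong (λ z → D * (D * z)) (sym (*-identityʳ D)) ⟩
      D ^ 3 ∎
      where open ≤-Reasoning

-- Discharging

subset-count : ∀ {n} (S : Subset n) → ∣ S ∣ ≡ count (λ x → x ∈ₛ? S)
subset-count [] = refl
subset-count (inside ∷ S) = cong suc (trans (subset-count S)
  (count-cong (λ x → x ∈ₛ? S) (λ x → suc x ∈ₛ? (inside ∷ S)) (λ _ → there) (λ _ → drop-there)))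
subset-count (outside ∷ S) = trans (subset-count S)
  (count-cong (λ x → x ∈ₛ? S) (λ x → suc x ∈ₛ? (outside ∷ S)) (λ _ → there) (λ _ → drop-there))

-- `w y x` is what `y` sends to `x`. By independence a vertex of `S` is paid only by the `n ∸ ∣ S ∣`
-- vertices outside.
discharge : ∀ {n} (G : Graph n) (S : Subset n) → Independent G S → (w : Fin n → Fin n → ℕ) (I O : ℕ) →
  (∀ x → I ≤ sum (λ y → 𝟙 (adj? G x y) * w y x)) →
  (∀ y → sum (λ x → 𝟙 (adj? G y x) * w y x) ≤ O) →
  ∣ S ∣ * I ≤ (n ∸ ∣ S ∣) * O
discharge {n} G S indep w I O incoming outgoing = begin
  ∣ S ∣ * I ≡⟨ trans (*-comm ∣ S ∣ I) (cong (I *_) (subset-count S)) ⟩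
  I * count (λ x → x ∈ₛ? S) ≡⟨ sum-* I (λ x → 𝟙 (x ∈ₛ? S)) ⟨
  sum (λ x → I * 𝟙 (x ∈ₛ? S)) ≤⟨ sum-mono (λ x → into x (x ∈ₛ? S)) ⟩
  sum (λ x → sum (λ y → 𝟙 (x ∈ₛ? S) * (𝟙 (adj? G x y) * w y x))) ≡⟨ sum-swap (λ x y → 𝟙 (x ∈ₛ? S) * (𝟙 (adj? G x y) * w y x)) ⟩
  sum (λ y → sum (λ x → 𝟙 (x ∈ₛ? S) * (𝟙 (adj? G x y) * w y x))) ≤⟨ sum-mono (λ y → out y (y ∈ₛ? S)) ⟩
  sum (λ y → O * 𝟙 (¬? (y ∈ₛ? S))) ≡⟨ sum-* O (λ y → 𝟙 (¬? (y ∈ₛ? S))) ⟩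
  O * count (λ y → ¬? (y ∈ₛ? S)) ≡⟨ cong (O *_) outside-count ⟩
  O * (n ∸ ∣ S ∣) ≡⟨ *-comm O _ ⟩
  (n ∸ ∣ S ∣) * O ∎
  where
  open ≤-Reasoning
  outside-count : count (λ y → ¬? (y ∈ₛ? S)) ≡ n ∸ ∣ S ∣
  outside-count = sym (trans (cong₂ _∸_ (sym (count-¬ (λ y → y ∈ₛ? S))) (subset-count S)) (m+n∸m≡n (count (λ y → y ∈ₛ? S)) _))
  into : ∀ x (d : Dec (x ∈ₛ S)) → I * 𝟙 d ≤ sum (λ y → 𝟙 d * (𝟙 (adj? G x y) * w y x))
  into x (yes _) = ≤-trans (≤-reflexive (*-identityʳ I)) (≤-trans (incoming x) (sum-mono (λ y → ≤-reflexive (sym (*-identityˡ (𝟙 (adj? G x y) * w y x))))))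
  into x (no _) = ≤-trans (≤-reflexive (*-zeroʳ I)) z≤n
  out : ∀ y (d : Dec (y ∈ₛ S)) → sum (λ x → 𝟙 (x ∈ₛ? S) * (𝟙 (adj? G x y) * w y x)) ≤ O * 𝟙 (¬? d)
  out y (yes y∈S) = ≤-trans (sum-mono (λ x → none x (x ∈ₛ? S) (adj? G x y)))
      (≤-reflexive (trans (sum-const n 0) (trans (*-zeroʳ n) (sym (*-zeroʳ O)))))
    where
    none : ∀ x (d : Dec (x ∈ₛ S)) (e : Dec (adj G x y ≡ true)) → 𝟙 d * (𝟙 e * w y x) ≤ 0
    none x (no _) e = z≤n
    none x (yes _) (no _) = z≤n
    none x (yes x∈S) (yes a) with trans (sym a) (indep x y x∈S y∈S)
    ... | ()
  out y (no _) = ≤-trans (sum-mono (λ x → flip x (x ∈ₛ? S))) (≤-trans (outgoing y) (≤-reflexive (sym (*-identityʳ O))))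
    where
    flip : ∀ x (d : Dec (x ∈ₛ S)) → 𝟙 d * (𝟙 (adj? G x y) * w y x) ≤ 𝟙 (adj? G y x) * w y x
    flip x (no _) = z≤n
    flip x (yes _) = ≤-trans (≤-reflexive (*-identityˡ _)) (*-monoˡ-≤ (w y x) (𝟙-mono (adj? G x y) (adj? G y x) (trans (adj-sym G y x))))

divide : ℕ → ℕ → ℕ
divide m zero = 0
divide m (suc t) = m / suc t

-- Divisibility makes `m / T` exact, and `m / t` is no smaller.
divide-lower : ∀ m t T → T ∣ m → 1 ≤ t → t ≤ T → m ≤ T * divide m t
divide-lower m (suc t) (suc T) T∣m _ t≤T = ≤-trans (≤-reflexive (sym (m*[n/m]≡n T∣m))) (*-monoʳ-≤ (suc T) (/-monoʳ-≤ m t≤T))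

divide-upper : ∀ m t → t * divide m t ≤ m
divide-upper m zero = z≤n
divide-upper m (suc t) = ≤-trans (≤-reflexive (*-comm (suc t) _)) (m/n*n≤m m (suc t))

divide-mono : ∀ {m m'} t → m ≤ m' → divide m t ≤ divide m' t
divide-mono zero _ = z≤n
divide-mono (suc t) h = /-monoˡ-≤ (suc t) h

module Discharging {n k} {G : Graph n} (nocol : ¬ EdgeColouring G k) (deg≤ : ∀ v → deg G v ≤ k)
  (rooted : ∀ x y → adj G x y ≡ true → ∃ λ (φ : PartialColouring G k) → Root φ x y)
  (D E : ℕ) (5≤D : 5 ≤ D) (2≤E : 2 ≤ E) (E≤D : E ≤ D) (big : D ^ 25 ≤ k)
  (nonempty : ∀ x → ∃ λ y → adj G x y ≡ true)
  (E≤deg : ∀ x → E ≤ 2 + deg G x)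
  (arith : ∀ x T → 3 ≤ T → 2 * T ≤ E → T * (3 * E + 2) + 6 * T ≤ 6 * (T * T + deg G x))
  (L : ℕ) (L-div : ∀ T → 1 ≤ T → T ≤ E → T ∣ L) where

  open Powers D k 5≤D big

  -- The degrees of two tiny vertices and a low one add up to less than k.
  Tiny Low Mid : Fin n → Set
  Tiny v = 4 * (E + 2) * deg G v < k
  Low v = deg G v * (E + 2) < k * E
  Mid v = Low v × ¬ Tiny v

  tiny? : ∀ v → Dec (Tiny v)
  tiny? v = 4 * (E + 2) * deg G v <? k

  low? : ∀ v → Dec (Low v)
  low? v = deg G v * (E + 2) <? k * E

  mid? : ∀ v → Dec (Mid v)
  mid? v = low? v ×-dec ¬? (tiny? v)

  t m s f : Fin n → ℕ
  t y = count (λ w → adj? G y w ×-dec tiny? w)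
  m y = count (λ w → adj? G y w ×-dec mid? w)
  s y = count (λ w → adj? G y w ×-dec low? w)
  f y = maxNbrs G k y

  -- A whole share is `B`, and `B₁` is what remains beside the reserve. The coefficients are chosen
  -- so that `B₁ * (3 * E + 2) = 3 * (B * E)`: a sum of E/2 + 1/3 in units of `B₁` is worth E/2 in
  -- units of `B`. The factor `L` makes both divisible by every number up to `E`, and `b` is
  -- `B / k`.
  β B B₁ b : ℕ
  β = L * k
  B = (3 * E + 2) * β
  B₁ = 3 * E * β
  b = (3 * E + 2) * L

  -- If y has neighbours that are low but not tiny, the part 2β of B = B₁ + 2β is reserved for them.
  tinyShare midShare : Fin n → ℕ
  tinyShare y = if does (m y ℕ.≟ 0) then divide B (t y) else divide B₁ (t y)
  midShare y = if does (s y * D ^ 10 ≤? k) then D ^ 8 * b else (if does (s y * D ^ 6 ≤? k) then D ^ 4 * b else 0)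

  share′ : Fin n → Fin n → ℕ
  share′ y x = 𝟙 (tiny? x) * tinyShare y + 𝟙 (mid? x) * midShare y

  B₁+2β : B₁ + 2 * β ≡ B
  B₁+2β = sym (*-distribʳ-+ β (3 * E) 2)

  B₁≤B : B₁ ≤ B
  B₁≤B = ≤-trans (m≤m+n B₁ (2 * β)) (≤-reflexive B₁+2β)

  m≤s : ∀ y → m y ≤ s y
  m≤s y = count-mono (λ w → adj? G y w ×-dec mid? w) (λ w → adj? G y w ×-dec low? w) (λ { w (a , l , _) → a , l })

  -- Fewer low neighbours allow larger pieces. The two powers of `D` between piece and threshold
  -- absorb the factor `3 * E + 2` of `b`.
  pool : ∀ y a c → s y * D ^ c ≤ k → 2 + a ≡ c → m y * (D ^ a * b) ≤ β
  pool y a c h refl = begin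
    m y * (D ^ a * b) ≤⟨ *-monoˡ-≤ (D ^ a * b) (m≤s y) ⟩
    s y * (D ^ a * ((3 * E + 2) * L)) ≤⟨ *-monoʳ-≤ (s y) (*-monoʳ-≤ (D ^ a) (*-monoˡ-≤ L (3E+2≤ E≤D))) ⟩
    s y * (D ^ a * (D ^ 2 * L)) ≡⟨ solve 4 (λ s X Y L → s :* (X :* (Y :* L)) := L :* (s :* (Y :* X))) refl (s y) (D ^ a) (D ^ 2) L ⟩
    L * (s y * (D ^ 2 * D ^ a)) ≡⟨ cong (λ z → L * (s y * z)) (sym (^-distribˡ-+-* D 2 a)) ⟩
    L * (s y * D ^ (2 + a)) ≤⟨ *-monoʳ-≤ L h ⟩
    L * k ∎
    where
    open ≤-Reasoning
    open +-*-Solver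

  mid-out : ∀ y → m y * midShare y ≤ β
  mid-out y = cases (s y * D ^ 10 ≤? k) (s y * D ^ 6 ≤? k)
    where
    cases : (d : Dec (s y * D ^ 10 ≤ k)) (e : Dec (s y * D ^ 6 ≤ k)) →
      m y * (if does d then D ^ 8 * b else (if does e then D ^ 4 * b else 0)) ≤ β
    cases (yes h) _ = pool y 8 10 h refl
    cases (no _) (yes h) = pool y 4 6 h refl
    cases (no _) (no _) = ≤-trans (≤-reflexive (*-zeroʳ (m y))) z≤n

  share-out : ∀ y → sum (λ x → 𝟙 (adj? G y x) * share′ y x) ≤ B
  share-out y = begin
    sum (λ x → 𝟙 (adj? G y x) * share′ y x) ≡⟨ sum-cong (λ x → split (adj? G y x) (tiny? x) (mid? x)) ⟩
    sum (λ x → tinyShare y * 𝟙 (adj? G y x ×-dec tiny? x) + midShare y * 𝟙 (adj? G y x ×-dec mid? x)) ≡⟨ sum-*+* (tinyShare y) (λ x → 𝟙 (adj? G y x ×-dec tiny? x)) (midShare y) (λ x → 𝟙 (adj? G y x ×-dec mid? x)) ⟩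
    tinyShare y * t y + midShare y * m y ≡⟨ cong₂ _+_ (*-comm (tinyShare y) (t y)) (*-comm (midShare y) (m y)) ⟩
    t y * tinyShare y + m y * midShare y ≤⟨ cases (m y ℕ.≟ 0) ⟩
    B ∎
    where
    open ≤-Reasoning
    open +-*-Solver
    split : ∀ {p q r} {P : Set p} {Q : Set q} {R : Set r} (d : Dec P) (e : Dec Q) (g : Dec R) →
      𝟙 d * (𝟙 e * tinyShare y + 𝟙 g * midShare y) ≡ tinyShare y * 𝟙 (d ×-dec e) + midShare y * 𝟙 (d ×-dec g)
    split d e g = trans (solve 5 (λ d e g a c → d :* (e :* a :+ g :* c) := a :* (d :* e) :+ c :* (d :* g)) refl (𝟙 d) (𝟙 e) (𝟙 g) (tinyShare y) (midShare y))
      (cong₂ (λ u v → tinyShare y * u + midShare y * v) (𝟙-× d e) (𝟙-× d g))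
    cases : (d : Dec (m y ≡ 0)) → t y * (if does d then divide B (t y) else divide B₁ (t y)) + m y * midShare y ≤ B
    cases (yes e) = ≤-trans (≤-reflexive (trans (cong (λ z → t y * divide B (t y) + z * midShare y) e) (+-identityʳ _))) (divide-upper B (t y))
    cases (no _) = ≤-trans (+-mono-≤ (divide-upper B₁ (t y)) (≤-trans (mid-out y) (m≤m+n β _))) (≤-reflexive B₁+2β)

  -- A mid vertex has degree at least k/D^3. If no neighbour has more than k/D^6 low neighbours,
  -- each sends `D ^ 4 * b`. Otherwise the fan at an exceptional neighbour yields at least k/D^7
  -- good ones, and each of these sends `D ^ 8 * b`. Both totals are at least `k * D * b`.
  mid-in : ∀ x → Mid x → B * E ≤ 2 * sum (λ y → 𝟙 (adj? G x y) * midShare y)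
  mid-in x (low-x , ¬tiny-x) = cases (any? (λ y → adj? G x y ×-dec ¬? (s y * D ^ 6 ≤? k)))
    where
    open ≤-Reasoning
    open +-*-Solver
    R : ℕ
    R = sum (λ y → 𝟙 (adj? G x y) * midShare y)
    needed : ∀ c → k ≤ c * D → B * E ≤ 2 * (c * (D * D) * b)
    needed c h = begin
      B * E ≤⟨ *-monoʳ-≤ B E≤D ⟩
      (3 * E + 2) * (L * k) * D ≡⟨ solve 4 (λ E L k D → (con 3 :* E :+ con 2) :* (L :* k) :* D := k :* (D :* ((con 3 :* E :+ con 2) :* L))) refl E L k D ⟩
      k * (D * b) ≤⟨ *-monoˡ-≤ (D * b) h ⟩
      c * D * (D * b) ≡⟨ solve 3 (λ c D b → c :* D :* (D :* b) := c :* (D :* D) :* b) refl c D b ⟩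
      c * (D * D) * b ≤⟨ m≤m+n _ _ ⟩
      2 * (c * (D * D) * b) ∎
    big-degree : k ≤ deg G x * D ^ 3
    big-degree = begin
      k ≤⟨ ≮⇒≥ ¬tiny-x ⟩
      4 * (E + 2) * deg G x ≤⟨ *-monoˡ-≤ (deg G x) (4[E+2]≤ E≤D) ⟩
      D ^ 3 * deg G x ≡⟨ *-comm (D ^ 3) _ ⟩
      deg G x * D ^ 3 ∎
    high-share : ∀ y → s y * D ^ 10 ≤ k → D ^ 8 * b ≤ midShare y
    high-share y h = ≤-reflexive (sym (if-yes (s y * D ^ 10 ≤? k) h))
    low-share : ∀ y → s y * D ^ 6 ≤ k → D ^ 4 * b ≤ midShare y
    low-share y h = help (s y * D ^ 10 ≤? k) (s y * D ^ 6 ≤? k)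
      where
      help : (d : Dec (s y * D ^ 10 ≤ k)) (e : Dec (s y * D ^ 6 ≤ k)) → D ^ 4 * b ≤ (if does d then D ^ 8 * b else (if does e then D ^ 4 * b else 0))
      help (yes _) _ = *-monoˡ-≤ b (pow≤ (m≤m+n 4 4))
      help (no _) (yes _) = ≤-refl
      help (no _) (no ¬h) = ⊥-elim (¬h h)
    bulk : ∀ {P : Fin n → Set} (P? : ∀ y → Dec (P y)) v → (∀ y → adj G x y ≡ true → P y → v ≤ midShare y) →
      count (λ y → adj? G x y ×-dec P? y) * v ≤ R
    bulk P? v h = begin
      count (λ y → adj? G x y ×-dec P? y) * v ≡⟨ *-comm _ v ⟩
      v * count (λ y → adj? G x y ×-dec P? y) ≡⟨ sum-* v (λ y → 𝟙 (adj? G x y ×-dec P? y)) ⟨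
      sum (λ y → v * 𝟙 (adj? G x y ×-dec P? y)) ≤⟨ sum-mono (λ y → pt y (adj? G x y) (P? y)) ⟩
      R ∎
      where
      pt : ∀ y (d : Dec (adj G x y ≡ true)) e → v * 𝟙 (d ×-dec e) ≤ 𝟙 d * midShare y
      pt y (yes a) (yes p) = subst₂ _≤_ (sym (*-identityʳ v)) (sym (*-identityˡ (midShare y))) (h y a p)
      pt y (yes _) (no _) = ≤-trans (≤-reflexive (*-zeroʳ v)) z≤n
      pt y (no _) _ = ≤-trans (≤-reflexive (*-zeroʳ v)) z≤n
    low-deg : ∀ {v} → Low v → k ≤ D * (k ∸ deg G v)
    low-deg {v} l = *-cancelˡ-≤ 2 (+-cancelʳ-≤ (deg G v * E) _ _ (begin
      2 * k + deg G v * E ≡⟨ cong (λ z → 2 * z + deg G v * E) (sym (m+[n∸m]≡n (deg≤ v))) ⟩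
      2 * (deg G v + e) + deg G v * E ≡⟨ solve 3 (λ d e E → con 2 :* (d :+ e) :+ d :* E := d :* (E :+ con 2) :+ con 2 :* e) refl (deg G v) e E ⟩
      deg G v * (E + 2) + 2 * e ≤⟨ +-monoˡ-≤ (2 * e) (<⇒≤ l) ⟩
      k * E + 2 * e ≡⟨ cong (λ z → z * E + 2 * e) (sym (m+[n∸m]≡n (deg≤ v))) ⟩
      (deg G v + e) * E + 2 * e ≡⟨ solve 3 (λ d e E → (d :+ e) :* E :+ con 2 :* e := (E :+ con 2) :* e :+ d :* E) refl (deg G v) e E ⟩
      (E + 2) * e + deg G v * E ≤⟨ +-monoˡ-≤ (deg G v * E) (*-monoˡ-≤ e (+-mono-≤ E≤D 2≤D)) ⟩
      (D + D) * e + deg G v * E ≡⟨ solve 3 (λ D e z → (D :+ D) :* e :+ z := con 2 :* (D :* e) :+ z) refl D e (deg G v * E) ⟩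
      2 * (D * e) + deg G v * E ∎))
      where e = k ∸ deg G v
    cases : Dec (∃ λ y → adj G x y ≡ true × ¬ s y * D ^ 6 ≤ k) → B * E ≤ 2 * R
    cases (no none) = begin
      B * E ≤⟨ needed (deg G x * D ^ 2) (≤-trans big-degree (≤-reflexive (solve 2 (λ d D → d :* (D :* (D :* (D :* con 1))) := d :* (D :* (D :* con 1)) :* D) refl (deg G x) D))) ⟩
      2 * (deg G x * D ^ 2 * (D * D) * b) ≡⟨ solve 3 (λ d D b → con 2 :* (d :* (D :* (D :* con 1)) :* (D :* D) :* b) := con 2 :* (d :* (D :* (D :* (D :* (D :* con 1))) :* b))) refl (deg G x) D b ⟩
      2 * (deg G x * (D ^ 4 * b)) ≤⟨ *-monoʳ-≤ 2 (≤-trans (*-monoˡ-≤ (D ^ 4 * b) deg≤count) (bulk {P = λ _ → ⊤} (λ _ → yes tt) (D ^ 4 * b) (λ y a _ → low-share y (decidable-stable (s y * D ^ 6 ≤? k) (λ ¬h → none (y , a , ¬h)))))) ⟩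
      2 * R ∎
      where
      deg≤count : deg G x ≤ count (λ y → adj? G x y ×-dec yes tt)
      deg≤count = ≤-trans (≤-reflexive (deg-count G x)) (count-mono (adj? G x) (λ y → adj? G x y ×-dec yes tt) (λ _ a → a , tt))
    cases (yes (y , a , s-big)) = from (rooted x y a)
      where
      module C = Crude nocol deg≤ k-pos low? D (≤-trans (s≤s z≤n) 2≤D) low-deg x low-x
      from : (∃ λ (φ : PartialColouring G k) → Root φ x y) → B * E ≤ 2 * R
      from (φ , root) = use (C.crude-spread (forbidden-fits C.P tower≤) root σ)
        where
        use : (∃ λ c → C.lowNbrs y ≤ 1 + (C.P + (C.goodNbrs σ + c)) × c * (σ ∸ 1) ≤ k * C.P) → B * E ≤ 2 * R
        use (c , h₁ , h₂) = begin
          B * E ≤⟨ needed (C.goodNbrs σ * D ^ 6) (≤-trans (many-good {s = C.lowNbrs y} {g = C.goodNbrs σ} {b = c} tower≤ h₁ h₂ s-big) (≤-reflexive (solve 3 (λ g D X → g :* (D :* X) := g :* X :* D) refl (C.goodNbrs σ) D (D ^ 6)))) ⟩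
          2 * (C.goodNbrs σ * D ^ 6 * (D * D) * b) ≡⟨ solve 4 (λ g X D b → con 2 :* (g :* X :* (D :* D) :* b) := con 2 :* (g :* (D :* (D :* X) :* b))) refl (C.goodNbrs σ) (D ^ 6) D b ⟩
          2 * (C.goodNbrs σ * (D ^ 8 * b)) ≤⟨ *-monoʳ-≤ 2 (bulk (λ y → C.lowNbrs y ≤? σ) (D ^ 8 * b)
              (λ y _ h → high-share y (≤-trans (*-monoˡ-≤ (D ^ 10) h) (m/n*n≤m k (D ^ 10))))) ⟩
          2 * R ∎

  module _ (x : Fin n) (tiny-x : Tiny x) where

    private
      sum<k : ∀ a b c z → 4 * (E + 2) * a < k → 4 * (E + 2) * b < k → 4 * (E + 2) * c ≤ z → k + k + z ≤ 4 * (E + 2) * k → a + b + c < k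
      sum<k a b c z ha hb hc hz = *-cancelˡ-< (4 * (E + 2)) _ _ (begin-strict
        4 * (E + 2) * (a + b + c) ≡⟨ trans (*-distribˡ-+ (4 * (E + 2)) (a + b) c) (cong (_+ 4 * (E + 2) * c) (*-distribˡ-+ (4 * (E + 2)) a b)) ⟩
        4 * (E + 2) * a + 4 * (E + 2) * b + 4 * (E + 2) * c <⟨ +-mono-<-≤ (+-mono-< ha hb) hc ⟩
        k + k + z ≤⟨ hz ⟩
        4 * (E + 2) * k ∎)
        where open ≤-Reasoning

    tiny-tiny : ∀ {w w'} → Tiny w → Tiny w' → deg G x + deg G w + deg G w' < k
    tiny-tiny {w} {w'} p q = sum<k (deg G x) (deg G w) (deg G w') k tiny-x p (<⇒≤ q)
      (≤-trans (m≤m+n (k + k + k) _) (≤-reflexive (solve 2 (λ k E → k :+ k :+ k :+ (con 4 :* E :* k :+ con 5 :* k) := con 4 :* (E :+ con 2) :* k) refl k E)))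
      where open +-*-Solver

    tiny-low : ∀ {w w'} → Tiny w → Low w' → deg G x + deg G w + deg G w' < k
    tiny-low {w} {w'} p q = sum<k (deg G x) (deg G w) (deg G w') (4 * (k * E)) tiny-x p
      (≤-trans (≤-reflexive (solve 2 (λ E d → con 4 :* (E :+ con 2) :* d := con 4 :* (d :* (E :+ con 2))) refl E (deg G w'))) (*-monoʳ-≤ 4 (<⇒≤ q)))
      (≤-trans (m≤m+n (k + k + 4 * (k * E)) _) (≤-reflexive (solve 2 (λ k E → k :+ k :+ con 4 :* (k :* E) :+ con 6 :* k := con 4 :* (E :+ con 2) :* k) refl k E)))
      where open +-*-Solver

    private
      module SC = SmallCentre nocol deg≤ x tiny? low? tiny-x tiny-tiny tiny-low

      t-pos : ∀ {v} → adj G x v ≡ true → 1 ≤ t v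
      t-pos {v} a = count-pos (λ w → adj? G v w ×-dec tiny? w) x (trans (adj-sym G v x) a , tiny-x)

      L-divides : ∀ c T → 1 ≤ T → T ≤ E → T ∣ c * (L * k)
      L-divides c T 1≤T T≤E = ∣n⇒∣m*n c (∣m⇒∣m*n k (L-div T 1≤T T≤E))

      module Full = WeightedShares (adj? G x) t t-pos B E 2≤E (divide B)
        (λ t T 1≤t t≤T T≤E → divide-lower B t T (L-divides (3 * E + 2) T (≤-trans 1≤t t≤T) T≤E) 1≤t t≤T)
      module Part = WeightedShares (adj? G x) t t-pos B₁ E 2≤E (divide B₁)
        (λ t T 1≤t t≤T T≤E → divide-lower B₁ t T (L-divides (3 * E) T (≤-trans 1≤t t≤T) T≤E) 1≤t t≤T)

      D≡ : count (adj? G x) ≡ deg G x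
      D≡ = sym (deg-count G x)

      E≤D′ : E ≤ 2 + count (adj? G x)
      E≤D′ = subst (λ d → E ≤ 2 + d) (sym D≡) (E≤deg x)

      arith′ : ∀ T → 3 ≤ T → 2 * T ≤ E → T * (3 * E + 2) + 6 * T ≤ 6 * (T * T + count (adj? G x))
      arith′ T p q = subst (λ d → T * (3 * E + 2) + 6 * T ≤ 6 * (T * T + d)) (sym D≡) (arith x T p q)

      spread₂ : ∀ {y} → adj G x y ≡ true → SC.Spread y 2
      spread₂ {y} a = SC.spread (proj₂ (rooted x y a))

      t≤n : ∀ v → t v ≤ n
      t≤n v = count≤ (λ w → adj? G v w ×-dec tiny? w)

      module FullTotals = Full.Totals E≤D′ (nonempty x) n t≤n spread₂ arith′
      module PartTotals = Part.Totals E≤D′ (nonempty x) n t≤n spread₂ arith′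

      tinySum : ℕ
      tinySum = sum (λ y → 𝟙 (adj? G x y) * tinyShare y)

      at-least : ∀ (g : ℕ → ℕ) → (∀ y → adj G x y ≡ true → g (t y) ≤ tinyShare y) →
        sum (λ y → 𝟙 (adj? G x y) * g (t y)) ≤ tinySum
      at-least g h = sum-mono (λ y → pt y (adj? G x y))
        where
        pt : ∀ y (d : Dec (adj G x y ≡ true)) → 𝟙 d * g (t y) ≤ 𝟙 d * tinyShare y
        pt y (yes a) = *-monoʳ-≤ 1 (h y a)
        pt y (no _) = z≤n

    -- If some neighbour has a mid neighbour, all neighbours are credited with `B₁` only, and the
    -- extra third from the fan rooted at that one makes up for the loss.
    tiny-in : B * E ≤ 2 * tinySum
    tiny-in = cases (any? (λ y → adj? G x y ×-dec ¬? (m y ℕ.≟ 0)))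
      where
      open ≤-Reasoning
      open +-*-Solver
      cases : Dec (∃ λ y → adj G x y ≡ true × m y ≢ 0) → B * E ≤ 2 * tinySum
      cases (no none) = ≤-trans FullTotals.share-total (*-monoʳ-≤ 2 (at-least (divide B) (λ y a →
        ≤-reflexive (sym (if-yes (m y ℕ.≟ 0) (decidable-stable (m y ℕ.≟ 0) (λ ne → none (y , a , ne))))))))
      cases (yes (y , a , ne)) = *-cancelˡ-≤ 3 (begin
        3 * (B * E) ≡⟨ solve 2 (λ E β → con 3 :* ((con 3 :* E :+ con 2) :* β :* E) := con 3 :* E :* β :* (con 3 :* E :+ con 2)) refl E β ⟩
        B₁ * (3 * E + 2) ≤⟨ PartTotals.share-total-mid {y} (SC.spread-mid y (proj₂ (rooted x y a)) (count-∃ (λ w → adj? G y w ×-dec mid? w) (n≢0⇒n>0 ne))) ⟩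
        6 * Part.received ≤⟨ *-monoʳ-≤ 6 (at-least (divide B₁) (λ y _ → part≤ y (m y ℕ.≟ 0))) ⟩
        6 * tinySum ≡⟨ *-assoc 3 2 tinySum ⟩
        3 * (2 * tinySum) ∎)
        where
        part≤ : ∀ y (d : Dec (m y ≡ 0)) → divide B₁ (t y) ≤ (if does d then divide B (t y) else divide B₁ (t y))
        part≤ y (yes _) = divide-mono (t y) B₁≤B
        part≤ y (no _) = ≤-refl

  share-in : ∀ x → Low x → B * E ≤ 2 * sum (λ y → 𝟙 (adj? G x y) * share′ y x)
  share-in x low-x = cases (tiny? x)
    where
    cases : Dec (Tiny x) → B * E ≤ 2 * sum (λ y → 𝟙 (adj? G x y) * share′ y x)
    cases (yes p) = ≤-trans (tiny-in x p) (*-monoʳ-≤ 2 (sum-mono (λ y → *-monoʳ-≤ (𝟙 (adj? G x y))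
      (≤-trans (≤-reflexive (trans (sym (*-identityˡ (tinyShare y))) (cong (_* tinyShare y) (sym (𝟙-yes (tiny? x) p))))) (m≤m+n _ _)))))
    cases (no ¬p) = ≤-trans (mid-in x (low-x , ¬p)) (*-monoʳ-≤ 2 (sum-mono (λ y → *-monoʳ-≤ (𝟙 (adj? G x y))
      (≤-trans (≤-reflexive (trans (sym (*-identityˡ (midShare y))) (cong (_* midShare y) (sym (𝟙-yes (mid? x) (low-x , ¬p)))))) (m≤n+m _ _)))))

  -- In units of B: y may give away (E + 2) k, and what it saves on its f y neighbours of degree k
  -- goes to its low neighbours, except for one unit which makes the final inequality strict.
  weight : Fin n → Fin n → ℕ
  weight y x = if does (deg G x ℕ.≟ k) then B * E else (B * (E + 2) + (2 * f y ∸ 1) * share′ y x)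

  enough-max : ∀ {x y} → adj G y x ≡ true → suc (k ∸ deg G x) ≤ f y
  enough-max {x} {y} a = vizing-adjacency nocol deg≤ (proj₂ (rooted y x a))

  -- A low `x` of degree `k - e` lacks at most `B * E * e`. By Vizing's lemma each neighbour passes
  -- on at least `2 * e + 1` times its share, and the shares add up to at least `B * E / 2`.
  incoming : ∀ x → B * E * k ≤ sum (λ y → 𝟙 (adj? G x y) * weight y x)
  incoming x = cases (deg G x ℕ.≟ k)
    where
    open ≤-Reasoning
    open +-*-Solver
    T : ℕ
    T = sum (λ y → 𝟙 (adj? G x y) * share′ y x)
    e : ℕ
    e = k ∸ deg G x
    uniform : ∀ c → sum (λ y → c * 𝟙 (adj? G x y)) ≡ c * deg G x
    uniform c = trans (sum-* c (λ y → 𝟙 (adj? G x y))) (cong (c *_) (sym (deg-count G x)))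
    cases : (d : Dec (deg G x ≡ k)) → B * E * k ≤ sum (λ y → 𝟙 (adj? G x y) * (if does d then B * E else (B * (E + 2) + (2 * f y ∸ 1) * share′ y x)))
    cases (yes eq) = begin
      B * E * k ≡⟨ cong (B * E *_) (sym eq) ⟩
      B * E * deg G x ≡⟨ uniform (B * E) ⟨
      sum (λ y → B * E * 𝟙 (adj? G x y)) ≤⟨ sum-mono (λ y → ≤-reflexive (*-comm (B * E) (𝟙 (adj? G x y)))) ⟩
      sum (λ y → 𝟙 (adj? G x y) * (B * E)) ∎
    cases (no _) = low-cases (low? x)
      where
      low-cases : Dec (Low x) → B * E * k ≤ sum (λ y → 𝟙 (adj? G x y) * (B * (E + 2) + (2 * f y ∸ 1) * share′ y x))
      -- `Low` is defined so that otherwise the flat amount `B * (E + 2)` from each neighbour is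
      -- enough.
      low-cases (no ¬low) = begin
        B * E * k ≡⟨ solve 3 (λ B E k → B :* E :* k := B :* (k :* E)) refl B E k ⟩
        B * (k * E) ≤⟨ *-monoʳ-≤ B (≮⇒≥ ¬low) ⟩
        B * (deg G x * (E + 2)) ≡⟨ solve 3 (λ B E d → B :* (d :* E) := B :* E :* d) refl B (E + 2) (deg G x) ⟩
        B * (E + 2) * deg G x ≡⟨ uniform (B * (E + 2)) ⟨
        sum (λ y → B * (E + 2) * 𝟙 (adj? G x y)) ≤⟨ sum-mono (λ y → ≤-trans (≤-reflexive (*-comm (B * (E + 2)) _)) (*-monoʳ-≤ (𝟙 (adj? G x y)) (m≤m+n (B * (E + 2)) _))) ⟩
        sum (λ y → 𝟙 (adj? G x y) * (B * (E + 2) + (2 * f y ∸ 1) * share′ y x)) ∎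
      low-cases (yes low) = begin
        B * E * k ≡⟨ cong (B * E *_) (sym (m+[n∸m]≡n (deg≤ x))) ⟩
        B * E * (deg G x + e) ≡⟨ *-distribˡ-+ (B * E) (deg G x) e ⟩
        B * E * deg G x + B * E * e ≤⟨ +-mono-≤ (*-monoˡ-≤ (deg G x) (*-monoʳ-≤ B (m≤m+n E 2))) (*-monoˡ-≤ e (share-in x low)) ⟩
        B * (E + 2) * deg G x + 2 * T * e ≤⟨ +-monoʳ-≤ (B * (E + 2) * deg G x) (≤-trans (≤-reflexive (solve 2 (λ T e → con 2 :* T :* e := con 2 :* e :* T) refl T e)) (*-monoˡ-≤ T (n≤1+n (2 * e)))) ⟩
        B * (E + 2) * deg G x + suc (2 * e) * T ≡⟨ cong₂ _+_ (sym (uniform (B * (E + 2)))) refl ⟩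
        sum (λ y → B * (E + 2) * 𝟙 (adj? G x y)) + suc (2 * e) * T ≡⟨ sum-+* (λ y → B * (E + 2) * 𝟙 (adj? G x y)) (suc (2 * e)) (λ y → 𝟙 (adj? G x y) * share′ y x) ⟨
        sum (λ y → B * (E + 2) * 𝟙 (adj? G x y) + suc (2 * e) * (𝟙 (adj? G x y) * share′ y x)) ≤⟨ sum-mono (λ y → pt y (adj? G x y)) ⟩
        sum (λ y → 𝟙 (adj? G x y) * (B * (E + 2) + (2 * f y ∸ 1) * share′ y x)) ∎
        where
        pt : ∀ y (d : Dec (adj G x y ≡ true)) →
          B * (E + 2) * 𝟙 d + suc (2 * e) * (𝟙 d * share′ y x) ≤ 𝟙 d * (B * (E + 2) + (2 * f y ∸ 1) * share′ y x)
        pt y (no _) = ≤-reflexive (trans (cong₂ _+_ (*-zeroʳ (B * (E + 2))) (*-zeroʳ (suc (2 * e)))) refl)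
        pt y (yes a) = begin
          B * (E + 2) * 1 + suc (2 * e) * (1 * share′ y x) ≡⟨ cong₂ _+_ (*-identityʳ (B * (E + 2))) (cong (suc (2 * e) *_) (*-identityˡ (share′ y x))) ⟩
          B * (E + 2) + suc (2 * e) * share′ y x ≤⟨ +-monoʳ-≤ (B * (E + 2)) (*-monoˡ-≤ (share′ y x) (m+n≤o⇒m≤o∸n (suc (2 * e)) (≤-trans (≤-reflexive (solve 1 (λ e → con 1 :+ con 2 :* e :+ con 1 := con 2 :* (con 1 :+ e)) refl e)) (*-monoʳ-≤ 2 (enough-max (trans (adj-sym G y x) a)))))) ⟩
          B * (E + 2) + (2 * f y ∸ 1) * share′ y x ≡⟨ *-identityˡ _ ⟨
          1 * (B * (E + 2) + (2 * f y ∸ 1) * share′ y x) ∎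

  -- Each of the `f y` neighbours of degree `k` costs `2 * B` less than the flat amount, and at most
  -- `(2 * f y ∸ 1) * B` is passed on, so `B` is left over.
  outgoing : ∀ y → sum (λ x → 𝟙 (adj? G y x) * weight y x) + B ≤ B * ((E + 2) * k)
  outgoing y = +-cancelʳ-≤ (2 * B * f y) _ _ (begin
    O + B + 2 * B * f y ≡⟨ solve 3 (λ O B F → O :+ B :+ F := O :+ F :+ B) refl O B (2 * B * f y) ⟩
    O + 2 * B * f y + B ≤⟨ +-monoˡ-≤ B balance ⟩
    B * (E + 2) * deg G y + (2 * f y ∸ 1) * Sh + B ≤⟨ +-monoˡ-≤ B (+-mono-≤ (*-monoʳ-≤ (B * (E + 2)) (deg≤ y)) (*-monoʳ-≤ (2 * f y ∸ 1) (share-out y))) ⟩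
    B * (E + 2) * k + (2 * f y ∸ 1) * B + B ≡⟨ solve 4 (λ B E k g → B :* E :* k :+ g :* B :+ B := B :* (E :* k) :+ (con 1 :+ g) :* B) refl B (E + 2) k (2 * f y ∸ 1) ⟩
    B * ((E + 2) * k) + (1 + (2 * f y ∸ 1)) * B ≡⟨ cong (λ z → B * ((E + 2) * k) + z * B) (m+[n∸m]≡n (≤-trans f-pos (m≤m+n (f y) _))) ⟩
    B * ((E + 2) * k) + 2 * f y * B ≡⟨ cong (B * ((E + 2) * k) +_) (solve 2 (λ f B → con 2 :* f :* B := con 2 :* B :* f) refl (f y) B) ⟩
    B * ((E + 2) * k) + 2 * B * f y ∎)
    where
    open ≤-Reasoning
    open +-*-Solver
    O Sh : ℕ
    O = sum (λ x → 𝟙 (adj? G y x) * weight y x)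
    Sh = sum (λ x → 𝟙 (adj? G y x) * share′ y x)
    f-pos : 1 ≤ f y
    f-pos = ≤-trans (s≤s z≤n) (enough-max (proj₂ (nonempty y)))
    pt : ∀ x (a : Dec (adj G y x ≡ true)) (d : Dec (deg G x ≡ k)) →
      𝟙 a * (if does d then B * E else (B * (E + 2) + (2 * f y ∸ 1) * share′ y x)) + 2 * B * 𝟙 (a ×-dec d)
      ≤ B * (E + 2) * 𝟙 a + (2 * f y ∸ 1) * (𝟙 a * share′ y x)
    pt x (no _) d = ≤-trans (≤-reflexive (*-zeroʳ (2 * B))) z≤n
    pt x (yes _) (yes _) = ≤-trans (≤-reflexive (solve 2 (λ B E → con 1 :* (B :* E) :+ con 2 :* B :* con 1 := B :* (E :+ con 2) :* con 1) refl B E)) (m≤m+n _ _)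
    pt x (yes _) (no _) = ≤-reflexive (solve 4 (λ B E g h → con 1 :* (B :* E :+ g :* h) :+ con 2 :* B :* con 0 := B :* E :* con 1 :+ g :* (con 1 :* h)) refl B (E + 2) (2 * f y ∸ 1) (share′ y x))
    balance : O + 2 * B * f y ≤ B * (E + 2) * deg G y + (2 * f y ∸ 1) * Sh
    balance = begin
      O + 2 * B * f y ≡⟨ sum-+* (λ x → 𝟙 (adj? G y x) * weight y x) (2 * B) (λ x → 𝟙 (adj? G y x ×-dec (deg G x ℕ.≟ k))) ⟨
      sum (λ x → 𝟙 (adj? G y x) * weight y x + 2 * B * 𝟙 (adj? G y x ×-dec (deg G x ℕ.≟ k))) ≤⟨ sum-mono (λ x → pt x (adj? G y x) (deg G x ℕ.≟ k)) ⟩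
      sum (λ x → B * (E + 2) * 𝟙 (adj? G y x) + (2 * f y ∸ 1) * (𝟙 (adj? G y x) * share′ y x)) ≡⟨ sum-*+* (B * (E + 2)) (λ x → 𝟙 (adj? G y x)) (2 * f y ∸ 1) (λ x → 𝟙 (adj? G y x) * share′ y x) ⟩
      B * (E + 2) * count (adj? G y) + (2 * f y ∸ 1) * Sh ≡⟨ cong (λ z → B * (E + 2) * z + (2 * f y ∸ 1) * Sh) (sym (deg-count G y)) ⟩
      B * (E + 2) * deg G y + (2 * f y ∸ 1) * Sh ∎

  -- Strictness comes from the `B` left over at each vertex outside `S`; an edge at `v₀` has an end
  -- there.
  independent-bound : 1 ≤ L → Fin n → ∀ S → Independent G S → E * ∣ S ∣ < (E + 2) * (n ∸ ∣ S ∣)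
  independent-bound 1≤L v₀ S indep = *-cancelˡ-< (B * k) _ _ (begin-strict
    B * k * (E * a) ≡⟨ solve 4 (λ B k E a → B :* k :* (E :* a) := a :* (B :* E :* k)) refl B k E a ⟩
    a * (B * E * k) ≤⟨ discharge G S indep weight (B * E * k) (Out ∸ B) incoming (λ y → m+n≤o⇒m≤o∸n _ (outgoing y)) ⟩
    c * (Out ∸ B) <⟨ *-monoʳ-< c ⦃ >-nonZero c-pos ⦄ (∸-monoʳ-< {Out} {B} {0} B-pos B≤Out) ⟩
    c * Out ≡⟨ solve 4 (λ B k E c → c :* (B :* (E :* k)) := B :* k :* (E :* c)) refl B k (E + 2) c ⟩
    B * k * ((E + 2) * c) ∎)
    where
    open ≤-Reasoning
    open +-*-Solver
    a c Out : ℕ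
    a = ∣ S ∣
    c = n ∸ ∣ S ∣
    Out = B * ((E + 2) * k)
    B-pos : 0 < B
    B-pos = *-mono-≤ (≤-trans (s≤s z≤n) (m≤n+m 2 (3 * E))) (*-mono-≤ 1≤L k-pos)
    B≤Out : B ≤ Out
    B≤Out = ≤-trans (m≤n+m B _) (outgoing v₀)
    outside-pos : ∀ {u v} → adj G u v ≡ true → Dec (u ∈ₛ S) → Dec (v ∈ₛ S) → 1 ≤ count (λ y → ¬? (y ∈ₛ? S))
    outside-pos {u} {v} e (no u∉) _ = count-pos (λ y → ¬? (y ∈ₛ? S)) u u∉
    outside-pos {u} {v} e (yes _) (no v∉) = count-pos (λ y → ¬? (y ∈ₛ? S)) v v∉
    outside-pos {u} {v} e (yes p) (yes q) with trans (sym e) (indep u v p q)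
    ... | ()
    c-pos : 0 < c
    c-pos = subst (1 ≤_) (trans (sym (m+n∸m≡n (count (λ y → y ∈ₛ? S)) _)) (cong₂ _∸_ (count-¬ (λ y → y ∈ₛ? S)) (sym (subset-count S))))
      (outside-pos (proj₂ (nonempty v₀)) (v₀ ∈ₛ? S) (proj₁ (nonempty v₀) ∈ₛ? S))

-- Conclusion

∈⇒≤maximum : ∀ {A : Set} (f : A → ℕ) {x xs} → x ∈ xs → f x ≤ foldr _⊔_ 0 (List.map f xs)
∈⇒≤maximum f (here refl) = m≤m⊔n _ _
∈⇒≤maximum f (there i) = ≤-trans (∈⇒≤maximum f i) (m≤n⊔m _ _)

deg≤maxDeg : ∀ {n} (G : Graph n) v → deg G v ≤ maxDeg G
deg≤maxDeg G v = ∈⇒≤maximum (deg G) (∈-allFin v)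

≤⇒∣! : ∀ m n → 1 ≤ m → m ≤ n → m ∣ n !
≤⇒∣! (suc m) n _ h = ∣-trans (m∣m*n (m !)) (m≤n⇒m!∣n! h)

2mn≤m²+n² : ∀ m n → 2 * (m * n) ≤ m * m + n * n
2mn≤m²+n² m n with ≤-total m n
... | inj₁ h = subst (λ n → 2 * (m * n) ≤ m * m + n * n) (m+[n∸m]≡n h)
  (≤-trans (m≤m+n _ ((n ∸ m) * (n ∸ m))) (≤-reflexive (solve 2 (λ m q → con 2 :* (m :* (m :+ q)) :+ q :* q := m :* m :+ (m :+ q) :* (m :+ q)) refl m (n ∸ m))))
  where open +-*-Solver
... | inj₂ h = subst (λ m → 2 * (m * n) ≤ m * m + n * n) (m+[n∸m]≡n h)
  (≤-trans (m≤m+n _ ((m ∸ n) * (m ∸ n))) (≤-reflexive (solve 2 (λ n q → con 2 :* ((n :+ q) :* n) :+ q :* q := (n :+ q) :* (n :+ q) :+ n :* n) refl n (m ∸ n))))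
  where open +-*-Solver

independence-ratio : ∀ {n} (G : Graph n) → Critical G → ∀ d E → 3 ≤ d → 2 ≤ E → E ≤ d + 2 → (∀ v → d ≤ deg G v) →
  (d + 2) ^ (5 * d + 10) ≤ maxDeg G →
  (∀ T → 3 ≤ T → 2 * T ≤ E → T * (3 * E + 2) + 6 * T ≤ 6 * (T * T + d)) →
  ∀ a → IndependenceNumber G a → E * a < (E + 2) * (n ∸ a) × a ≤ n
independence-ratio {zero} G _ d E 3≤d _ _ _ big _ _ _ = ⊥-elim (<⇒≱ (m^n>0 (d + 2) ⦃ >-nonZero (≤-trans (s≤s z≤n) (m≤n+m 2 d)) ⦄ (5 * d + 10)) big)
independence-ratio {suc n} G (_ , (_ , minimal) , removal) d E 3≤d 2≤E E≤D d≤deg big arith a ((S , indep , refl) , _) =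
  Disch.independent-bound (1≤n! E) zero S indep , ∣p∣≤n S
  where
  D≥5 : 5 ≤ d + 2
  D≥5 = +-monoˡ-≤ 2 3≤d
  module Disch = Discharging {G = G} (minimal (maxDeg G) (n<1+n _)) (deg≤maxDeg G)
    (λ x y e → fromRemoval x y e (proj₁ (removal x y e)))
    (d + 2) E D≥5 2≤E E≤D
    (≤-trans (^-monoʳ-≤ (d + 2) ⦃ >-nonZero (≤-trans (s≤s z≤n) D≥5) ⦄ (+-monoˡ-≤ 10 (*-monoʳ-≤ 5 3≤d))) big)
    (λ x → count-∃ (adj? G x) (≤-trans (≤-trans (s≤s z≤n) 3≤d) (≤-trans (d≤deg x) (≤-reflexive (deg-count G x)))))
    (λ x → ≤-trans E≤D (≤-trans (≤-reflexive (+-comm d 2)) (+-monoʳ-≤ 2 (d≤deg x))))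
    (λ x T p q → ≤-trans (arith T p q) (*-monoʳ-≤ 6 (+-monoʳ-≤ (T * T) (d≤deg x))))
    (E !) (λ T p q → ≤⇒∣! T E p q)

-- Induction on `d` from `e = 4`. The cube condition forces `e` up only when `d + 10` equals
-- `e ^ 3`, and by then `d` is large enough for the next square.
root-parameter : ∀ d → 19 ≤ d → ∃ λ e → 4 ≤ e × d + 10 ≤ e ^ 3 × e * e ≤ d
root-parameter d 19≤d = subst (λ d → ∃ λ e → 4 ≤ e × d + 10 ≤ e ^ 3 × e * e ≤ d) (m+[n∸m]≡n 19≤d) (go (d ∸ 19))
  where
  next-square : ∀ q e → 4 ≤ e → q + 10 ≡ e ^ 3 → suc e * suc e ≤ suc q
  next-square q e 4≤e eq = +-cancelʳ-≤ 10 _ _ (begin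
    suc e * suc e + 10 ≡⟨ solve 1 (λ e → (con 1 :+ e) :* (con 1 :+ e) :+ con 10 := e :* e :+ (con 2 :* e :+ con 10) :+ con 1) refl e ⟩
    e * e + (2 * e + 10) + 1 ≤⟨ +-monoˡ-≤ 1 (+-monoʳ-≤ (e * e) (begin
        2 * e + 10 ≤⟨ +-monoʳ-≤ (2 * e) (≤-trans (m≤m+n 10 2) (*-monoʳ-≤ 3 4≤e)) ⟩
        2 * e + 3 * e ≡⟨ solve 1 (λ e → con 2 :* e :+ con 3 :* e := e :* con 5) refl e ⟩
        e * 5 ≤⟨ *-monoʳ-≤ e (≤-trans (m≤m+n 5 7) (*-monoʳ-≤ 3 4≤e)) ⟩
        e * (3 * e) ∎)) ⟩
    e * e + e * (3 * e) + 1 ≡⟨ solve 1 (λ e → e :* e :+ e :* (con 3 :* e) :+ con 1 := e :* e :* con 4 :+ con 1) refl e ⟩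
    e * e * 4 + 1 ≤⟨ +-monoˡ-≤ 1 (*-monoʳ-≤ (e * e) 4≤e) ⟩
    e * e * e + 1 ≡⟨ solve 1 (λ e → e :* e :* e :+ con 1 := con 1 :+ e :* (e :* (e :* con 1))) refl e ⟩
    1 + e ^ 3 ≡⟨ cong suc (sym eq) ⟩
    suc q + 10 ∎)
    where
    open ≤-Reasoning
    open +-*-Solver
  go : ∀ q → ∃ λ e → 4 ≤ e × (19 + q) + 10 ≤ e ^ 3 × e * e ≤ 19 + q
  go zero = 4 , ≤-refl , m≤m+n 29 35 , m≤m+n 16 3
  go (suc q) with go q
  ... | e , 4≤e , cube , square with (19 + suc q) + 10 ≤? e ^ 3
  ...   | yes h = e , 4≤e , h , ≤-trans square (+-monoʳ-≤ 19 (n≤1+n q))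
  ...   | no ¬h = suc e , ≤-trans 4≤e (n≤1+n e)
          , ≤-trans (≤-reflexive (trans (cong (_+ 10) (+-suc 19 q)) (cong suc exact))) (≤-trans (≤-reflexive (+-comm 1 (e ^ 3))) (≤-trans (m≤m+n (e ^ 3 + 1) _)
              (≤-reflexive (solve 1 (λ e → e :* (e :* (e :* con 1)) :+ con 1 :+ (con 3 :* (e :* e) :+ con 3 :* e) := (con 1 :+ e) :* ((con 1 :+ e) :* ((con 1 :+ e) :* con 1))) refl e))))
          , ≤-trans (next-square (19 + q) e 4≤e exact) (≤-reflexive (sym (+-suc 19 q)))
    where
    open +-*-Solver
    exact : (19 + q) + 10 ≡ e ^ 3
    exact = ≤-antisym cube (≤-pred (≤-trans (≰⇒> ¬h) (≤-reflexive (cong (_+ 10) (+-suc 19 q)))))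

cube< : ∀ {a b} → a < b → a ^ 3 < b ^ 3
cube< = ^-monoˡ-< 3

-- With `c` the cube root of `(d - 1) d`, the claim says that a/(n - a) is below 1 + c/(d+2), and
-- the hypothesis bounds it by 1 + 1/e. So `(d + 2) ^ 3 ≤ (d - 1) * d * e ^ 3` suffices; it follows
-- from `cube`, as `(d - 1) * d * (d + 10)` exceeds `(d + 2) ^ 3`.
cubeRootBound : ∀ d e n a → 19 ≤ d → d + 10 ≤ e ^ 3 → a ≤ n → e * a < suc e * (n ∸ a) → CubeRootBound d n a
cubeRootBound d e n a 19≤d cube a≤n lt with a <? n ∸ a
... | yes a<R = inj₁ (begin-strict
  a * (2 * d + 4) ≡⟨ solve 2 (λ a d → a :* (con 2 :* d :+ con 4) := (d :+ con 2) :* (a :+ a)) refl a d ⟩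
  (d + 2) * (a + a) <⟨ *-monoʳ-< (d + 2) ⦃ >-nonZero (≤-trans (s≤s z≤n) (m≤n+m 2 d)) ⦄ (+-monoʳ-< a a<R) ⟩
  (d + 2) * (a + (n ∸ a)) ≡⟨ cong ((d + 2) *_) (m+[n∸m]≡n a≤n) ⟩
  (d + 2) * n ∎)
  where
  open ≤-Reasoning
  open +-*-Solver
... | no a≮R = inj₂ (begin-strict
  (a * (2 * d + 4) ∸ (d + 2) * n) ^ 3 ≡⟨ cong (_^ 3) L≡ ⟩
  ((d + 2) * q) ^ 3 ≡⟨ solve 2 (λ D q → (D :* q) :^ 3 := D :^ 3 :* q :^ 3) refl (d + 2) q ⟩
  (d + 2) ^ 3 * q ^ 3 ≤⟨ *-monoˡ-≤ (q ^ 3) cubic ⟩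
  (d ∸ 1) * d * e ^ 3 * q ^ 3 ≡⟨ solve 3 (λ c e q → c :* e :^ 3 :* q :^ 3 := c :* (e :* q) :^ 3) refl ((d ∸ 1) * d) e q ⟩
  (d ∸ 1) * d * (e * q) ^ 3 <⟨ *-monoʳ-< ((d ∸ 1) * d) ⦃ >-nonZero c-pos ⦄ (cube< eq<R) ⟩
  (d ∸ 1) * d * R ^ 3 ∎)
  where
  open ≤-Reasoning
  open +-*-Solver
  R q : ℕ
  R = n ∸ a
  q = a ∸ R
  R+q : R + q ≡ a
  R+q = m+[n∸m]≡n (≮⇒≥ a≮R)
  c-pos : 1 ≤ (d ∸ 1) * d
  c-pos = *-mono-≤ (∸-monoˡ-≤ 1 (≤-trans (m≤m+n 2 17) 19≤d)) (≤-trans (s≤s z≤n) 19≤d)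
  L≡ : a * (2 * d + 4) ∸ (d + 2) * n ≡ (d + 2) * q
  L≡ = trans (cong₂ _∸_ (trans (solve 2 (λ a d → a :* (con 2 :* d :+ con 4) := (d :+ con 2) :* (a :+ a)) refl a d)
        (trans (cong (λ z → (d + 2) * (a + z)) (sym R+q)) (solve 4 (λ d a R q → (d :+ con 2) :* (a :+ (R :+ q)) := (d :+ con 2) :* (a :+ R) :+ (d :+ con 2) :* q) refl d a R q)))
      (cong ((d + 2) *_) (sym (m+[n∸m]≡n a≤n)))) (m+n∸m≡n ((d + 2) * (a + R)) ((d + 2) * q))
  eq<R : e * q < R
  eq<R = +-cancelˡ-< (e * R) _ _ (begin-strict
    e * R + e * q ≡⟨ *-distribˡ-+ e R q ⟨
    e * (R + q) ≡⟨ cong (e *_) R+q ⟩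
    e * a <⟨ lt ⟩
    R + e * R ≡⟨ +-comm R (e * R) ⟩
    e * R + R ∎)
  cubic : (d + 2) ^ 3 ≤ (d ∸ 1) * d * e ^ 3
  cubic = ≤-trans (subst (λ d → (d + 2) ^ 3 ≤ (d ∸ 1) * d * (d + 10)) (m+[n∸m]≡n 19≤d) (base (d ∸ 19))) (*-monoʳ-≤ ((d ∸ 1) * d) cube)
    where
    base : ∀ p → (19 + p + 2) ^ 3 ≤ (18 + p) * (19 + p) * (19 + p + 10)
    base p = ≤-trans (m≤m+n _ (3 * p ^ 2 + 92 * p + 657)) (≤-reflexive (solve 1 (λ p →
      (con 19 :+ p :+ con 2) :^ 3 :+ (con 3 :* p :^ 2 :+ con 92 :* p :+ con 657) := (con 18 :+ p) :* (con 19 :+ p) :* (con 19 :+ p :+ con 10)) refl p))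

theorem1p5 : (d n : ℕ) → 1 ≤ d → (G : Graph n) → Critical G
    → (∀ v → d ≤ deg G v)
    → (d + 2) ^ (5 * d + 10) ≤ maxDeg G
    → (a : ℕ) → IndependenceNumber G a
    → (d ≡ 3 → 12 * a < 7 * n)
    × (d ≡ 4 → 7 * a < 4 * n)
    × (19 ≤ d → CubeRootBound d n a)
theorem1p5 d n _ G crit d≤deg big a isα = case-3 , case-4 , case-19
  where
  open ≤-Reasoning
  open +-*-Solver
  Ratio : ℕ → Set
  Ratio E = E * a < (E + 2) * (n ∸ a) × a ≤ n
  ratio : ∀ E → 3 ≤ d → 2 ≤ E → E ≤ d + 2 →
    (∀ T → 3 ≤ T → 2 * T ≤ E → T * (3 * E + 2) + 6 * T ≤ 6 * (T * T + d)) → Ratio E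
  ratio E 3≤d 2≤E E≤D arith = independence-ratio G crit d E 3≤d 2≤E E≤D d≤deg big arith a isα
  case-3 : d ≡ 3 → 12 * a < 7 * n
  case-3 e = conclude (ratio 5 (≤-reflexive (sym e)) (m≤m+n 2 3) (+-monoˡ-≤ 2 (≤-reflexive (sym e)))
      (λ T 3≤T 2T≤5 → ⊥-elim (<⇒≱ (n<1+n 5) (≤-trans (*-monoʳ-≤ 2 3≤T) 2T≤5))))
    where
    conclude : Ratio 5 → 12 * a < 7 * n
    conclude (lt , a≤n) = begin-strict
      12 * a ≡⟨ solve 1 (λ a → con 12 :* a := con 5 :* a :+ con 7 :* a) refl a ⟩
      5 * a + 7 * a <⟨ +-monoˡ-< (7 * a) lt ⟩
      7 * (n ∸ a) + 7 * a ≡⟨ *-distribˡ-+ 7 (n ∸ a) a ⟨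
      7 * (n ∸ a + a) ≡⟨ cong (7 *_) (m∸n+n≡m a≤n) ⟩
      7 * n ∎
  case-4 : d ≡ 4 → 7 * a < 4 * n
  case-4 e = conclude (ratio 6 (≤-trans (n≤1+n 3) 4≤d) (m≤m+n 2 4) (+-monoˡ-≤ 2 4≤d) only-3)
    where
    4≤d : 4 ≤ d
    4≤d = ≤-reflexive (sym e)
    -- Only `T = 3` occurs, and for `d = 4` it gives equality: both sides are 78.
    only-3 : ∀ T → 3 ≤ T → 2 * T ≤ 6 → T * (3 * 6 + 2) + 6 * T ≤ 6 * (T * T + d)
    only-3 T 3≤T 2T≤6 = subst (λ T → T * (3 * 6 + 2) + 6 * T ≤ 6 * (T * T + d)) (≤-antisym 3≤T (*-cancelˡ-≤ 2 2T≤6))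
      (*-monoʳ-≤ 6 (+-monoʳ-≤ 9 4≤d))
    conclude : Ratio 6 → 7 * a < 4 * n
    conclude (lt , a≤n) = *-cancelˡ-< 2 _ _ (begin-strict
      2 * (7 * a) ≡⟨ solve 1 (λ a → con 2 :* (con 7 :* a) := con 6 :* a :+ con 8 :* a) refl a ⟩
      6 * a + 8 * a <⟨ +-monoˡ-< (8 * a) lt ⟩
      8 * (n ∸ a) + 8 * a ≡⟨ *-distribˡ-+ 8 (n ∸ a) a ⟨
      8 * (n ∸ a + a) ≡⟨ cong (8 *_) (m∸n+n≡m a≤n) ⟩
      8 * n ≡⟨ *-assoc 2 4 n ⟩
      2 * (4 * n) ∎)
  case-19 : 19 ≤ d → CubeRootBound d n a
  case-19 19≤d = from (root-parameter d 19≤d)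
    where
    from : (∃ λ e → 4 ≤ e × d + 10 ≤ e ^ 3 × e * e ≤ d) → CubeRootBound d n a
    from (e , 4≤e , cube , square) = conclude (ratio (2 * e) (≤-trans (m≤m+n 3 16) 19≤d) (*-monoʳ-≤ 2 (≤-trans (s≤s z≤n) 4≤e)) 2e≤D arith)
      where
      2e≤D : 2 * e ≤ d + 2
      2e≤D = ≤-trans (*-monoˡ-≤ e (≤-trans (m≤m+n 2 2) 4≤e)) (≤-trans square (m≤m+n d 2))
      -- The arithmetic-geometric mean inequality: `T * T + d` is at least `2 * T * e`, and `e`
      -- being at least 4 absorbs the lower terms.
      arith : ∀ T → 3 ≤ T → 2 * T ≤ 2 * e → T * (3 * (2 * e) + 2) + 6 * T ≤ 6 * (T * T + d)
      arith T _ _ = begin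
        T * (3 * (2 * e) + 2) + 6 * T ≡⟨ solve 2 (λ T e → T :* (con 3 :* (con 2 :* e) :+ con 2) :+ con 6 :* T := con 6 :* (T :* e) :+ con 2 :* (T :* con 4)) refl T e ⟩
        6 * (T * e) + 2 * (T * 4) ≤⟨ +-monoʳ-≤ (6 * (T * e)) (≤-trans (*-monoʳ-≤ 2 (*-monoʳ-≤ T 4≤e)) (m≤m+n _ (4 * (T * e)))) ⟩
        6 * (T * e) + (2 * (T * e) + 4 * (T * e)) ≡⟨ solve 1 (λ z → con 6 :* z :+ (con 2 :* z :+ con 4 :* z) := con 6 :* (con 2 :* z)) refl (T * e) ⟩
        6 * (2 * (T * e)) ≤⟨ *-monoʳ-≤ 6 (≤-trans (2mn≤m²+n² T e) (+-monoʳ-≤ (T * T) square)) ⟩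
        6 * (T * T + d) ∎
      conclude : Ratio (2 * e) → CubeRootBound d n a
      conclude (lt , a≤n) = cubeRootBound d e n a 19≤d cube a≤n (*-cancelˡ-< 2 _ _ (begin-strict
        2 * (e * a) ≡⟨ *-assoc 2 e a ⟨
        2 * e * a <⟨ lt ⟩
        (2 * e + 2) * (n ∸ a) ≡⟨ solve 2 (λ e R → (con 2 :* e :+ con 2) :* R := con 2 :* ((con 1 :+ e) :* R)) refl e (n ∸ a) ⟩
        2 * (suc e * (n ∸ a)) ∎))
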